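{- Let $K$ be a field that is complete with respect to a discrete valuation $v:K\to\mathbb{Z}_{\mathrm{m}0}$, and let $L/K$ be a finite extension of fields. Then there is a unique discrete valuation $w:L\to\mathbb{Z}_{\mathrm{m}0}$ extending $v$, in the sense that there is an integer $e\ge 1$ with $w(x)=v(x)^e$ for all $x\in K$. Moreover, $L$ is complete with respect to the uniform structure induced by $w$.
   Context: $\mathbb{Z}_{\mathrm{m}0}$ is the linearly ordered commutative group with zero obtained from the multiplicatively written ordered group $\mathbb{Z}$ (elements $\mathrm{of\_add}(n)$, $n\in\mathbb{Z}$, with $\mathrm{of\_add}(a+b)=\mathrm{of\_add}(a)\,\mathrm{of\_add}(b)$, ordered as $\mathbb{Z}$) by adjoining an absorbing smallest element $0$. A valuation on a commutative unitary ring $A$ is a function $v: A\to \mathbb{Z}_{\mathrm{m}0}$ with $v(0)=0$, $v(1)=1$, $v(xy)=v(x)v(y)$ and $v(x+y)\le\max\{v(x),v(y)\}$ for all $x,y$. It is called discrete if it is surjective onto $\mathbb{Z}_{\mathrm{m}0}$ (i.e. normalized); because of this normalization, a valuation on $L$ extends one on $K$ only up to rescaling by a positive integer power. A valuation induces a uniform structure for which the sets $\{x : v(x)\le\gamma\}$, $\gamma\ne 0$ in $\mathbb{Z}_{\mathrm{m}0}$, form a basis of neighborhoods of $0$, and completeness refers to this structure. -}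

module Defs where

open import Algebra.Apartness.Bundles using (HeytingField; HeytingCommutativeRing)
open import Algebra.Bundles using (CommutativeRing)
import Algebra.Definitions.RawMonoid as RawMonoidDefs
open import Algebra.Morphism.Structures using (module RingMorphisms)
open import Axiom.ExcludedMiddle using (ExcludedMiddle)
open import Data.Integer.Base as ℤ using (ℤ)
open import Data.Nat.Base as ℕ using (ℕ; zero; suc)
open import Data.Product.Base using (∃-syntax; _×_)
open import Data.Vec.Functional using (Vector)
open import Function.Definitions using (Congruent; Surjective)
open import Level using (Level; _⊔_; 0ℓ; Setω) renaming (suc to lsuc)
open import Relation.Binary.Construct.Add.Infimum.NonStrict ℤ._≤_ using (_≤₋_)
open import Relation.Binary.PropositionalEquality.Core using (_≡_; _≢_)
open import Relation.Nullary.Construct.Add.Infimum using (_₋; ⊥₋; [_])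
open import Relation.Unary using (Pred; _⊆_; _∩_; U; Satisfiable)

private
  variable
    a c ℓ c₁ ℓ₁ e₁ c₂ ℓ₂ e₂ : Level

-- Classical logic. Assumed as a hypothesis where a classical theorem is stated.
EM : Setω
EM = ∀ ℓ → ExcludedMiddle ℓ

------------------------------------------------------------------------
-- The value group with zero.
-- [ n ] is of_add(n): the group law of ℤ is written multiplicatively below,
-- so the unit is [ 0 ]. The adjoined infimum ⊥₋ is the zero element.

ℤₘ₀ : Set
ℤₘ₀ = ℤ ₋

𝟘 𝟙 : ℤₘ₀
𝟘 = ⊥₋
𝟙 = [ ℤ.0ℤ ]

infixl 7 _·_
infixl 6 _⊔₀_
infixr 8 _^_
infix  4 _≤₀_

_·_ : ℤₘ₀ → ℤₘ₀ → ℤₘ₀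
⊥₋    · _     = ⊥₋
[ _ ] · ⊥₋    = ⊥₋
[ m ] · [ n ] = [ m ℤ.+ n ]

_^_ : ℤₘ₀ → ℕ → ℤₘ₀
x ^ zero  = 𝟙
x ^ suc n = x · x ^ n

_≤₀_ : ℤₘ₀ → ℤₘ₀ → Set
_≤₀_ = _≤₋_

_⊔₀_ : ℤₘ₀ → ℤₘ₀ → ℤₘ₀
⊥₋    ⊔₀ y     = y
[ m ] ⊔₀ ⊥₋    = [ m ]
[ m ] ⊔₀ [ n ] = [ m ℤ.⊔ n ]

------------------------------------------------------------------------
-- Valuations

module _ (A : CommutativeRing c ℓ) where
  open CommutativeRing A

  record IsValuation (v : Carrier → ℤₘ₀) : Set (c ⊔ ℓ) where
    field
      v-cong : Congruent _≈_ _≡_ v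
      v-0    : v 0# ≡ 𝟘
      v-1    : v 1# ≡ 𝟙
      v-*    : ∀ x y → v (x * y) ≡ v x · v y
      v-+    : ∀ x y → v (x + y) ≤₀ v x ⊔₀ v y

  record IsDiscreteValuation (v : Carrier → ℤₘ₀) : Set (c ⊔ ℓ) where
    field
      isValuation : IsValuation v
      surjective  : Surjective _≈_ _≡_ v
    open IsValuation isValuation public

------------------------------------------------------------------------
-- Completeness of the uniform structure induced by a valuation

-- Proper filters of subsets. In the presence of excluded middle every type,
-- seen as a proposition, is logically equivalent to one in Set, so working
-- with subsets and families of subsets valued in Set loses no generality.
record IsFilter {A : Set a} (F : Pred (Pred A 0ℓ) 0ℓ) : Set (a ⊔ lsuc 0ℓ) where
  field
    universal : F U
    upward    : ∀ {S T} → S ⊆ T → F S → F T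
    inter     : ∀ {S T} → F S → F T → F (S ∩ T)
    proper    : ∀ {S} → F S → Satisfiable S

module _ (A : CommutativeRing c ℓ) (v : CommutativeRing.Carrier A → ℤₘ₀) where
  open CommutativeRing A

  -- For γ ≢ 𝟘 these form a basis of the uniformity: they are the entourages
  -- attached to the basic neighbourhoods {x : v x ≤ γ} of 0.
  Entourage : ℤₘ₀ → Carrier → Carrier → Set
  Entourage γ x y = v (x - y) ≤₀ γ

  IsCauchy : Pred (Pred Carrier 0ℓ) 0ℓ → Set (c ⊔ lsuc 0ℓ)
  IsCauchy F = ∀ γ → γ ≢ 𝟘 →
    ∃[ S ] F S × (∀ {x y} → S x → S y → Entourage γ x y)

  ConvergesTo : Pred (Pred Carrier 0ℓ) 0ℓ → Carrier → Set
  ConvergesTo F a = ∀ γ → γ ≢ 𝟘 → F (λ x → Entourage γ x a)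

  -- Subsets are not required to respect _≈_. This is harmless: _≈_-related
  -- points have the same entourage neighbourhoods.
  IsComplete : Set (c ⊔ lsuc 0ℓ)
  IsComplete = ∀ F → IsFilter F → IsCauchy F → ∃[ a ] ConvergesTo F a

------------------------------------------------------------------------
-- Fields and finite extensions

-- Under excluded middle a Heyting field is the same thing as a field, its
-- apartness being the negation of _≈_.
⟦_⟧ : HeytingField c ℓ a → CommutativeRing c ℓ
⟦ K ⟧ = HeytingCommutativeRing.commutativeRing
          (HeytingField.heytingCommutativeRing K)

module _ (K : HeytingField c₁ ℓ₁ e₁) (L : HeytingField c₂ ℓ₂ e₂) where
  private
    module K = CommutativeRing ⟦ K ⟧
    module L = CommutativeRing ⟦ L ⟧
  open RingMorphisms K.rawRing L.rawRing using (IsRingHomomorphism)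

  linComb : (K.Carrier → L.Carrier) →
            ∀ {n} → Vector L.Carrier n → Vector K.Carrier n → L.Carrier
  linComb ι b k = RawMonoidDefs.sum L.+-rawMonoid (λ i → ι (k i) L.* b i)

  record IsBasis (ι : K.Carrier → L.Carrier) {n : ℕ} (b : Vector L.Carrier n)
         : Set (c₁ ⊔ ℓ₁ ⊔ c₂ ⊔ ℓ₂) where
    field
      spanning    : ∀ x → ∃[ k ] x L.≈ linComb ι b k
      independent : ∀ k → linComb ι b k L.≈ L.0# → ∀ i → k i K.≈ K.0#

  -- L is an extension of K via ι, of finite dimension as a K-vector space.
  record IsFiniteExtension (ι : K.Carrier → L.Carrier)
         : Set (c₁ ⊔ ℓ₁ ⊔ c₂ ⊔ ℓ₂) where
    field
      isRingHomomorphism : IsRingHomomorphism ι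
      degree             : ℕ
      basis              : Vector L.Carrier degree
      isBasis            : IsBasis ι basis

  Extends : (K.Carrier → L.Carrier) →
            (K.Carrier → ℤₘ₀) → (L.Carrier → ℤₘ₀) → Set c₁
  Extends ι v w = ∃[ e ] 1 ℕ.≤ e × (∀ x → w (ι x) ≡ v x ^ e)

{-# OPTIONS --safe #-}
module Submission where

-- Let O be the valuation ring of K, π a uniformiser and M₀ ⊆ L the O-span of a basis.
-- An element of L is power bounded if π^m y^n ∈ M₀ for some m and all n; equivalently, it
-- stabilises an O-lattice commensurable with M₀, so the power bounded elements form a ring R
-- (the integral closure of O).  Completeness enters by lifting idempotents with Newton's
-- iteration e ↦ 3e² - 2e³: since L is a field, an e ∈ R with e ≡ e² (mod π) is 0 or 1 (mod π).
-- A primitive linear relation between the powers of x ∈ R produces such an e, showing that x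
-- is a unit of R or that some power of x lies in πR.  Hence R is local, and being integrally
-- closed it is a valuation ring.  If its maximal ideal were not principal, it would contain an
-- infinite chain of strictly increasing divisibility starting at π, and dim L + 1 members of
-- the chain would be linearly independent over K.  A generator of the ideal defines w.  For
-- completeness one bounds R inside π^-c M₀, by induction on the number of basis vectors.
-- Any other extension w′ is bounded on M₀, hence w′ ≤ 1 on R, which forces w′ = w.

open import Defs hiding (_^_)
open import Defs using () renaming (_^_ to _^₀_)
open import Algebra.Apartness.Bundles using (HeytingField)
open import Algebra.Bundles using (CommutativeRing)
open import Algebra.Morphism.Structures using (module RingMorphisms)
open import Data.Empty using (⊥; ⊥-elim)
open import Data.Fin.Base as Fin using (Fin; zero; suc; punchIn; punchOut)
import Data.Fin.Properties as Fin
open import Data.Integer.Base as ℤ using (ℤ; -[1+_])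
import Data.Integer.Properties as ℤ
open import Data.List.Base as List using (List; []; _∷_; tabulate)
open import Data.List.Relation.Unary.All as All using (All; []; _∷_)
import Data.List.Relation.Unary.All.Properties as All
open import Data.List.Relation.Unary.Any as Any using (Any; here; there)
import Data.List.Relation.Unary.Any.Properties as Any
open import Data.Maybe.Base as Maybe using (Maybe)
open import Data.Nat.Base as ℕ using (ℕ; zero; suc)
import Data.Nat.Properties as ℕ
open import Data.Product using (Σ-syntax; ∃; ∃!; ∃-syntax; _×_; _,_; proj₁; proj₂)
import Data.Sign.Base as Sign
open import Data.Sum.Base using (_⊎_; inj₁; inj₂) renaming ([_,_]′ to ⊎-elim)
import Data.Vec.Functional as Vector
open Vector using (Vector)
open import Function.Base using (id; _∘_)
open import Level using (Level; _⊔_; 0ℓ) renaming (suc to lsuc)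
open import Relation.Binary.Construct.Add.Infimum.NonStrict ℤ._≤_
  using (⊥₋≤_; [_]; [≤]-injective; ≤₋-trans; ≤₋-total)
open import Relation.Binary.PropositionalEquality as ≡ using (_≡_; _≢_; _≗_)
open import Relation.Nullary using (¬_; Dec; yes; no; ¬?; decidable-stable)
open import Relation.Nullary.Construct.Add.Infimum using (⊥₋; [_])
open import Relation.Nullary.Decidable using (dec⇒maybe)
open import Relation.Unary using (Pred; _∩_)

-- The value group with zero

-- L/K may be inseparable, so traces and discriminants cannot control the integral closure. The
-- argument works instead with boundedness and linear relations, and `DVRLattice` collects what it
-- takes from K. Closure of R under sums and products follows from a lattice stabilised by both
-- elements, since the stabiliser of a lattice is a ring; no monic equations are manipulated. M₀
-- need not be a ring, nor comparable with R by inclusion. Passing between M₀, R and stabilisers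
-- therefore costs a fixed power of π each time, which is the origin of the many exponents m; a
-- fixed loss does not affect convergence. The polynomial f = 3e² - 2e³ satisfies f = e²(3 - 2e) and
-- 1 - f = (1 - e)²(1 + 2e), so f - f² is a multiple of (e - e²)² and the defect is squared at each
-- iteration. The chain argument is the inequality between ramification index and degree in
-- disguise: elements whose values are distinct and lie between those of π (included) and 1
-- (excluded) have distinct values modulo the value of π, hence are independent over K.

≤₀-refl : ∀ {x} → x ≤₀ x
≤₀-refl {⊥₋}    = ⊥₋≤ ⊥₋
≤₀-refl {[ m ]} = [ ℤ.≤-refl ]

≤₀-reflexive : ∀ {x y} → x ≡ y → x ≤₀ y
≤₀-reflexive ≡.refl = ≤₀-refl

≤₀-trans : ∀ {x y z} → x ≤₀ y → y ≤₀ z → x ≤₀ z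
≤₀-trans = ≤₋-trans ℤ.≤-trans

≤₀-total : ∀ x y → x ≤₀ y ⊎ y ≤₀ x
≤₀-total = ≤₋-total ℤ.≤-total

x≤₀x⊔y : ∀ x y → x ≤₀ x ⊔₀ y
x≤₀x⊔y ⊥₋    y     = ⊥₋≤ y
x≤₀x⊔y [ m ] ⊥₋    = ≤₀-refl
x≤₀x⊔y [ m ] [ n ] = [ ℤ.i≤i⊔j m n ]

y≤₀x⊔y : ∀ x y → y ≤₀ x ⊔₀ y
y≤₀x⊔y ⊥₋    y     = ≤₀-refl
y≤₀x⊔y [ m ] ⊥₋    = ⊥₋≤ _
y≤₀x⊔y [ m ] [ n ] = [ ℤ.i≤j⊔i m n ]

⊔₀-lub : ∀ {x y z} → x ≤₀ z → y ≤₀ z → x ⊔₀ y ≤₀ z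
⊔₀-lub (⊥₋≤ _) q       = q
⊔₀-lub [ p ]   (⊥₋≤ _) = [ p ]
⊔₀-lub [ p ]   [ q ]   = [ ℤ.⊔-lub p q ]

·-mono-≤₀ : ∀ {x y z w} → x ≤₀ y → z ≤₀ w → x · z ≤₀ y · w
·-mono-≤₀ (⊥₋≤ _) q       = ⊥₋≤ _
·-mono-≤₀ [ p ]   (⊥₋≤ _) = ⊥₋≤ _
·-mono-≤₀ [ p ]   [ q ]   = [ ℤ.+-mono-≤ p q ]

·-comm : ∀ x y → x · y ≡ y · x
·-comm ⊥₋    ⊥₋    = ≡.refl
·-comm ⊥₋    [ n ] = ≡.refl
·-comm [ m ] ⊥₋    = ≡.refl
·-comm [ m ] [ n ] = ≡.cong [_] (ℤ.+-comm m n)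

·-identityˡ : ∀ x → 𝟙 · x ≡ x
·-identityˡ ⊥₋    = ≡.refl
·-identityˡ [ m ] = ≡.cong [_] (ℤ.+-identityˡ m)

·-identityʳ : ∀ x → x · 𝟙 ≡ x
·-identityʳ x = ≡.trans (·-comm x 𝟙) (·-identityˡ x)

·-𝟘 : ∀ x → x · 𝟘 ≡ 𝟘
·-𝟘 x = ·-comm x 𝟘

·-≤𝟙 : ∀ {x y} → x ≤₀ 𝟙 → y ≤₀ 𝟙 → x · y ≤₀ 𝟙
·-≤𝟙 = ·-mono-≤₀

·-decreasing : ∀ x {y} → y ≤₀ 𝟙 → x · y ≤₀ x
·-decreasing x y≤𝟙 = ≤₀-trans (·-mono-≤₀ (≤₀-refl {x}) y≤𝟙) (≤₀-reflexive (·-identityʳ x))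

[]-^₀ : ∀ m n → [ m ] ^₀ n ≡ [ ℤ.+ n ℤ.* m ]
[]-^₀ m zero    = ≡.cong [_] (≡.sym (ℤ.*-zeroˡ m))
[]-^₀ m (suc n) = ≡.trans (≡.cong ([ m ] ·_) ([]-^₀ m n)) (≡.cong [_] (≡.sym (ℤ.suc-* (ℤ.+ n) m)))

[]-injective : ∀ {m n : ℤ} → [ m ] ≡ [ n ] → m ≡ n
[]-injective ≡.refl = ≡.refl

[]≢𝟘 : ∀ {m} → [ m ] ≢ 𝟘
[]≢𝟘 ()

·-inverse-unique : ∀ {x j} → x · [ j ] ≡ 𝟙 → x ≡ [ ℤ.- j ]
·-inverse-unique {[ i ]} {j} eq = ≡.cong [_] (ℤ.i-j≡0⇒i≡j i (ℤ.- j)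
  (≡.trans (≡.cong (ℤ._+_ i) (ℤ.neg-involutive j)) ([]-injective eq)))

-- ℤ has no 2-torsion; this gives -1 the value `𝟙`.
square-≡𝟙 : ∀ x → x · x ≡ 𝟙 → x ≡ 𝟙
square-≡𝟙 [ ℤ.+ zero ]  eq = ≡.refl
square-≡𝟙 [ ℤ.+ suc n ] ()
square-≡𝟙 [ -[1+ n ] ]  ()

neg-∣∣≤ : ∀ g → ℤ.- (ℤ.+ ℤ.∣ g ∣) ℤ.≤ g
neg-∣∣≤ (ℤ.+ zero)  = ℤ.≤-refl
neg-∣∣≤ (ℤ.+ suc n) = ℤ.-≤+
neg-∣∣≤ -[1+ n ]    = ℤ.≤-refl

^₀-≤𝟙 : ∀ {x} n → x ≤₀ 𝟙 → x ^₀ n ≤₀ 𝟙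
^₀-≤𝟙 zero    x≤ = ≤₀-refl
^₀-≤𝟙 (suc n) x≤ = ·-≤𝟙 x≤ (^₀-≤𝟙 n x≤)

-- Only 1 and -1 are invertible in ℤ, and the sign condition decides. This determines the factor by
-- which two normalised valuations could differ.
integer-inverse : ∀ i s → i ℤ.* s ≡ ℤ.1ℤ → s ℤ.≤ ℤ.0ℤ → s ≡ ℤ.-1ℤ
integer-inverse i s is≡1 s≤0 =
    go s s≤0 (ℕ.m*n≡1⇒n≡1 ℤ.∣ i ∣ ℤ.∣ s ∣ (≡.trans (≡.sym (ℤ.abs-* i s)) (≡.cong ℤ.∣_∣ is≡1)))
  where
  go : ∀ s → s ℤ.≤ ℤ.0ℤ → ℤ.∣ s ∣ ≡ 1 → s ≡ ℤ.-1ℤ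
  go (ℤ.+ n)    (ℤ.+≤+ ℕ.z≤n) ()
  go -[1+ n ] _             eq = ≡.cong -[1+_] (ℕ.suc-injective eq)

i≤∣i∣ : ∀ i → i ℤ.≤ ℤ.+ ℤ.∣ i ∣
i≤∣i∣ (ℤ.+ n)  = ℤ.≤-refl
i≤∣i∣ -[1+ n ] = ℤ.-≤+

-- The archimedean property of ℤ, which turns a uniform bound on all powers of an element into a
-- bound by `𝟙`. The multiple `suc ∣ b ∣` refutes a positive j.
bounded-multiples : ∀ j b → (∀ n → ℤ.+ n ℤ.* j ℤ.≤ b) → j ℤ.≤ ℤ.0ℤ
bounded-multiples (ℤ.+ zero)  b h = ℤ.≤-refl
bounded-multiples -[1+ n ]    b h = ℤ.-≤+
bounded-multiples (ℤ.+ suc k) b h = ⊥-elim (ℕ.1+n≰n (ℤ.drop‿+≤+ (ℤ.≤-trans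
  (≡.subst (ℤ.+ suc ℤ.∣ b ∣ ℤ.≤_) (ℤ.pos-* (suc ℤ.∣ b ∣) (suc k))
      (ℤ.+≤+ (ℕ.m≤m*n (suc ℤ.∣ b ∣) (suc k))))
  (ℤ.≤-trans (h (suc ℤ.∣ b ∣)) (i≤∣i∣ b)))))

units-≤𝟙 : ∀ {x y} → x ≤₀ 𝟙 → y ≤₀ 𝟙 → x · y ≡ 𝟙 → x ≡ 𝟙
units-≤𝟙 {[ i ]} {[ j ]} [ i≤0 ] [ j≤0 ] eq = ≡.cong [_] (ℤ.≤-antisym i≤0
  (≡.subst₂ ℤ._≤_ ([]-injective eq) (ℤ.+-identityʳ i) (ℤ.+-monoʳ-≤ i j≤0)))
units-≤𝟙 {⊥₋}    {_}  _ _ ()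
units-≤𝟙 {[ i ]} {⊥₋} _ _ ()

-- Ring solver with integer coefficients

module Solver {c ℓ : Level} (R : CommutativeRing c ℓ) where
  open CommutativeRing R
  open import Algebra.Solver.Ring.AlmostCommutativeRing
    using (fromCommutativeRing; _-Raw-AlmostCommutative⟶_)
  open import Algebra.Properties.Semiring.Mult.TCOptimised semiring
    using (×-homo-+; ×1-homo-*; 1+×) renaming (_×_ to _×ₙ_)
  open import Algebra.Properties.Ring ring
  open import Algebra.Properties.AbelianGroup +-abelianGroup using (⁻¹-∙-comm)
  open import Relation.Binary.Reasoning.Setoid setoid
  open import Algebra.Properties.CommutativeSemigroup +-commutativeSemigroup using (interchange)

  -- Integer coefficients have decidable equality, so the solver can cancel terms although `_≈_`
  -- need not be decidable. With the optimised multiples, 0 and 1 compute to `0#` and `1#`.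
  fromℤ : ℤ → Carrier
  fromℤ (ℤ.+ n)  = n ×ₙ 1#
  fromℤ -[1+ n ] = - (suc n ×ₙ 1#)

  fromℤ-⊖ : ∀ m n → fromℤ (m ℤ.⊖ n) ≈ m ×ₙ 1# - n ×ₙ 1#
  fromℤ-⊖ m zero = begin
    m ×ₙ 1#      ≈⟨ +-identityʳ _ ⟨
    m ×ₙ 1# + 0# ≈⟨ +-congˡ -0#≈0# ⟨
    m ×ₙ 1# - 0# ∎
  fromℤ-⊖ zero (suc n) = sym (+-identityˡ _)
  fromℤ-⊖ (suc m) (suc n) = begin
    fromℤ (suc m ℤ.⊖ suc n)              ≡⟨ ≡.cong fromℤ (ℤ.[1+m]⊖[1+n]≡m⊖n m n) ⟩
    fromℤ (m ℤ.⊖ n)                      ≈⟨ fromℤ-⊖ m n ⟩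
    m ×ₙ 1# - n ×ₙ 1#                    ≈⟨ +-identityˡ _ ⟨
    0# + (m ×ₙ 1# - n ×ₙ 1#)             ≈⟨ +-congʳ (-‿inverseʳ 1#) ⟨
    (1# - 1#) + (m ×ₙ 1# - n ×ₙ 1#)      ≈⟨ interchange _ _ _ _ ⟩
    (1# + m ×ₙ 1#) + (- 1# - n ×ₙ 1#)    ≈⟨ +-congˡ (⁻¹-∙-comm _ _) ⟩
    (1# + m ×ₙ 1#) - (1# + n ×ₙ 1#)      ≈⟨ +-cong (1+× m 1#) (-‿cong (1+× n 1#)) ⟨
    suc m ×ₙ 1# - suc n ×ₙ 1#            ∎

  fromℤ-+ : ∀ i j → fromℤ (i ℤ.+ j) ≈ fromℤ i + fromℤ j
  fromℤ-+ (ℤ.+ m)  (ℤ.+ n)  = ×-homo-+ 1# m n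
  fromℤ-+ (ℤ.+ m)  -[1+ n ] = fromℤ-⊖ m (suc n)
  fromℤ-+ -[1+ m ] (ℤ.+ n)  = trans (fromℤ-⊖ n (suc m)) (+-comm _ _)
  fromℤ-+ -[1+ m ] -[1+ n ] = begin
    - (suc (suc (m ℕ.+ n)) ×ₙ 1#)      ≡⟨ ≡.cong (λ k → - (suc k ×ₙ 1#)) (≡.sym (ℕ.+-suc m n)) ⟩
    - ((suc m ℕ.+ suc n) ×ₙ 1#)        ≈⟨ -‿cong (×-homo-+ 1# (suc m) (suc n)) ⟩
    - (suc m ×ₙ 1# + suc n ×ₙ 1#)      ≈⟨ ⁻¹-∙-comm _ _ ⟨
    - (suc m ×ₙ 1#) - (suc n ×ₙ 1#)    ∎

  fromℤ-neg : ∀ i → fromℤ (ℤ.- i) ≈ - fromℤ i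
  fromℤ-neg (ℤ.+ zero)  = sym -0#≈0#
  fromℤ-neg (ℤ.+ suc n) = refl
  fromℤ-neg -[1+ n ]    = sym (-‿involutive _)

  fromℤ-* : ∀ i j → fromℤ (i ℤ.* j) ≈ fromℤ i * fromℤ j
  fromℤ-* (ℤ.+ m) (ℤ.+ n) = begin
    fromℤ (Sign.+ ℤ.◃ (m ℕ.* n)) ≡⟨ ≡.cong fromℤ (ℤ.+◃n≡+n (m ℕ.* n)) ⟩
    (m ℕ.* n) ×ₙ 1#              ≈⟨ ×1-homo-* m n ⟩
    m ×ₙ 1# * n ×ₙ 1#            ∎
  fromℤ-* (ℤ.+ m) -[1+ n ] = begin
    fromℤ (Sign.- ℤ.◃ (m ℕ.* suc n)) ≡⟨ ≡.cong fromℤ (ℤ.-◃n≡-n (m ℕ.* suc n)) ⟩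
    fromℤ (ℤ.- (ℤ.+ (m ℕ.* suc n)))  ≈⟨ fromℤ-neg (ℤ.+ (m ℕ.* suc n)) ⟩
    - ((m ℕ.* suc n) ×ₙ 1#)          ≈⟨ -‿cong (×1-homo-* m (suc n)) ⟩
    - (m ×ₙ 1# * suc n ×ₙ 1#)        ≈⟨ -‿distribʳ-* _ _ ⟩
    m ×ₙ 1# * - (suc n ×ₙ 1#)        ∎
  fromℤ-* -[1+ m ] (ℤ.+ n) = begin
    fromℤ (Sign.- ℤ.◃ (suc m ℕ.* n)) ≡⟨ ≡.cong fromℤ (ℤ.-◃n≡-n (suc m ℕ.* n)) ⟩
    fromℤ (ℤ.- (ℤ.+ (suc m ℕ.* n)))  ≈⟨ fromℤ-neg (ℤ.+ (suc m ℕ.* n)) ⟩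
    - ((suc m ℕ.* n) ×ₙ 1#)          ≈⟨ -‿cong (×1-homo-* (suc m) n) ⟩
    - (suc m ×ₙ 1# * n ×ₙ 1#)        ≈⟨ -‿distribˡ-* _ _ ⟩
    - (suc m ×ₙ 1#) * n ×ₙ 1#        ∎
  fromℤ-* -[1+ m ] -[1+ n ] = begin
    (suc m ℕ.* suc n) ×ₙ 1#            ≈⟨ ×1-homo-* (suc m) (suc n) ⟩
    suc m ×ₙ 1# * suc n ×ₙ 1#          ≈⟨ -‿involutive _ ⟨
    - - (suc m ×ₙ 1# * suc n ×ₙ 1#)    ≈⟨ -‿cong (-‿distribˡ-* _ _) ⟩
    - (- (suc m ×ₙ 1#) * suc n ×ₙ 1#)  ≈⟨ -‿distribʳ-* _ _ ⟩
    - (suc m ×ₙ 1#) * - (suc n ×ₙ 1#)  ∎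

  morphism : ℤ.+-*-rawRing -Raw-AlmostCommutative⟶ fromCommutativeRing R
  morphism = record
    { ⟦_⟧ = fromℤ ; +-homo = fromℤ-+ ; *-homo = fromℤ-* ; -‿homo = fromℤ-neg
    ; 0-homo = refl ; 1-homo = refl }

  fromℤ≟ : ∀ i j → Maybe (fromℤ i ≈ fromℤ j)
  fromℤ≟ i j = Maybe.map (λ eq → reflexive (≡.cong fromℤ eq)) (dec⇒maybe (i ℤ.≟ j))

  open import Algebra.Solver.Ring ℤ.+-*-rawRing (fromCommutativeRing R) morphism fromℤ≟ public
    using (solve; _:=_; _:+_; _:*_; _:-_; :-_; con; Polynomial)

  :0 :1 : ∀ {n} → Polynomial n
  :0 = con (ℤ.+ 0)
  :1 = con (ℤ.+ 1)

HasInverses : ∀ {c ℓ} → CommutativeRing c ℓ → Set (c ⊔ ℓ)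
HasInverses R = ∀ x → ¬ x ≈ 0# → ∃[ y ] x * y ≈ 1#
  where open CommutativeRing R

Nontrivial : ∀ {c ℓ} → CommutativeRing c ℓ → Set ℓ
Nontrivial R = ¬ 1# ≈ 0#
  where open CommutativeRing R

-- Lattices over a discrete valuation ring

module Spans {c ℓ : Level} (L : CommutativeRing c ℓ) where
  open CommutativeRing L hiding (zero)
  open import Algebra.Properties.Semiring.Exp semiring public
  open import Algebra.Properties.CommutativeSemiring.Exp commutativeSemiring public
    using (^-distrib-*)
  open import Algebra.Properties.Semiring.Sum semiring public

  open Solver L
  open import Relation.Binary.Reasoning.Setoid setoid

  ^-inverse : ∀ {x y} n → x * y ≈ 1# → x ^ n * y ^ n ≈ 1#
  ^-inverse zero xy = *-identityˡ 1#
  ^-inverse {x} {y} (suc n) xy = begin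
    x * x ^ n * (y * y ^ n)
      ≈⟨ solve 4 (λ x y u v → x :* u :* (y :* v) := x :* y :* (u :* v)) refl x y (x ^ n) (y ^ n) ⟩
    x * y * (x ^ n * y ^ n)   ≈⟨ *-cong xy (^-inverse n xy) ⟩
    1# * 1#                   ≈⟨ *-identityˡ 1# ⟩
    1#                        ∎

  -- The equations in the constructors make membership invariant under `_≈_`. The coefficients of an
  -- element are not determined by it, as the generators may be dependent.
  data Span {p : Level} (O : Pred Carrier p) : List Carrier → Carrier → Set (c ⊔ ℓ ⊔ p) where
    nil  : ∀ {x} → x ≈ 0# → Span O [] x
    cons : ∀ {b bs a s x} → O a → Span O bs s → x ≈ a * b + s → Span O (b ∷ bs) x

  -- Partial sums of the π-adic series with digits `d`. Completeness of O, of spans and of R is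
  -- expressed through such series.
  partial : Carrier → (ℕ → Carrier) → ℕ → Carrier
  partial π d zero    = 0#
  partial π d (suc n) = partial π d n + π ^ n * d n

  -- L is the field K[b₁, …, b_d] of the theorem, with K visible only through its valuation ring O.
  record DVRLattice (p : Level) : Set (c ⊔ ℓ ⊔ lsuc p) where
    field
      1≉0         : Nontrivial L
      inverse     : HasInverses L
      O           : Pred Carrier p
      O-resp      : ∀ {x y} → x ≈ y → O x → O y
      O-1         : O 1#
      O-+         : ∀ {x y} → O x → O y → O (x + y)
      O-*         : ∀ {x y} → O x → O y → O (x * y)
      O-neg       : ∀ {x} → O x → O (- x)
      π           : Carrier
      O-π         : O π
      π≉0         : ¬ π ≈ 0#
      O-dichotomy : ∀ {x} → O x → (∃[ y ] O y × x * y ≈ 1#) ⊎ (∃[ y ] O y × x ≈ π * y)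
      O-complete  : ∀ d → (∀ n → O (d n)) →
                    ∃[ s ] (∀ n → ∃[ r ] O r × s ≈ partial π d n + π ^ n * r)
      basis       : List Carrier
      spanning    : ∀ x → ∃[ m ] Span O basis (π ^ m * x)
      -- The linear independence of the basis enters in this form.
      separated   : ∀ x → (∀ m → ∃[ y ] Span O basis y × x ≈ π ^ m * y) → x ≈ 0#
      dim         : ℕ
      -- A linear relation over K, scaled so that its coefficients lie in O and one of them is a
      -- unit there: a primitive relation.
      dependent   : ∀ (x : Vector Carrier (suc dim)) →
                    Σ[ k ∈ Vector Carrier (suc dim) ] (∀ i → O (k i)) ×
                    (∃[ i ] ∃[ y ] O y × k i * y ≈ 1#) × sum (λ i → k i * x i) ≈ 0#

-- Valuations on a ring

module ValuationProperties {c ℓ : Level} (A : CommutativeRing c ℓ)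
    {v : CommutativeRing.Carrier A → ℤₘ₀} (isVal : IsValuation A v) where
  open CommutativeRing A hiding (zero)
  open IsValuation isVal
  open Spans A using (_^_)
  open import Algebra.Properties.Ring ring
  open Solver A

  1≉0 : ¬ 1# ≈ 0#
  1≉0 eq with ≡.trans (≡.sym v-1) (≡.trans (v-cong eq) v-0)
  ... | ()

  v-zero : ∀ {x} → x ≈ 0# → v x ≡ 𝟘
  v-zero x≈0 = ≡.trans (v-cong x≈0) v-0

  v-neg1 : v (- 1#) ≡ 𝟙
  v-neg1 = square-≡𝟙 _
      (≡.trans (≡.sym (v-* _ _)) (≡.trans (v-cong (solve 0 (:- :1 :* :- :1 := :1) refl)) v-1))

  v-neg : ∀ x → v (- x) ≡ v x
  v-neg x = ≡.trans (v-cong (sym (-1*x≈-x x)))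
      (≡.trans (v-* _ x) (≡.trans (≡.cong (_· v x) v-neg1) (·-identityˡ _)))

  v-swap : ∀ x y → v (x - y) ≡ v (y - x)
  v-swap x y = ≡.trans (v-cong (solve 2 (λ x y → x :- y := :- (y :- x)) refl x y)) (v-neg _)

  v-+-≤ : ∀ {x y γ} → v x ≤₀ γ → v y ≤₀ γ → v (x + y) ≤₀ γ
  v-+-≤ {x} {y} p r = ≤₀-trans (v-+ x y) (⊔₀-lub p r)

  v-triangle : ∀ {x y z γ} → v (x - y) ≤₀ γ → v (y - z) ≤₀ γ → v (x - z) ≤₀ γ
  v-triangle {x} {y} {z} p r =
      ≤₀-trans (≤₀-reflexive
      (v-cong (solve 3 (λ x y z → x :- z := (x :- y) :+ (y :- z)) refl x y z))) (v-+-≤ p r)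

  v-^ : ∀ x n → v (x ^ n) ≡ v x ^₀ n
  v-^ x zero    = v-1
  v-^ x (suc n) = ≡.trans (v-* x _) (≡.cong (v x ·_) (v-^ x n))

  v-inverse : ∀ {x y j} → x * y ≈ 1# → v x ≡ [ j ] → v y ≡ [ ℤ.- j ]
  v-inverse {x} {y} xy vx = ·-inverse-unique (≡.trans (≡.cong (v y ·_) (≡.sym vx))
    (≡.trans (≡.sym (v-* y x)) (≡.trans (v-cong (trans (*-comm y x) xy)) v-1)))

  v≡𝟘⇒≈0 : (∀ x → ¬ x ≈ 0# → ∃[ y ] x * y ≈ 1#) → (∀ x → Dec (x ≈ 0#)) → ∀ {x} → v x ≡ 𝟘 → x ≈ 0#
  v≡𝟘⇒≈0 inverse _≟0 {x} vx = decidable-stable (x ≟0) λ x≉0 → let y , xy = inverse x x≉0 in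
    []≢𝟘 (≡.trans (≡.sym v-1) (≡.trans (v-cong (sym xy)) (≡.trans (v-* x y) (≡.cong (_· v y) vx))))

  -- Completeness by filters and by sequences

  module _ (γ : ℕ → ℤₘ₀) (γ≢𝟘 : ∀ n → γ n ≢ 𝟘) (γ-antitone : ∀ m n → γ (m ℕ.+ n) ≤₀ γ m)
           (γ-cofinal : ∀ g → ∃[ n ] γ n ≤₀ [ g ])
           (limit : ∀ (x : ℕ → Carrier) → (∀ n → v (x (suc n) - x n) ≤₀ γ n) →
                    ∃[ a ] (∀ g → ∃[ N ] (∀ n → v (x (N ℕ.+ n) - a) ≤₀ [ g ]))) where

    module _ {F : Pred (Pred Carrier 0ℓ) 0ℓ} (filter : IsFilter F) (cauchy : IsCauchy A v F) where
      open IsFilter filter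

      small : ℕ → Pred Carrier 0ℓ
      small n = proj₁ (cauchy (γ n) (γ≢𝟘 n))

      small-close : ∀ n {x y} → small n x → small n y → v (x - y) ≤₀ γ n
      small-close n = proj₂ (proj₂ (cauchy (γ n) (γ≢𝟘 n)))

      -- The intersections are nested, so `point (suc n)` and `point n` both lie in `small n`.
      meet : ℕ → Pred Carrier 0ℓ
      meet zero    = small zero
      meet (suc n) = meet n ∩ small (suc n)

      meet∈F : ∀ n → F (meet n)
      meet∈F zero    = proj₁ (proj₂ (cauchy (γ zero) (γ≢𝟘 zero)))
      meet∈F (suc n) = inter (meet∈F n) (proj₁ (proj₂ (cauchy (γ (suc n)) (γ≢𝟘 (suc n)))))

      meet⊆small : ∀ n {x} → meet n x → small n x
      meet⊆small zero    = id
      meet⊆small (suc n) = proj₂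

      point : ℕ → Carrier
      point n = proj₁ (proper (meet∈F n))

      point∈meet : ∀ n → meet n (point n)
      point∈meet n = proj₂ (proper (meet∈F n))

      point-close : ∀ n → v (point (suc n) - point n) ≤₀ γ n
      point-close n =
          small-close n (meet⊆small n (proj₁ (point∈meet (suc n)))) (meet⊆small n (point∈meet n))

      converges : ∃[ a ] (∀ g → g ≢ 𝟘 → F (λ x → Entourage A v g x a))
      converges = a , near
        where
        a : Carrier
        a = proj₁ (limit point point-close)

        near : ∀ g → g ≢ 𝟘 → F (λ x → Entourage A v g x a)
        near ⊥₋    g≢𝟘 = ⊥-elim (g≢𝟘 ≡.refl)
        near [ g ] _ =
          let N , h = proj₂ (limit point point-close) g
              n , γn = γ-cofinal g
          -- The index `N + n` lies beyond `N`, where the points are near `a`, and beyond `n`, where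
          -- the radius is at most `[ g ]`.
          in upward (λ {x} x∈ → v-triangle {x} {point (N ℕ.+ n)} {a}
               (≤₀-trans (small-close (N ℕ.+ n) (meet⊆small (N ℕ.+ n) x∈)
                   (meet⊆small (N ℕ.+ n) (point∈meet (N ℕ.+ n))))
                 (≤₀-trans (≤₀-reflexive (≡.cong γ (ℕ.+-comm N n))) (≤₀-trans (γ-antitone n N) γn)))
               (h n))
             (meet∈F (N ℕ.+ n))

    sequentially-complete⇒complete : IsComplete A v
    sequentially-complete⇒complete F filter cauchy = converges filter cauchy

  module _ (x : ℕ → Carrier) (x-cauchy : ∀ n → v (x (suc n) - x n) ≤₀ [ ℤ.- (ℤ.+ n) ]) where

    cauchy-+ : ∀ n k → v (x (k ℕ.+ n) - x n) ≤₀ [ ℤ.- (ℤ.+ n) ]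
    cauchy-+ n zero    = ≤₀-trans (≤₀-reflexive (v-zero (-‿inverseʳ (x n)))) (⊥₋≤ _)
    cauchy-+ n (suc k) = v-triangle {y = x (k ℕ.+ n)}
      (≤₀-trans (x-cauchy (k ℕ.+ n)) [ ℤ.neg-mono-≤ (ℤ.+≤+ (ℕ.m≤n+m n k)) ]) (cauchy-+ n k)

    cauchy-≤ : ∀ {n m} → n ℕ.≤ m → v (x m - x n) ≤₀ [ ℤ.- (ℤ.+ n) ]
    cauchy-≤ {n} {m} n≤m =
        ≡.subst (λ m → v (x m - x n) ≤₀ [ ℤ.- (ℤ.+ n) ]) (ℕ.m∸n+n≡m n≤m) (cauchy-+ n (m ℕ.∸ n))

    -- The elementary filter of the sequence, through which completeness by filters yields limits of
    -- sequences.
    Tails : Pred (Pred Carrier 0ℓ) 0ℓ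
    Tails S = ∃[ N ] (∀ n → N ℕ.≤ n → S (x n))

    tails-isFilter : IsFilter Tails
    tails-isFilter = record
      { universal = 0 , λ _ _ → _
      ; upward    = λ S⊆T (N , h) → N , λ n N≤n → S⊆T (h n N≤n)
      ; inter     = λ (M , g) (N , h) → M ℕ.+ N , λ n le →
                      g n (ℕ.≤-trans (ℕ.m≤m+n M N) le) , h n (ℕ.≤-trans (ℕ.m≤n+m N M) le)
      ; proper    = λ (N , h) → x N , h N ℕ.≤-refl
      }

    tails-isCauchy : IsCauchy A v Tails
    tails-isCauchy ⊥₋    γ≢𝟘 = ⊥-elim (γ≢𝟘 ≡.refl)
    tails-isCauchy [ g ] _ = (λ y → v (y - x n) ≤₀ [ g ]) ,
      (n , λ m n≤m → ≤₀-trans (cauchy-≤ n≤m) [ neg-∣∣≤ g ]) ,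
      λ {y} {z} Sy Sz → v-triangle {y} {x n} {z} Sy (≤₀-trans (≤₀-reflexive (v-swap (x n) z)) Sz)
      where
      n : ℕ
      n = ℤ.∣ g ∣

    -- A late term is close both to the limit and to `x n`; by the ultrametric inequality the limit
    -- inherits the bound at each n without loss.
    complete⇒limit : IsComplete A v → ∃[ a ] (∀ n → v (a - x n) ≤₀ [ ℤ.- (ℤ.+ n) ])
    complete⇒limit complete = let a , conv = complete Tails tails-isFilter tails-isCauchy in
      a , λ n → let N , h = conv [ ℤ.- (ℤ.+ n) ] []≢𝟘 in
        v-triangle {a} {x (N ℕ.+ n)} {x n}
          (≤₀-trans (≤₀-reflexive (v-swap a _)) (h (N ℕ.+ n) (ℕ.m≤m+n N n)))
          (cauchy-≤ (ℕ.m≤n+m n N))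

-- Linear dependence over a field

module LinearAlgebra {c ℓ : Level} (em : ∀ {P : Set ℓ} → Dec P) (K : CommutativeRing c ℓ)
  (inverse : HasInverses K) (1≉0 : Nontrivial K) where
  open CommutativeRing K hiding (zero)
  open Spans K
  open Solver K
  open import Relation.Binary.Reasoning.Setoid setoid

  sum-zero : ∀ {n} (f : Vector Carrier n) → (∀ i → f i ≈ 0#) → sum f ≈ 0#
  sum-zero {zero}  f f≈0 = refl
  sum-zero {suc n} f f≈0 =
      trans (+-cong (f≈0 zero) (sum-zero (λ i → f (suc i)) (λ i → f≈0 (suc i)))) (+-identityˡ 0#)

  -- Gaussian elimination: if the first vector is nonzero, a pivot coordinate `p` is cleared from
  -- the others and dropped, and induction applies. A zero first vector is a relation by itself.
  linear-dependence : ∀ n (A : Fin (suc n) → Fin n → Carrier) →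
    Σ[ k ∈ Vector Carrier (suc n) ] (∃[ p ] ¬ k p ≈ 0#) × (∀ i → sum (λ j → k j * A j i) ≈ 0#)
  linear-dependence zero A = (λ _ → 1#) , (zero , 1≉0) , λ ()
  linear-dependence (suc n) A = go (Fin.any? (λ i → ¬? (em {A zero i ≈ 0#})))
    where
    Result : Set _
    Result = Σ[ k ∈ Vector Carrier (suc (suc n)) ] (∃[ p ] ¬ k p ≈ 0#) ×
        (∀ i → sum (λ j → k j * A j i) ≈ 0#)

    trivial : ¬ (∃[ i ] ¬ A zero i ≈ 0#) → Result
    trivial A₀≈0 = k , (zero , 1≉0) , λ i → trans
      (+-cong (trans (*-identityˡ _) (decidable-stable em λ ≉0 → A₀≈0 (i , ≉0)))
          (sum-zero {suc n} (λ j → k (suc j) * A (suc j) i) (λ j → zeroˡ _)))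
      (+-identityˡ 0#)
      where
      k : Vector Carrier (suc (suc n))
      k zero    = 1#
      k (suc _) = 0#

    module Eliminate (p : Fin (suc n)) {a : Carrier} (inv : A zero p * a ≈ 1#) where

      reduced : Fin (suc n) → Fin (suc n) → Carrier
      reduced j i = A (suc j) i - A (suc j) p * a * A zero i

      module _ (k′ : Vector Carrier (suc n))
          (eq : ∀ i → sum (λ j → k′ j * reduced j (punchIn p i)) ≈ 0#) where

        -- The first coefficient collects the multiples of the first vector that `reduced` subtracts
        -- from the others.
        k : Vector Carrier (suc (suc n))
        k zero    = sum (λ j → k′ j * - (A (suc j) p * a))
        k (suc j) = k′ j

        -- Coordinate `p` vanishes after elimination; any other coordinate is in the image of
        -- `punchIn p` and covered by `eq`.
        reduced-relation : ∀ i → sum (λ j → k′ j * reduced j i) ≈ 0#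
        reduced-relation i with p Fin.≟ i
        ... | yes ≡.refl = sum-zero (λ j → k′ j * reduced j i) λ j → begin
          k′ j * (A (suc j) i - A (suc j) i * a * A zero i)
            ≈⟨ solve 4 (λ k b a c → k :* (b :- b :* a :* c) := k :* (b :- b :* (c :* a)))
                 refl (k′ j) (A (suc j) i) a (A zero i) ⟩
          k′ j * (A (suc j) i - A (suc j) i * (A zero i * a))
            ≈⟨ *-congˡ (+-congˡ (-‿cong (*-congˡ inv))) ⟩
          k′ j * (A (suc j) i - A (suc j) i * 1#)
            ≈⟨ solve 2 (λ k b → k :* (b :- b :* :1) := :0) refl (k′ j) (A (suc j) i) ⟩
          0# ∎
        ... | no p≢i =
            ≡.subst (λ i → sum (λ j → k′ j * reduced j i) ≈ 0#) (Fin.punchIn-punchOut p≢i)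
            (eq (punchOut p≢i))

        relation : ∀ i → sum (λ j → k j * A j i) ≈ 0#
        relation i = begin
          sum (λ j → k′ j * - (A (suc j) p * a)) * A zero i + sum (λ j → k′ j * A (suc j) i)
            ≈⟨ +-congʳ (*-distribʳ-sum (A zero i) (λ j → k′ j * - (A (suc j) p * a))) ⟩
          sum (λ j → k′ j * - (A (suc j) p * a) * A zero i) + sum (λ j → k′ j * A (suc j) i)
            ≈⟨ ∑-distrib-+ (λ j → k′ j * - (A (suc j) p * a) * A zero i) (λ j → k′ j * A (suc j) i)
                ⟨
          sum (λ j → k′ j * - (A (suc j) p * a) * A zero i + k′ j * A (suc j) i)
            ≈⟨ sum-cong-≋ (λ j → solve 5 (λ k b a c d → k :* :- (b :* a) :* c :+ k :* d :=
                 k :* (d :- b :* a :* c))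
                 refl (k′ j) (A (suc j) p) a (A zero i) (A (suc j) i)) ⟩
          sum (λ j → k′ j * reduced j i)
            ≈⟨ reduced-relation i ⟩
          0# ∎

    go : Dec (∃[ i ] ¬ A zero i ≈ 0#) → Result
    go (no A₀≈0)  = trivial A₀≈0
    go (yes (p , ≉0)) =
      let a , inv = inverse _ ≉0
          open Eliminate p inv
          k′ , (q , k′q) , eq = linear-dependence n (λ j i → reduced j (punchIn p i))
      in k k′ eq , (suc q , k′q) , relation k′ eq

-- The ring of power bounded elements

module IntegralClosure {c ℓ p : Level} (em : EM) (L : CommutativeRing c ℓ)
    (D : Spans.DVRLattice L p) where
  open CommutativeRing L hiding (zero)
  open Spans L
  open DVRLattice D
  open Solver L
  open import Algebra.Properties.Ring ring
  open import Relation.Binary.Reasoning.Setoid setoid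

  q : Level
  q = c ⊔ ℓ ⊔ p

  O-0 : O 0#
  O-0 = O-resp (-‿inverseʳ 1#) (O-+ O-1 (O-neg O-1))

  O-^ : ∀ {x} n → O x → O (x ^ n)
  O-^ zero    Ox = O-1
  O-^ (suc n) Ox = O-* Ox (O-^ n Ox)

  π^-+ : ∀ m n x → π ^ m * (π ^ n * x) ≈ π ^ (m ℕ.+ n) * x
  π^-+ m n x = trans (sym (*-assoc _ _ _)) (*-congʳ (sym (^-homo-* π m n)))

  -- Submodules and lattices over O

  record IsSubmodule (M : Pred Carrier q) : Set q where
    field
      resp : ∀ {x y} → x ≈ y → M x → M y
      0∈   : M 0#
      +∈   : ∀ {x y} → M x → M y → M (x + y)
      *∈   : ∀ {a x} → O a → M x → M (a * x)

    -∈ : ∀ {x} → M x → M (- x)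
    -∈ Mx = resp (-1*x≈-x _) (*∈ (O-neg O-1) Mx)

    π^∈ : ∀ {x} n → M x → M (π ^ n * x)
    π^∈ n = *∈ (O-^ n O-π)

  span-isSubmodule : ∀ bs → IsSubmodule (Span O bs)
  span-isSubmodule bs = record { resp = resp ; 0∈ = zero∈ bs ; +∈ = +∈ ; *∈ = *∈ }
    where
    resp : ∀ {bs x y} → x ≈ y → Span O bs x → Span O bs y
    resp x≈y (nil x≈0)       = nil (trans (sym x≈y) x≈0)
    resp x≈y (cons Oa s x≈) = cons Oa s (trans (sym x≈y) x≈)

    zero∈ : ∀ bs → Span O bs 0#
    zero∈ []       = nil refl
    zero∈ (b ∷ bs) = cons O-0 (zero∈ bs) (solve 1 (λ b → :0 := :0 :* b :+ :0) refl b)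

    +∈ : ∀ {bs x y} → Span O bs x → Span O bs y → Span O bs (x + y)
    +∈ (nil x≈0) (nil y≈0) = nil (trans (+-cong x≈0 y≈0) (+-identityˡ 0#))
    +∈ (cons {b} {a = a} {s} Oa S x≈) (cons {a = a′} {s′} Oa′ S′ y≈) =
      cons (O-+ Oa Oa′) (+∈ S S′) (trans (+-cong x≈ y≈)
        (solve 5 (λ a a′ b s s′ → (a :* b :+ s) :+ (a′ :* b :+ s′) := (a :+ a′) :* b :+ (s :+ s′))
            refl a a′ b s s′))

    *∈ : ∀ {bs e x} → O e → Span O bs x → Span O bs (e * x)
    *∈ Oe (nil x≈0) = nil (trans (*-congˡ x≈0) (zeroʳ _))
    *∈ {e = e} Oe (cons {b} {a = a} {s} Oa S x≈) = cons (O-* Oe Oa) (*∈ Oe S) (trans (*-congˡ x≈)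
      (solve 4 (λ e a b s → e :* (a :* b :+ s) := e :* a :* b :+ e :* s) refl e a b s))

  M₀ : Pred Carrier q
  M₀ = Span O basis

  module M₀ = IsSubmodule (span-isSubmodule basis)

  abstract
    span-scale : ∀ y bs → ∃[ m ] (∀ {x} → Span O bs x → M₀ (π ^ m * (y * x)))
    span-scale y [] = 0 , λ { (nil x≈0) →
      M₀.resp (sym (trans (*-congˡ (trans (*-congˡ x≈0) (zeroʳ y))) (zeroʳ _))) M₀.0∈ }
    span-scale y (b ∷ bs) with spanning (y * b) | span-scale y bs
    ... | m , Myb | n , Mbs = m ℕ.+ n , λ { {x} (cons {a = a} {s} Oa S x≈) →
      M₀.resp (begin
        a * (π ^ n * (π ^ m * (y * b))) + π ^ m * (π ^ n * (y * s))
          ≈⟨ solve 6 (λ a u v y b s → a :* (u :* (v :* (y :* b))) :+ v :* (u :* (y :* s)) :=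
               v :* u :* (y :* (a :* b :+ s)))
               refl a (π ^ n) (π ^ m) y b s ⟩
        π ^ m * π ^ n * (y * (a * b + s)) ≈⟨ *-cong (^-homo-* π m n) (*-congˡ x≈) ⟨
        π ^ (m ℕ.+ n) * (y * x) ∎)
        (M₀.+∈ (M₀.*∈ Oa (M₀.π^∈ n Myb)) (M₀.π^∈ m (Mbs S))) }

    span-* : ∀ bs → ∃[ m ] (∀ {x z} → Span O bs x → M₀ z → M₀ (π ^ m * (x * z)))
    span-* [] = 0 , λ { (nil x≈0) _ →
      M₀.resp (sym (trans (*-congˡ (trans (*-congʳ x≈0) (zeroˡ _))) (zeroʳ _))) M₀.0∈ }
    span-* (b ∷ bs) with span-scale b basis | span-* bs
    ... | m , Mb | n , Mbs = m ℕ.+ n , λ { {x} {z} (cons {a = a} {s} Oa S x≈) Mz →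
      M₀.resp (begin
        a * (π ^ n * (π ^ m * (b * z))) + π ^ m * (π ^ n * (s * z))
          ≈⟨ solve 6 (λ a u v z b s → a :* (u :* (v :* (b :* z))) :+ v :* (u :* (s :* z)) :=
               v :* u :* ((a :* b :+ s) :* z))
               refl a (π ^ n) (π ^ m) z b s ⟩
        π ^ m * π ^ n * ((a * b + s) * z) ≈⟨ *-cong (^-homo-* π m n) (*-congʳ x≈) ⟨
        π ^ (m ℕ.+ n) * (x * z) ∎)
        (M₀.+∈ (M₀.*∈ Oa (M₀.π^∈ n (Mb Mz))) (M₀.π^∈ m (Mbs S Mz))) }

  -- Products of elements of M₀ may leave M₀, but only with a bounded denominator, because M₀ has
  -- finitely many generators.
  M₀-* : ∃[ m ] (∀ {x z} → M₀ x → M₀ z → M₀ (π ^ m * (x * z)))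
  M₀-* = span-* basis

  -- Commensurability with M₀ takes the place of finite generation. It passes to the submodules
  -- constructed below by comparing exponents, with no appeal to Noetherian arguments.
  record IsLattice (M : Pred Carrier q) : Set q where
    field
      isSubmodule : IsSubmodule M
      lower       : ∃[ m ] (∀ {x} → M₀ x → M (π ^ m * x))
      upper       : ∃[ m ] (∀ {x} → M x → M₀ (π ^ m * x))
    open IsSubmodule isSubmodule public

    abstract
      scale : ∀ y → ∃[ m ] (∀ {x} → M x → M (π ^ m * (y * x)))
      scale y with upper | span-scale y basis | lower
      ... | m , f | n , g | k , h = k ℕ.+ (n ℕ.+ m) , λ {x} Mx → resp (begin
        π ^ k * (π ^ n * (y * (π ^ m * x)))
          ≈⟨ solve 5 (λ k n m y x → k :* (n :* (y :* (m :* x))) := k :* (n :* (m :* (y :* x))))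
               refl (π ^ k) (π ^ n) (π ^ m) y x ⟩
        π ^ k * (π ^ n * (π ^ m * (y * x)))  ≈⟨ *-congˡ (π^-+ n m _) ⟩
        π ^ k * (π ^ (n ℕ.+ m) * (y * x))    ≈⟨ π^-+ k (n ℕ.+ m) _ ⟩
        π ^ (k ℕ.+ (n ℕ.+ m)) * (y * x)      ∎)
        (h (g (f Mx)))

  M₀-isLattice : IsLattice M₀
  M₀-isLattice = record
    { isSubmodule = span-isSubmodule basis
    ; lower = 0 , λ Mx → M₀.resp (sym (*-identityˡ _)) Mx
    ; upper = 0 , λ Mx → M₀.resp (sym (*-identityˡ _)) Mx }

  -- Power bounded elements and the lattices they stabilise

  PowerBounded : Pred Carrier q
  PowerBounded y = ∃[ m ] (∀ n → M₀ (π ^ m * y ^ n))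

  Stab : Pred Carrier q → Pred Carrier q
  Stab M y = ∀ {x} → M x → M (y * x)

  -- The largest submodule of M stable under y.
  saturate : Pred Carrier q → Carrier → Pred Carrier q
  saturate M y x = ∀ n → M (y ^ n * x)

  abstract
    -- Power boundedness gives the lower bound: one exponent `m₁` serves all powers of y at once.
    -- The upper bound is the case n = 0.
    saturate-isLattice : ∀ {M y} → IsLattice M → PowerBounded y → IsLattice (saturate M y)
    saturate-isLattice {M} {y} lat (m₁ , f) with M₀-* | IsLattice.lower lat | IsLattice.upper lat
    ... | m₂ , g | m₃ , h | m₄ , u = record
      { isSubmodule = record
        { resp = λ x≈y Mx n → resp (*-congˡ x≈y) (Mx n)
        ; 0∈   = λ n → resp (sym (zeroʳ _)) 0∈
        ; +∈   = λ Mx My n → resp (sym (distribˡ _ _ _)) (+∈ (Mx n) (My n))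
        ; *∈   = λ {a} {x} Oa Mx n → resp
            (solve 3 (λ a y x → a :* (y :* x) := y :* (a :* x)) refl a (y ^ n) x) (*∈ Oa (Mx n))
        }
      ; lower = m₃ ℕ.+ (m₂ ℕ.+ m₁) , λ {x} Mx n → resp (begin
        π ^ m₃ * (π ^ m₂ * (π ^ m₁ * y ^ n * x))   ≈⟨ *-congˡ (*-congˡ (*-assoc _ _ _)) ⟩
        π ^ m₃ * (π ^ m₂ * (π ^ m₁ * (y ^ n * x))) ≈⟨ *-congˡ (π^-+ m₂ m₁ _) ⟩
        π ^ m₃ * (π ^ (m₂ ℕ.+ m₁) * (y ^ n * x))   ≈⟨ π^-+ m₃ _ _ ⟩
        π ^ (m₃ ℕ.+ (m₂ ℕ.+ m₁)) * (y ^ n * x)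
          ≈⟨ solve 3 (λ a y x → a :* (y :* x) := y :* (a :* x)) refl _ (y ^ n) x ⟩
        y ^ n * (π ^ (m₃ ℕ.+ (m₂ ℕ.+ m₁)) * x)     ∎)
        (h (g (f n) Mx))
      ; upper = m₄ , λ {x} Mx → u (resp (*-identityˡ x) (Mx 0)) }
      where open IsLattice lat

  saturate-stab : ∀ {M y} → IsLattice M → Stab (saturate M y) y
  saturate-stab {M} {y} lat {x} Mx n = IsLattice.resp lat
    (solve 3 (λ y u x → y :* u :* x := u :* (y :* x)) refl y (y ^ n) x) (Mx (suc n))

  saturate-stab-other : ∀ {M y z} → IsLattice M → Stab M z → Stab (saturate M y) z
  saturate-stab-other {M} {y} {z} lat st {x} Mx n = IsLattice.resp lat
    (solve 3 (λ y u x → y :* (u :* x) := u :* (y :* x)) refl z (y ^ n) x) (st (Mx n))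

  module _ {M : Pred Carrier q} (lat : IsLattice M) where
    open IsLattice lat

    stab-resp : ∀ {x y} → x ≈ y → Stab M x → Stab M y
    stab-resp x≈y Sx Mz = resp (*-congʳ x≈y) (Sx Mz)

    stab-+ : ∀ {x y} → Stab M x → Stab M y → Stab M (x + y)
    stab-+ Sx Sy Mz = resp (sym (distribʳ _ _ _)) (+∈ (Sx Mz) (Sy Mz))

    stab-* : ∀ {x y} → Stab M x → Stab M y → Stab M (x * y)
    stab-* Sx Sy Mz = resp (sym (*-assoc _ _ _)) (Sx (Sy Mz))

    stab-O : ∀ {x} → O x → Stab M x
    stab-O Ox Mz = *∈ Ox Mz

    stab-neg : ∀ {x} → Stab M x → Stab M (- x)
    stab-neg Sx = stab-resp (-1*x≈-x _) (stab-* (stab-O (O-neg O-1)) Sx)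

    stab-^ : ∀ {x} n → Stab M x → Stab M (x ^ n)
    stab-^ zero    Sx = stab-O O-1
    stab-^ (suc n) Sx = stab-* Sx (stab-^ n Sx)

    -- A fixed multiple of 1 lies in `M`; applying y to it gives that multiple of y in `M`.
    stab-upper : ∃[ m ] (∀ {y} → Stab M y → M₀ (π ^ m * y))
    stab-upper with spanning 1# | lower | upper
    ... | m , M1 | n , f | k , g = k ℕ.+ (n ℕ.+ m) , λ {y} Sy → M₀.resp (begin
      π ^ k * (y * (π ^ n * (π ^ m * 1#)))
        ≈⟨ solve 4 (λ k y n m → k :* (y :* (n :* (m :* :1))) := k :* (n :* (m :* y))) refl _ y _ _ ⟩
      π ^ k * (π ^ n * (π ^ m * y))        ≈⟨ *-congˡ (π^-+ n m y) ⟩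
      π ^ k * (π ^ (n ℕ.+ m) * y)          ≈⟨ π^-+ k _ y ⟩
      π ^ (k ℕ.+ (n ℕ.+ m)) * y            ∎)
      (g (Sy (f M1)))

    stab-lower : ∃[ m ] (∀ {y} → M₀ y → Stab M (π ^ m * y))
    stab-lower with upper | M₀-* | lower
    ... | m , f | n , g | k , h = k ℕ.+ (n ℕ.+ m) , λ {y} My {x} Mx → resp (begin
      π ^ k * (π ^ n * (y * (π ^ m * x)))
        ≈⟨ solve 5 (λ k n y m x → k :* (n :* (y :* (m :* x))) := k :* (n :* (m :* (y :* x))))
             refl _ _ y _ x ⟩
      π ^ k * (π ^ n * (π ^ m * (y * x)))  ≈⟨ *-congˡ (π^-+ n m _) ⟩
      π ^ k * (π ^ (n ℕ.+ m) * (y * x))    ≈⟨ π^-+ k _ _ ⟩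
      π ^ (k ℕ.+ (n ℕ.+ m)) * (y * x)      ≈⟨ *-assoc _ _ _ ⟨
      π ^ (k ℕ.+ (n ℕ.+ m)) * y * x        ∎)
      (h (g My (f Mx)))

    abstract
      -- The powers of y stabilise `M` as well, so the single exponent of `stab-upper` bounds them
      -- all.
      stab⇒powerBounded : ∀ {y} → Stab M y → PowerBounded y
      stab⇒powerBounded Sy = let m , f = stab-upper in m , λ n → f (stab-^ n Sy)

  abstract
    -- Saturation with respect to one element preserves stability under the others, since
    -- multiplication is commutative. Finitely many power bounded elements are thus treated inside
    -- one stabiliser, which is a ring.
    common : ∀ {ys} → All PowerBounded ys → Σ[ M ∈ Pred Carrier q ] IsLattice M × All (Stab M) ys
    common []         = M₀ , M₀-isLattice , []
    common {y ∷ _} (py ∷ ps) with common ps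
    ... | M , lat , ss = saturate M y , saturate-isLattice lat py ,
          saturate-stab lat ∷ All.map (saturate-stab-other lat) ss

  module CommonStabiliser {x y} (px : PowerBounded x) (py : PowerBounded y) where
    lat : IsLattice (proj₁ (common (px ∷ py ∷ [])))
    lat = proj₁ (proj₂ (common (px ∷ py ∷ [])))

    sx : Stab (proj₁ (common (px ∷ py ∷ []))) x
    sx = All.head (proj₂ (proj₂ (common (px ∷ py ∷ []))))

    sy : Stab (proj₁ (common (px ∷ py ∷ []))) y
    sy = All.head (All.tail (proj₂ (proj₂ (common (px ∷ py ∷ [])))))

  abstract
    PB-resp : ∀ {x y} → x ≈ y → PowerBounded x → PowerBounded y
    PB-resp x≈y (m , f) = m , λ n → M₀.resp (*-congˡ (^-congˡ n x≈y)) (f n)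

    PB-+ : ∀ {x y} → PowerBounded x → PowerBounded y → PowerBounded (x + y)
    PB-+ px py = stab⇒powerBounded lat (stab-+ lat sx sy)
      where open CommonStabiliser px py

    PB-* : ∀ {x y} → PowerBounded x → PowerBounded y → PowerBounded (x * y)
    PB-* px py = stab⇒powerBounded lat (stab-* lat sx sy)
      where open CommonStabiliser px py

  PB-O : ∀ {x} → O x → PowerBounded x
  PB-O Ox = stab⇒powerBounded M₀-isLattice (stab-O M₀-isLattice Ox)

  PB-neg : ∀ {x} → PowerBounded x → PowerBounded (- x)
  PB-neg px = PB-resp (-1*x≈-x _) (PB-* (PB-O (O-neg O-1)) px)

  PB-1 : PowerBounded 1#
  PB-1 = PB-O O-1

  PB-^ : ∀ {x} n → PowerBounded x → PowerBounded (x ^ n)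
  PB-^ zero    px = PB-1
  PB-^ (suc n) px = PB-* px (PB-^ n px)

  -- Polynomial relations and integrality

  eval : List Carrier → Carrier → Carrier
  eval []       x = 0#
  eval (a ∷ as) x = a + x * eval as x

  -- The z for which z, x z, ..., x ^ n z all lie in `M`. When y is inverse to x, this is the
  -- intersection of M, y M, ..., y ^ n M.
  Powers : Pred Carrier q → Carrier → ℕ → Pred Carrier q
  Powers M x zero    z = M z
  Powers M x (suc n) z = M z × Powers M x n (x * z)

  abstract
    powers-isLattice : ∀ {M x} → IsLattice M → ∀ n → IsLattice (Powers M x n)
    powers-isLattice lat zero = lat
    powers-isLattice {M} {x} lat (suc n) = record
      { isSubmodule = record
        { resp = λ eq (Mz , Nz) → M.resp eq Mz , N.resp (*-congˡ eq) Nz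
        ; 0∈   = M.0∈ , N.resp (sym (zeroʳ x)) N.0∈
        ; +∈   = λ (Mz , Nz) (Mw , Nw) → M.+∈ Mz Mw , N.resp (sym (distribˡ _ _ _)) (N.+∈ Nz Nw)
        ; *∈   = λ {a} {z} Oa (Mz , Nz) → M.*∈ Oa Mz ,
                   N.resp (solve 3 (λ a x z → a :* (x :* z) := x :* (a :* z)) refl a x z)
                       (N.*∈ Oa Nz)
        }
      ; lower =
          let m₁ , f = M.lower
              m₂ , g = N.lower
              m₃ , h = N.scale x
          in (m₃ ℕ.+ m₂) ℕ.+ m₁ , λ {z} Mz →
            M.resp (π^-+ (m₃ ℕ.+ m₂) m₁ z) (M.π^∈ (m₃ ℕ.+ m₂) (f Mz)) ,
            N.resp (begin
              π ^ m₁ * (π ^ m₃ * (x * (π ^ m₂ * z)))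
                ≈⟨ solve 5 (λ u v x w z → u :* (v :* (x :* (w :* z))) := x :* (v :* w :* u :* z))
                     refl (π ^ m₁) (π ^ m₃) x (π ^ m₂) z ⟩
              x * (π ^ m₃ * π ^ m₂ * π ^ m₁ * z)
                ≈⟨ *-congˡ
                    (*-congʳ (trans (^-homo-* π (m₃ ℕ.+ m₂) m₁) (*-congʳ (^-homo-* π m₃ m₂)))) ⟨
              x * (π ^ (m₃ ℕ.+ m₂ ℕ.+ m₁) * z)  ∎)
              (N.π^∈ m₁ (h (g Mz)))
      ; upper = let m , f = M.upper in m , λ (Mz , _) → f Mz
      }
      where
      module M = IsLattice lat
      module N = IsLattice (powers-isLattice {M} {x} lat n)

  powers-drop : ∀ {M x} n {z} → Powers M x (suc n) z → Powers M x n z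
  powers-drop zero    (Mz , _)  = Mz
  powers-drop (suc n) (Mz , Nz) = Mz , powers-drop n Nz

  powers-stab : ∀ {M x c} → IsLattice M → ∀ n → Stab M c → Stab (Powers M x n) c
  powers-stab lat zero    Sc Mz = Sc Mz
  powers-stab {M} {x} {c} lat (suc n) Sc {z} (Mz , Nz) = Sc Mz ,
    IsLattice.resp (powers-isLattice lat n)
      (solve 3 (λ c x z → c :* (x :* z) := x :* (c :* z)) refl c x z) (powers-stab lat n Sc Nz)

  powers-eval : ∀ {M x as z} → IsLattice M → All (Stab M) as → Powers M x (List.length as) z →
                  M (eval as x * z)
  powers-eval lat [] _ = IsLattice.resp lat (sym (zeroˡ _)) (IsLattice.0∈ lat)
  powers-eval {M} {x} {a ∷ as} {z} lat (Sa ∷ Sas) Nz = IsLattice.resp lat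
    (solve 4 (λ a x e z → a :* z :+ e :* (x :* z) := (a :+ x :* e) :* z) refl a x (eval as x) z)
    (IsLattice.+∈ lat (Sa (proj₁ Nz)) (powers-eval lat Sas (proj₂ Nz)))

  -- The equation gives c y = - `eval as x`, which sends the lattice into `M`. Multiplying by x
  -- undoes y: x (c y z) = c z, which lies in the lattice with one power fewer because c stabilises
  -- it.
  leading-stab : ∀ {M c as x y} → IsLattice M → Stab M c → All (Stab M) as →
                 x * y ≈ 1# → c + x * eval as x ≈ 0# → Stab (Powers M x (List.length as)) (c * y)
  leading-stab {M} {c} {as} {x} {y} lat Sc Sas xy eq {z} = stable (List.length as) z Mcyz
    where
    open IsLattice lat

    cy : - eval as x ≈ c * y
    cy = begin
      - eval as x
        ≈⟨ solve 2 (λ e y → :- e := :0 :* y :- :1 :* e) refl (eval as x) y ⟩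
      0# * y - 1# * eval as x                  ≈⟨ +-cong (*-congʳ eq) (-‿cong (*-congʳ xy)) ⟨
      (c + x * eval as x) * y - x * y * eval as x
        ≈⟨ solve 4 (λ c x e y → (c :+ x :* e) :* y :- x :* y :* e := c :* y)
             refl c x (eval as x) y ⟩
      c * y                                  ∎

    Mcyz : ∀ {z} → Powers M x (List.length as) z → M (c * y * z)
    Mcyz {z} Nz =
        resp (trans (-‿distribˡ-* (eval as x) z) (*-congʳ cy)) (-∈ (powers-eval lat Sas Nz))

    stable : ∀ k z → (Powers M x k z → M (c * y * z)) → Powers M x k z → Powers M x k (c * y * z)
    stable zero    z h Nz = h Nz
    stable (suc k) z h Nz = h Nz , IsLattice.resp (powers-isLattice lat k) (begin
      c * z             ≈⟨ *-congʳ (*-identityˡ c) ⟨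
      1# * c * z        ≈⟨ *-congʳ (*-congʳ xy) ⟨
      x * y * c * z
        ≈⟨ solve 4 (λ x y c z → x :* y :* c :* z := x :* (c :* y :* z)) refl x y c z ⟩
      x * (c * y * z)   ∎)
      (powers-stab lat k Sc (powers-drop k Nz))

  abstract
    -- For a polynomial equation c + a₁ x + a₂ x² + … = 0, lowest coefficient first, so that with
    -- y = x⁻¹ the coefficient c is the leading one of the equation satisfied by y.
    leading-integral : ∀ {c as x y} → PowerBounded c → All PowerBounded as →
                       x * y ≈ 1# → c + x * eval as x ≈ 0# → PowerBounded (c * y)
    leading-integral {c} {as} {x} pc pas xy eq = let M , lat , ss = common (pc ∷ pas) in
      stab⇒powerBounded (powers-isLattice {M} {x} lat (List.length as))
          (leading-stab lat (All.head ss) (All.tail ss) xy eq)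

  -- Units of R

  π-nonunit : ∀ {b} → PowerBounded b → ¬ π * b ≈ 1#
  -- Of the `m + n` factors π, m are spent on putting the power of b into M₀ and n remain outside.
  -- So 1 is divisible by every power of π, against `separated`.
  π-nonunit {b} (m , f) πb = 1≉0 (separated 1# λ n → π ^ m * b ^ (m ℕ.+ n) , f (m ℕ.+ n) , (begin
    1#                                ≈⟨ ^-inverse (m ℕ.+ n) πb ⟨
    π ^ (m ℕ.+ n) * b ^ (m ℕ.+ n)     ≈⟨ *-congʳ (^-homo-* π m n) ⟩
    π ^ m * π ^ n * b ^ (m ℕ.+ n)
      ≈⟨ solve 3 (λ u v w → u :* v :* w := v :* (u :* w)) refl _ _ _ ⟩
    π ^ n * (π ^ m * b ^ (m ℕ.+ n))   ∎))

  -- The element x itself need not be power bounded.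
  IsUnit : Pred Carrier q
  IsUnit x = ∃[ y ] PowerBounded y × x * y ≈ 1#

  unit-resp : ∀ {x y} → x ≈ y → IsUnit x → IsUnit y
  unit-resp x≈y (z , pz , xz) = z , pz , trans (*-congʳ (sym x≈y)) xz

  factor-unit : ∀ {x y} → PowerBounded y → IsUnit (x * y) → IsUnit x
  factor-unit {y = y} py (z , pz , xyz) = y * z , PB-* py pz , trans (sym (*-assoc _ _ _)) xyz

  stab-inverse : ∀ {M b y} → IsLattice M → Stab M b → (1# - π * b) * y ≈ 1# → Stab M y
  stab-inverse {M} {b} {y} lat Sb yinv = descend (proj₁ (scale y)) (proj₂ (scale y))
    where
    open IsLattice lat
    -- y = 1 + π b y, so a bound π ^ (m + 1) y M ⊆ M improves to π ^ m y M ⊆ M.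
    descend : ∀ m → (∀ {x} → M x → M (π ^ m * (y * x))) → Stab M y
    descend zero    h {x} Mx = resp (*-identityˡ _) (h Mx)
    descend (suc m) h = descend m λ {x} Mx → resp (begin
      π ^ m * x + b * (π * π ^ m * (y * x))
        ≈⟨ +-congʳ (*-congˡ (trans (*-congʳ yinv) (*-identityˡ x))) ⟨
      π ^ m * ((1# - π * b) * y * x) + b * (π * π ^ m * (y * x))
        ≈⟨ solve 5 (λ u p b y x → u :* ((:1 :- p :* b) :* y :* x) :+ b :* (p :* u :* (y :* x)) :=
             u :* (y :* x))
             refl (π ^ m) π b y x ⟩
      π ^ m * (y * x) ∎)
      (+∈ (π^∈ m Mx) (Sb (h Mx)))

  abstract
    -- The inverse exists in the field L because `π * b` is not 1. That it lies in R is seen on a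
    -- lattice stabilised by b, so no series has to be summed.
    unit-1-π : ∀ {b} → PowerBounded b → IsUnit (1# - π * b)
    unit-1-π {b} pb =
        proj₁ inv , stab⇒powerBounded lat (stab-inverse lat sx (proj₂ inv)) , proj₂ inv
      where
      open CommonStabiliser pb pb
      nonzero : ¬ 1# - π * b ≈ 0#
      nonzero eq = π-nonunit pb (begin
        π * b               ≈⟨ solve 1 (λ u → u := :1 :- (:1 :- u)) refl (π * b) ⟩
        1# - (1# - π * b)   ≈⟨ +-congˡ (-‿cong eq) ⟩
        1# - 0#             ≈⟨ solve 0 (:1 :- :0 := :1) refl ⟩
        1#                  ∎)
      inv : ∃[ y ] (1# - π * b) * y ≈ 1#
      inv = inverse _ nonzero

    -- The factor `g` is the finite geometric sum in t.
    geometric : ∀ {t} → PowerBounded t → ∀ n → ∃[ g ] PowerBounded g × 1# - t ^ n ≈ (1# - t) * g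
    geometric {t} pt zero = 0# , PB-O O-0 , solve 1 (λ t → :1 :- :1 := (:1 :- t) :* :0) refl t
    geometric {t} pt (suc n) = let g , pg , eq = geometric pt n in
      1# + t * g , PB-+ PB-1 (PB-* pt pg) , (begin
      1# - t * t ^ n
        ≈⟨ solve 2 (λ t u → :1 :- t :* u := (:1 :- t) :+ t :* (:1 :- u)) refl t (t ^ n) ⟩
      (1# - t) + t * (1# - t ^ n)      ≈⟨ +-congˡ (*-congˡ eq) ⟩
      (1# - t) + t * ((1# - t) * g)
        ≈⟨ solve 2 (λ t g → (:1 :- t) :+ t :* ((:1 :- t) :* g) := (:1 :- t) :* (:1 :+ t :* g))
             refl t g ⟩
      (1# - t) * (1# + t * g)          ∎)

  -- Convergent series in lattices and lifting of idempotents

  partial-0 : ∀ {d} → (∀ n → d n ≈ 0#) → ∀ n → partial π d n ≈ 0#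
  partial-0 d≈0 zero    = refl
  partial-0 d≈0 (suc n) =
      trans (+-cong (partial-0 d≈0 n) (trans (*-congˡ (d≈0 n)) (zeroʳ _))) (+-identityˡ 0#)

  partial-* : ∀ u d n → partial π (λ i → u * d i) n ≈ u * partial π d n
  partial-* u d zero    = sym (zeroʳ u)
  partial-* u d (suc n) = trans (+-congʳ (partial-* u d n))
    (solve 4 (λ u s w e → u :* s :+ w :* (u :* e) := u :* (s :+ w :* e)) refl u (partial π d n)
        (π ^ n) (d n))

  partial-linear : ∀ {d a s b} → (∀ n → d n ≈ a n * b + s n) → ∀ n →
                   partial π d n ≈ partial π a n * b + partial π s n
  partial-linear {b = b} eq zero = solve 1 (λ b → :0 := :0 :* b :+ :0) refl b
  partial-linear {d} {a} {s} {b} eq (suc n) = trans (+-cong (partial-linear eq n) (*-congˡ (eq n)))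
    (solve 6 (λ A b S u a s → (A :* b :+ S) :+ u :* (a :* b :+ s) := (A :+ u :* a) :* b :+
        (S :+ u :* s)) refl
      (partial π a n) b (partial π s n) (π ^ n) (a n) (s n))

  span-uncons : ∀ {b bs x} → Span O (b ∷ bs) x → ∃[ a ] ∃[ s ] O a × Span O bs s × x ≈ a * b + s
  span-uncons (cons {a = a} {s} Oa S eq) = a , s , Oa , S , eq

  abstract
    -- Coefficients are chosen for each digit separately, and the resulting series of coefficients
    -- converge in O, one generator at a time.
    span-complete : ∀ bs d → (∀ n → Span O bs (d n)) →
                    ∃[ s ] (∀ n → ∃[ r ] Span O bs r × s ≈ partial π d n + π ^ n * r)
    span-complete [] d Sd =
        0# , λ n → 0# , nil refl , sym (trans (+-cong (partial-0 d≈0 n) (zeroʳ _)) (+-identityˡ 0#))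
      where
      d≈0 : ∀ n → d n ≈ 0#
      d≈0 n with Sd n
      ... | nil eq = eq
    span-complete (b ∷ bs) d Sd = A * b + S , λ n →
      let rA , OrA , eqA = proj₂ hA n
          rS , SrS , eqS = proj₂ hS n
      in rA * b + rS , cons OrA SrS refl , (begin
        A * b + S
          ≈⟨ +-cong (*-congʳ eqA) eqS ⟩
        (partial π a n + π ^ n * rA) * b + (partial π s n + π ^ n * rS)
          ≈⟨ solve 6 (λ P u r b Q t → (P :+ u :* r) :* b :+ (Q :+ u :* t) :=
               (P :* b :+ Q) :+ u :* (r :* b :+ t))
               refl _ _ rA b _ rS ⟩
        (partial π a n * b + partial π s n) + π ^ n * (rA * b + rS)
          ≈⟨ +-congʳ (partial-linear (λ n → proj₂ (proj₂ (proj₂ (proj₂ (split n))))) n) ⟨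
        partial π d n + π ^ n * (rA * b + rS) ∎)
      where
      split : ∀ n → ∃[ a ] ∃[ s ] O a × Span O bs s × d n ≈ a * b + s
      split n = span-uncons (Sd n)
      a s : ℕ → Carrier
      a n = proj₁ (split n)
      s n = proj₁ (proj₂ (split n))
      hA : ∃[ A ] (∀ n → ∃[ r ] O r × A ≈ partial π a n + π ^ n * r)
      hA = O-complete a (λ n → proj₁ (proj₂ (proj₂ (split n))))
      hS : ∃[ S ] (∀ n → ∃[ r ] Span O bs r × S ≈ partial π s n + π ^ n * r)
      hS = span-complete bs s (λ n → proj₁ (proj₂ (proj₂ (proj₂ (split n)))))
      A S : Carrier
      A = proj₁ hA
      S = proj₁ hS

    π⁻¹ : Carrier
    π⁻¹ = proj₁ (inverse π π≉0)

    π-inverse : π * π⁻¹ ≈ 1#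
    π-inverse = proj₂ (inverse π π≉0)

  zero-product : ∀ {x y} → ¬ x ≈ 0# → x * y ≈ 0# → y ≈ 0#
  zero-product {x} {y} x≉0 xy = let z , xz = inverse x x≉0 in begin
    y            ≈⟨ *-identityˡ y ⟨
    1# * y       ≈⟨ *-congʳ xz ⟨
    x * z * y    ≈⟨ solve 3 (λ x z y → x :* z :* y := z :* (x :* y)) refl x z y ⟩
    z * (x * y)  ≈⟨ *-congˡ xy ⟩
    z * 0#       ≈⟨ zeroʳ z ⟩
    0#           ∎

  module Idempotent {M : Pred Carrier q} (lat : IsLattice M) where
    abstract
      -- The factor `π ^ m` brings the digits into M₀, where the series is summed; `π ^ f` brings
      -- the remainders back into the stabiliser. The index shift is the total loss `m + f`.
      stab-complete : ∀ d → (∀ n → Stab M (d n)) →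
                      ∃[ s ] ∃[ c ] (∀ k → ∃[ z ] Stab M z × s ≈ partial π d (c ℕ.+ k) + π ^ k * z)
      stab-complete d Sd = π⁻¹ ^ m * S , m ℕ.+ f , λ k →
        let n = m ℕ.+ f ℕ.+ k
            r , Mr , eq = proj₂ hS n
        in π ^ f * r , proj₂ (stab-lower lat) Mr , (begin
          π⁻¹ ^ m * S
            ≈⟨ *-congˡ (trans eq (+-congʳ (partial-* (π ^ m) d n))) ⟩
          π⁻¹ ^ m * (π ^ m * partial π d n + π ^ n * r)
            ≈⟨ *-congˡ
                (+-congˡ (*-congʳ (trans (^-homo-* π (m ℕ.+ f) k) (*-congʳ (^-homo-* π m f))))) ⟩
          π⁻¹ ^ m * (π ^ m * partial π d n + π ^ m * π ^ f * π ^ k * r)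
            ≈⟨ solve 6 (λ i u P v w r → i :* (u :* P :+ u :* v :* w :* r) :=
                 u :* i :* (P :+ w :* (v :* r))) refl
                 (π⁻¹ ^ m) (π ^ m) (partial π d n) (π ^ f) (π ^ k) r ⟩
          π ^ m * π⁻¹ ^ m * (partial π d n + π ^ k * (π ^ f * r))
            ≈⟨ trans (*-congʳ (^-inverse m π-inverse)) (*-identityˡ _) ⟩
          partial π d n + π ^ k * (π ^ f * r) ∎)
        where
        m f : ℕ
        m = proj₁ (stab-upper lat)
        f = proj₁ (stab-lower lat)
        hS : ∃[ S ] (∀ n → ∃[ r ] M₀ r × S ≈ partial π (λ n → π ^ m * d n) n + π ^ n * r)
        hS = span-complete basis (λ n → π ^ m * d n) (λ n → proj₂ (stab-upper lat) (Sd n))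
        S : Carrier
        S = proj₁ hS

    stab-separated : ∀ x → (∀ k → ∃[ z ] Stab M z × x ≈ π ^ k * z) → x ≈ 0#
    stab-separated x h = let m , f = stab-upper lat in separated x λ k →
      let z , Sz , eq = h (k ℕ.+ m) in π ^ m * z , f Sz , trans eq (sym (π^-+ k m z))

    Newton : Carrier → ℕ → Set q
    Newton e n = ∃[ r ] Stab M e × Stab M r × e - e * e ≈ π ^ suc n * r

    two three : Carrier
    two = 1# + 1#
    three = 1# + 1# + 1#

    S1 : Stab M 1#
    S1 = stab-O lat O-1

    S2 : Stab M two
    S2 = stab-+ lat S1 S1

    step : Carrier → Carrier
    step e = three * (e * e) - two * (e * e * e)

    -- The defect of `step e` is the square of that of e times (3 - 2e)(1 + 2e). Only one further
    -- power of π is recorded; the surplus `π ^ n` stays in the cofactor.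
    newton-step : ∀ {e n} → Newton e n → Newton (step e) (suc n)
    newton-step {e} {n} (r , Se , Sr , eq) =
      π ^ n * (r * r) * ((three - two * e) * (1# + two * e)) ,
      stab-+ lat (stab-* lat (stab-+ lat S2 S1) See)
          (stab-neg lat (stab-* lat S2 (stab-* lat See Se))) ,
      stab-* lat (stab-* lat (stab-^ lat n (stab-O lat O-π)) (stab-* lat Sr Sr))
        (stab-* lat (stab-+ lat (stab-+ lat S2 S1) (stab-neg lat S2e)) (stab-+ lat S1 S2e)) ,
      (begin
        step e - step e * step e
          ≈⟨ solve 1 (λ e →
               let 3e²-2e³ = (:1 :+ :1 :+ :1) :* (e :* e) :- (:1 :+ :1) :* (e :* e :* e) in
               3e²-2e³ :- 3e²-2e³ :* 3e²-2e³ :=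
               (e :- e :* e) :* (e :- e :* e) :*
                   ((:1 :+ :1 :+ :1 :- (:1 :+ :1) :* e) :* (:1 :+ (:1 :+ :1) :* e))) refl e ⟩
        (e - e * e) * (e - e * e) * ((three - two * e) * (1# + two * e))
          ≈⟨ *-congʳ (*-cong eq eq) ⟩
        π ^ suc n * r * (π ^ suc n * r) * ((three - two * e) * (1# + two * e))
          ≈⟨ solve 4 (λ p u r g → p :* u :* r :* (p :* u :* r) :* g :=
               p :* (p :* u) :* (u :* (r :* r) :* g))
               refl π (π ^ n) r _ ⟩
        π ^ suc (suc n) * (π ^ n * (r * r) * ((three - two * e) * (1# + two * e))) ∎)
      where
      See = stab-* lat Se Se
      S2e = stab-* lat S2 Se

    stab-partial : ∀ {d} → (∀ n → Stab M (d n)) → ∀ n → Stab M (partial π d n)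
    stab-partial Sd zero    = stab-O lat O-0
    stab-partial Sd (suc n) =
        stab-+ lat (stab-partial Sd n) (stab-* lat (stab-^ lat n (stab-O lat O-π)) (Sd n))

    module Limit
      (E R : ℕ → Carrier)
      (SE : ∀ n → Stab M (E n)) (SR : ∀ n → Stab M (R n))
      (eqE : ∀ n → E n - E n * E n ≈ π ^ suc n * R n)
      (E-step : ∀ n → E (suc n) ≈ E n + π ^ suc n * (R n * (two * E n - 1#)))
      where

      -- The digits of the increments: `step e - e` equals (e - e²)(2e - 1).
      d : ℕ → Carrier
      d n = R n * (two * E n - 1#)

      Sd : ∀ n → Stab M (d n)
      Sd n = stab-* lat (SR n) (stab-+ lat (stab-* lat S2 (SE n)) (stab-neg lat S1))

      E-partial : ∀ n → E n ≈ E 0 + π * partial π d n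
      E-partial zero    = solve 2 (λ e p → e := e :+ p :* :0) refl (E 0) π
      E-partial (suc n) = begin
        E (suc n)
          ≈⟨ E-step n ⟩
        E n + π * π ^ n * d n
          ≈⟨ +-congʳ (E-partial n) ⟩
        E 0 + π * partial π d n + π * π ^ n * d n
          ≈⟨ solve 5 (λ e p P u r → e :+ p :* P :+ p :* u :* r := e :+ p :* (P :+ u :* r))
               refl (E 0) π (partial π d n) (π ^ n) (d n) ⟩
        E 0 + π * partial π d (suc n) ∎

      Sπ : Stab M π
      Sπ = stab-O lat O-π

      module _ (s : Carrier) (c₀ : ℕ)
        (lim : ∀ k → ∃[ z ] Stab M z × s ≈ partial π d (c₀ ℕ.+ k) + π ^ k * z) where

        ê : Carrier
        ê = E 0 + π * s

        near : ∀ k {z} → s ≈ partial π d (c₀ ℕ.+ k) + π ^ k * z → ê ≈ E (c₀ ℕ.+ k) + π ^ suc k * z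
        near k {z} eq = begin
          E 0 + π * s                                       ≈⟨ +-congˡ (*-congˡ eq) ⟩
          E 0 + π * (partial π d (c₀ ℕ.+ k) + π ^ k * z)
            ≈⟨ solve 5 (λ e p P u z → e :+ p :* (P :+ u :* z) := e :+ p :* P :+ p :* u :* z)
                 refl (E 0) π (partial π d (c₀ ℕ.+ k)) (π ^ k) z ⟩
          E 0 + π * partial π d (c₀ ℕ.+ k) + π ^ suc k * z  ≈⟨ +-congʳ (E-partial (c₀ ℕ.+ k)) ⟨
          E (c₀ ℕ.+ k) + π ^ suc k * z                      ∎

        ê-small : ∀ k {z} → ê ≈ E (c₀ ℕ.+ k) + π ^ suc k * z →
          ê - ê * ê ≈ π ^ k *
              (π * (π ^ c₀ * R (c₀ ℕ.+ k) + z * (1# - two * E (c₀ ℕ.+ k) - π ^ suc k * z)))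
        ê-small k {z} eq = begin
          ê - ê * ê
            ≈⟨ +-cong eq (-‿cong (*-cong eq eq)) ⟩
          (E n + w) - (E n + w) * (E n + w)
            ≈⟨ solve 2 (λ e w → (e :+ w) :- (e :+ w) :* (e :+ w) :=
                 (e :- e :* e) :+ w :* (:1 :- (:1 :+ :1) :* e :- w))
                 refl (E n) w ⟩
          (E n - E n * E n) + w * (1# - two * E n - w)
            ≈⟨ +-congʳ (trans (eqE n) (*-congʳ (*-congˡ (^-homo-* π c₀ k)))) ⟩
          π * (π ^ c₀ * π ^ k) * R n + w * (1# - two * E n - w)
            ≈⟨ solve 6 (λ p u v r z t → p :* (u :* v) :* r :+ p :* v :* z :* t :=
                 v :* (p :* (u :* r :+ z :* t))) refl
                 π (π ^ c₀) (π ^ k) (R n) z (1# - two * E n - w) ⟩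
          π ^ k * (π * (π ^ c₀ * R n + z * (1# - two * E n - w))) ∎
          where
          n : ℕ
          n = c₀ ℕ.+ k
          w : Carrier
          w = π ^ suc k * z

        -- The defect of `E (c₀ + k)` is divisible by `π ^ k`, and passing from it to `ê` adds a
        -- multiple of `π ^ suc k`; hence the defect of `ê` is divisible by every power of π.
        ê-idempotent : ê - ê * ê ≈ 0#
        ê-idempotent = stab-separated _ λ k → let z , Sz , eq = lim k in
          _ ,
          stab-* lat Sπ (stab-+ lat (stab-* lat (stab-^ lat c₀ Sπ) (SR (c₀ ℕ.+ k)))
            (stab-* lat Sz
                (stab-+ lat (stab-+ lat S1 (stab-neg lat (stab-* lat S2 (SE (c₀ ℕ.+ k)))))
              (stab-neg lat (stab-* lat (stab-^ lat (suc k) Sπ) Sz))))) ,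
          ê-small k (near k eq)

        Ss : Stab M s
        Ss = let z , Sz , eq = lim 0 in
          stab-resp lat (sym eq) (stab-+ lat (stab-partial Sd (c₀ ℕ.+ 0)) (stab-* lat S1 Sz))

        abstract
          limit-dichotomy : ∃[ s ] Stab M s × (E 0 ≈ π * s ⊎ 1# - E 0 ≈ π * s)
          limit-dichotomy with em ℓ {ê ≈ 0#}
          ... | yes ê≈0 = - s , stab-neg lat Ss , inj₁ (begin
            E 0
              ≈⟨ solve 3 (λ e p s → e := (e :+ p :* s) :+ p :* :- s) refl (E 0) π s ⟩
            ê + π * - s        ≈⟨ +-congʳ ê≈0 ⟩
            0# + π * - s       ≈⟨ +-identityˡ _ ⟩
            π * - s            ∎)
          ... | no ê≉0 = s , Ss , inj₂ (begin
            1# - E 0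
              ≈⟨ solve 3 (λ e p s → :1 :- e := (:1 :- (e :+ p :* s)) :+ p :* s) refl (E 0) π s ⟩
            (1# - ê) + π * s
              ≈⟨ +-congʳ (zero-product ê≉0 (trans (solve 1 (λ e → e :* (:1 :- e) := e :- e :* e)
                   refl ê) ê-idempotent)) ⟩
            0# + π * s           ≈⟨ +-identityˡ _ ⟩
            π * s                ∎)

      sequence-dichotomy : ∃[ s ] Stab M s × (E 0 ≈ π * s ⊎ 1# - E 0 ≈ π * s)
      sequence-dichotomy = let s , c₀ , lim = stab-complete d Sd in limit-dichotomy s c₀ lim

    abstract
      newton-sequence : ∀ {e r} → Stab M e → Stab M r → e - e * e ≈ π * r → ∀ n → ∃[ e ] Newton e n
      newton-sequence {e} {r} Se Sr eq zero =
          e , r , Se , Sr , trans eq (*-congʳ (sym (*-identityʳ π)))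
      newton-sequence Se Sr eq (suc n) = let e , N = newton-sequence Se Sr eq n in
        step e , newton-step {n = n} N

    step-difference : ∀ {e n} (N : Newton e n) → step e ≈ e + π ^ suc n * (proj₁ N * (two * e - 1#))
    step-difference {e} {n} (r , _ , _ , eq) = begin
      step e
        ≈⟨ solve 1 (λ e → (:1 :+ :1 :+ :1) :* (e :* e) :- (:1 :+ :1) :* (e :* e :* e) :=
             e :+ (e :- e :* e) :* ((:1 :+ :1) :* e :- :1)) refl e ⟩
      e + (e - e * e) * (two * e - 1#)
        ≈⟨ +-congˡ (trans (*-congʳ eq) (*-assoc _ _ _)) ⟩
      e + π ^ suc n * (r * (two * e - 1#)) ∎

    abstract
      idempotent-lift : ∀ {e r} → Stab M e → Stab M r → e - e * e ≈ π * r →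
                        ∃[ s ] Stab M s × (e ≈ π * s ⊎ 1# - e ≈ π * s)
      idempotent-lift Se Sr eq = Limit.sequence-dichotomy
        (λ n → proj₁ (seq n)) (λ n → proj₁ (proj₂ (seq n)))
        (λ n → proj₁ (proj₂ (proj₂ (seq n)))) (λ n → proj₁ (proj₂ (proj₂ (proj₂ (seq n)))))
        (λ n → proj₂ (proj₂ (proj₂ (proj₂ (seq n)))))
        (λ n → step-difference {n = n} (proj₂ (seq n)))
        where
        seq : ∀ n → ∃[ e ] Newton e n
        seq = newton-sequence Se Sr eq

  -- Locality of R and the valuation ring property

  OUnit : Pred Carrier q
  OUnit x = ∃[ y ] O y × x * y ≈ 1#

  PB-0 : PowerBounded 0#
  PB-0 = PB-O O-0

  OUnit⇒unit : ∀ {x} → OUnit x → IsUnit x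
  OUnit⇒unit (y , Oy , xy) = y , PB-O Oy , xy

  PB-eval : ∀ {as x} → PowerBounded x → All O as → PowerBounded (eval as x)
  PB-eval px []         = PB-0
  PB-eval px (Oa ∷ Oas) = PB-+ (PB-O Oa) (PB-* px (PB-eval px Oas))

  abstract
    -- Coefficients below the first unit u are divisible by π and go into `π * r`. The higher terms
    -- carry one more factor x, and dividing them by u produces - h.
    lowest-unit : ∀ {as x} → PowerBounded x → All O as → Any OUnit as →
                  ∃[ j ] ∃[ u ] ∃[ h ] ∃[ r ] OUnit u × PowerBounded h × PowerBounded r ×
                  eval as x ≈ π * r + x ^ j * (u * (1# - x * h))
    lowest-unit {a ∷ as} {x} px (Oa ∷ Oas) (here (a′ , Oa′ , aa′)) =
      0 , a , - (a′ * eval as x) , 0# , (a′ , Oa′ , aa′) ,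
          PB-neg (PB-* (PB-O Oa′) (PB-eval px Oas)) , PB-0 , (begin
        a + x * eval as x                                  ≈⟨ +-congˡ (*-congˡ (*-identityˡ _)) ⟨
        a + x * (1# * eval as x)                           ≈⟨ +-congˡ (*-congˡ (*-congʳ aa′)) ⟨
        a + x * (a * a′ * eval as x)
          ≈⟨ solve 5 (λ a x a′ e p → a :+ x :* (a :* a′ :* e) :=
               p :* :0 :+ :1 :* (a :* (:1 :- x :* :- (a′ :* e))))
               refl a x a′ (eval as x) π ⟩
        π * 0# + 1# * (a * (1# - x * - (a′ * eval as x)))  ∎)
    lowest-unit {a ∷ as} {x} px (Oa ∷ Oas) (there any) with O-dichotomy Oa
    -- `Any` may point past an earlier unit coefficient; that one is taken instead, so that the
    -- skipped coefficients are all divisible by π.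
    ... | inj₁ ua = lowest-unit px (Oa ∷ Oas) (here ua)
    ... | inj₂ (a′ , Oa′ , a≈πa′) =
      let j , u , h , r , uu , ph , pr , eq = lowest-unit px Oas any in
      suc j , u , h , a′ + x * r , uu , ph , PB-+ (PB-O Oa′) (PB-* px pr) , (begin
        a + x * eval as x
          ≈⟨ +-cong a≈πa′ (*-congˡ eq) ⟩
        π * a′ + x * (π * r + x ^ j * (u * (1# - x * h)))
          ≈⟨ solve 6 (λ p a x r v w → p :* a :+ x :* (p :* r :+ v :* w) :=
               p :* (a :+ x :* r) :+ x :* v :* w)
               refl π a′ x r (x ^ j) (u * (1# - x * h)) ⟩
        π * (a′ + x * r) + x * x ^ j * (u * (1# - x * h))             ∎)

  sum-eval : ∀ {n} (k : Vector Carrier n) x →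
               sum (λ i → k i * x ^ Fin.toℕ i) ≈ eval (tabulate k) x
  sum-eval {zero}  k x = refl
  sum-eval {suc n} k x = +-cong (*-identityʳ _) (begin
    sum (λ i → k (suc i) * (x * x ^ Fin.toℕ i))
      ≈⟨ sum-cong-≋ (λ i → solve 3 (λ k x u → k :* (x :* u) := x :* (k :* u))
           refl (k (suc i)) x (x ^ Fin.toℕ i)) ⟩
    sum (λ i → x * (k (suc i) * x ^ Fin.toℕ i))
      ≈⟨ *-distribˡ-sum x (λ i → k (suc i) * x ^ Fin.toℕ i) ⟨
    x * sum (λ i → k (suc i) * x ^ Fin.toℕ i)
      ≈⟨ *-congˡ (sum-eval (λ i → k (suc i)) x) ⟩
    x * eval (tabulate (λ i → k (suc i))) x ∎)

  abstract
    primitive-relation : ∀ x → ∃[ as ] All O as × Any OUnit as × eval as x ≈ 0#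
    primitive-relation x =
      let k , Ok , (i , uki) , eq = dependent (λ i → x ^ Fin.toℕ i) in
      tabulate k , All.tabulate⁺ {f = k} Ok , Any.tabulate⁺ {f = k} i uki ,
          trans (sym (sum-eval k x)) eq

    -- The unit u is cancelled, and one more factor x makes the exponent positive, so that `fitting`
    -- can split x off a power of `x * h`.
    reduced-relation : ∀ {x} → PowerBounded x →
                       ∃[ j ] ∃[ h ] ∃[ r ] PowerBounded h × PowerBounded r ×
                       x ^ suc j * (1# - x * h) ≈ π * r
    reduced-relation {x} px =
      let as , Oas , any , eval≈0 = primitive-relation x
          j , u , h , r , (u′ , Ou′ , uu′) , ph , pr , eq = lowest-unit px Oas any
      in j , h , - (x * u′ * r) , ph , PB-neg (PB-* (PB-* px (PB-O Ou′)) pr) , (begin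
        x * x ^ j * (1# - x * h)
          ≈⟨ *-identityˡ _ ⟨
        1# * (x * x ^ j * (1# - x * h))
          ≈⟨ *-congʳ uu′ ⟨
        u * u′ * (x * x ^ j * (1# - x * h))
          ≈⟨ solve 7 (λ u u′ x v w p r → u :* u′ :* (x :* v :* w) :=
               x :* u′ :* (p :* r :+ v :* (u :* w)) :- x :* u′ :* (p :* r))
               refl u u′ x (x ^ j) (1# - x * h) π r ⟩
        x * u′ * (π * r + x ^ j * (u * (1# - x * h))) - x * u′ * (π * r)
          ≈⟨ +-congʳ (*-congˡ (trans (sym eq) eval≈0)) ⟩
        x * u′ * 0# - x * u′ * (π * r)
          ≈⟨ solve 4 (λ x u p r → x :* u :* :0 :- x :* u :* (p :* r) := p :* :- (x :* u :* r))
               refl x u′ π r ⟩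
        π * - (x * u′ * r) ∎)

    idempotent-dichotomy : ∀ {e r} → PowerBounded e → PowerBounded r → e - e * e ≈ π * r →
                           ∃[ s ] PowerBounded s × (e ≈ π * s ⊎ 1# - e ≈ π * s)
    idempotent-dichotomy pe pr eq =
      let s , Ss , d = Idempotent.idempotent-lift lat sx sy eq in s , stab⇒powerBounded lat Ss , d
      where open CommonStabiliser pe pr

  TopNilpotent : Pred Carrier q
  TopNilpotent x = ∃[ j ] ∃[ r ] PowerBounded r × x ^ suc j ≈ π * r

  abstract
    -- Modulo π, t = x h satisfies x ^ J t = x ^ J, so e = t ^ J is idempotent.  If e lifts to 1
    -- then x is a unit; if it lifts to 0 then x ^ J ≡ x ^ J e ≡ 0.
    fitting : ∀ {x j h r} → PowerBounded x → PowerBounded h → PowerBounded r →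
              x ^ suc j * (1# - x * h) ≈ π * r → IsUnit x ⊎ TopNilpotent x
    fitting {x} {j} {h} {r} px ph pr eq =
      let g , pg , geo = geometric (PB-* px ph) J
          s , ps , d =
              idempotent-dichotomy (PB-^ J (PB-* px ph)) (PB-* (PB-^ J ph) (PB-* pr pg)) (idem geo)
      in conclude pg geo ps d
      where
      J : ℕ
      J = suc j
      t e : Carrier
      t = x * h
      e = t ^ J

      idem : ∀ {g} → 1# - e ≈ (1# - t) * g → e - e * e ≈ π * (h ^ J * (r * g))
      idem {g} geo = begin
        e - e * e
          ≈⟨ solve 1 (λ e → e :- e :* e := e :* (:1 :- e)) refl e ⟩
        e * (1# - e)                           ≈⟨ *-cong (^-distrib-* x h J) geo ⟩
        x ^ J * h ^ J * ((1# - t) * g)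
          ≈⟨ solve 4 (λ u v w g → u :* v :* (w :* g) := v :* (u :* w :* g))
               refl (x ^ J) (h ^ J) (1# - t) g ⟩
        h ^ J * (x ^ J * (1# - t) * g)         ≈⟨ *-congˡ (*-congʳ eq) ⟩
        h ^ J * (π * r * g)
          ≈⟨ solve 4 (λ v p r g → v :* (p :* r :* g) := p :* (v :* (r :* g))) refl (h ^ J) π r g ⟩
        π * (h ^ J * (r * g))                  ∎

      conclude : ∀ {g s} → PowerBounded g → 1# - e ≈ (1# - t) * g → PowerBounded s →
                 (e ≈ π * s ⊎ 1# - e ≈ π * s) → IsUnit x ⊎ TopNilpotent x
      conclude {g} {s} pg geo ps (inj₁ e≈πs) =
          inj₂ (j , r * g + x ^ J * s , PB-+ (PB-* pr pg) (PB-* (PB-^ J px) ps) , (begin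
        x ^ J
          ≈⟨ solve 2 (λ u e → u := u :* (:1 :- e) :+ u :* e) refl (x ^ J) e ⟩
        x ^ J * (1# - e) + x ^ J * e         ≈⟨ +-cong (*-congˡ geo) (*-congˡ e≈πs) ⟩
        x ^ J * ((1# - t) * g) + x ^ J * (π * s)
          ≈⟨ +-congʳ (trans (sym (*-assoc _ _ _)) (*-congʳ eq)) ⟩
        π * r * g + x ^ J * (π * s)
          ≈⟨ solve 5 (λ p r g u s → p :* r :* g :+ u :* (p :* s) := p :* (r :* g :+ u :* s))
               refl π r g (x ^ J) s ⟩
        π * (r * g + x ^ J * s)              ∎))
      conclude {g} {s} pg geo ps (inj₂ 1-e≈πs) = inj₁ (factor-unit (PB-* ph (PB-^ j (PB-* px ph)))
        (unit-resp (begin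
          1# - π * s         ≈⟨ +-congˡ (-‿cong 1-e≈πs) ⟨
          1# - (1# - e)      ≈⟨ solve 1 (λ e → :1 :- (:1 :- e) := e) refl e ⟩
          x * h * t ^ j      ≈⟨ *-assoc x h (t ^ j) ⟩
          x * (h * t ^ j)    ∎) (unit-1-π ps)))

    unit⊎topNilpotent : ∀ {x} → PowerBounded x → IsUnit x ⊎ TopNilpotent x
    unit⊎topNilpotent px = let j , h , r , ph , pr , eq = reduced-relation px in
      fitting {j = j} px ph pr eq

  -- 1 - x divides 1 - x ^ suc j, which has the form 1 - π r and is therefore a unit.
  topNilpotent⇒unit-1- : ∀ {x} → PowerBounded x → TopNilpotent x → IsUnit (1# - x)
  topNilpotent⇒unit-1- {x} px (j , r , pr , eq) = let g , pg , geo = geometric px (suc j) in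
    factor-unit pg (unit-resp (trans (+-congˡ (-‿cong (sym eq))) geo) (unit-1-π pr))

  abstract
    -- This is locality of R. With u inverse to a + b, either a u is a unit or it is topologically
    -- nilpotent, and then b u = 1 - a u is a unit.
    unit-+ : ∀ {a b} → PowerBounded a → PowerBounded b → IsUnit (a + b) → IsUnit a ⊎ IsUnit b
    unit-+ {a} {b} pa pb (u , pu , eq) =
        ⊎-elim (inj₁ ∘ factor-unit pu) (inj₂ ∘ other) (unit⊎topNilpotent (PB-* pa pu))
      where
      other : TopNilpotent (a * u) → IsUnit b
      other N = factor-unit pu (unit-resp (begin
        1# - a * u            ≈⟨ +-congʳ eq ⟨
        (a + b) * u - a * u   ≈⟨ solve 3 (λ a b u → (a :+ b) :* u :- a :* u := b :* u) refl a b u ⟩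
        b * u                 ∎) (topNilpotent⇒unit-1- (PB-* pa pu) N))

    -- Induction on the degree: c y is integral, and (c y + a₁) + a₂ x + … = 0 has smaller degree.
    -- If a₁ was the only unit coefficient and c y + a₁ is not a unit, then c y is a unit.
    unit-root-dichotomy : ∀ as {c x y} → PowerBounded c → All PowerBounded as → x * y ≈ 1# →
                 c + x * eval as x ≈ 0# → Any IsUnit (c ∷ as) → PowerBounded x ⊎ PowerBounded y
    unit-root-dichotomy as {c} {x} {y} pc pas xy eq (here (z , pz , cz)) = inj₂ (PB-resp (begin
      z * (c * y)   ≈⟨ solve 3 (λ z c y → z :* (c :* y) := c :* z :* y) refl z c y ⟩
      c * z * y     ≈⟨ trans (*-congʳ cz) (*-identityˡ y) ⟩
      y             ∎) (PB-* pz (leading-integral pc pas xy eq)))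
    unit-root-dichotomy (a ∷ as) {c} {x} {y} pc (pa ∷ pas) xy eq (there any) = go any
      where
      pcy : PowerBounded (c * y)
      pcy = leading-integral pc (pa ∷ pas) xy eq

      eq′ : (c * y + a) + x * eval as x ≈ 0#
      eq′ = begin
        (c * y + a) + x * eval as x
          ≈⟨ solve 4 (λ c y a e → (c :* y :+ a) :+ e := c :* y :+ :1 :* (a :+ e))
               refl c y a (x * eval as x) ⟩
        c * y + 1# * (a + x * eval as x)             ≈⟨ +-congˡ (*-congʳ xy) ⟨
        c * y + x * y * (a + x * eval as x)
          ≈⟨ solve 4 (λ c y x e → c :* y :+ x :* y :* e := y :* (c :+ x :* e))
               refl c y x (a + x * eval as x) ⟩
        y * (c + x * (a + x * eval as x))            ≈⟨ trans (*-congˡ eq) (zeroʳ y) ⟩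
        0#                                         ∎

      integral : IsUnit (- (c * y)) → PowerBounded x
      integral (z , pz , cyz) = PB-resp (begin
        - (c * z)               ≈⟨ solve 2 (λ c z → :- (c :* z) := :1 :* :- (c :* z)) refl c z ⟩
        1# * - (c * z)          ≈⟨ *-congʳ xy ⟨
        x * y * - (c * z)
          ≈⟨ solve 4 (λ x y c z → x :* y :* :- (c :* z) := x :* (:- (c :* y) :* z)) refl x y c z ⟩
        x * (- (c * y) * z)     ≈⟨ trans (*-congˡ cyz) (*-identityʳ x) ⟩
        x                       ∎) (PB-neg (PB-* pc pz))

      go : Any IsUnit (a ∷ as) → PowerBounded x ⊎ PowerBounded y
      go (there any) = unit-root-dichotomy as (PB-+ pcy pa) pas xy eq′ (there any)
      go (here Ua) = ⊎-elim
        (λ U → unit-root-dichotomy as (PB-+ pcy pa) pas xy eq′ (here U))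
        (inj₁ ∘ integral)
        (unit-+ (PB-+ pcy pa) (PB-neg pcy)
            (unit-resp (solve 2 (λ a b → a := (b :+ a) :+ :- b) refl a (c * y)) Ua))

    -- Every element of L satisfies a primitive relation over O, power bounded or not, and a unit
    -- coefficient is what `unit-root-dichotomy` asks for.
    valuation-ring : ∀ {x y} → x * y ≈ 1# → PowerBounded x ⊎ PowerBounded y
    valuation-ring {x} {y} xy = go (primitive-relation x)
      where
      go : ∃[ as ] All O as × Any OUnit as × eval as x ≈ 0# → PowerBounded x ⊎ PowerBounded y
      go (a ∷ as , Oa ∷ Oas , any , eq) =
        unit-root-dichotomy as (PB-O Oa) (All.map PB-O Oas) xy eq (Any.map OUnit⇒unit any)

  -- The maximal ideal of R is principal

  UnitPB : Pred Carrier q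
  UnitPB x = PowerBounded x × IsUnit x

  Max : Pred Carrier q
  Max x = PowerBounded x × ¬ IsUnit x

  max-resp : ∀ {x y} → x ≈ y → Max x → Max y
  max-resp x≈y (px , ¬U) = PB-resp x≈y px , λ U → ¬U (unit-resp (sym x≈y) U)

  max-* : ∀ {x y} → PowerBounded y → Max x → Max (y * x)
  max-* py (px , ¬U) = PB-* py px , λ U → ¬U (factor-unit py (unit-resp (*-comm _ _) U))

  max-+ : ∀ {x y} → Max x → Max y → Max (x + y)
  max-+ {x} {y} (px , ¬Ux) (py , ¬Uy) = PB-+ px py , λ U → ⊎-elim ¬Ux ¬Uy (unit-+ px py U)

  max-0 : Max 0#
  max-0 = PB-0 , λ (z , _ , 0z) → 1≉0 (trans (sym 0z) (zeroˡ z))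

  max-π : Max π
  max-π = PB-O O-π , λ (z , pz , πz) → π-nonunit pz πz

  -- In a relation Σ kᵢ Bᵢ = 0 among B₀ = π, B₁, …, each properly divisible by the next, the
  -- coefficient of the last term has to be divisible by π; its term can then be moved into π Max.
  module Chain (B : ℕ → Carrier) (B-max : ∀ n → Max (B n)) (B-0 : B 0 ≈ π)
               (B-suc : ∀ n → ∃[ z ] Max z × B n ≈ B (suc n) * z) where

    -- Listed from `B (m - 1)` down to `B 0`, so that recursion on m removes the member that divides
    -- all the others.
    chain : ∀ m → Vector Carrier m
    chain (suc m) zero    = B m
    chain (suc m) (suc i) = chain m i

    π-divisible : ∀ m → ∃[ r ] PowerBounded r × π ≈ B m * r
    π-divisible zero    = 1# , PB-1 , trans (sym B-0) (sym (*-identityʳ _))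
    π-divisible (suc m) =
      let r , pr , eq = π-divisible m
          z , (pz , _) , eq′ = B-suc m
      in z * r , PB-* pz pr , trans eq (trans (*-congʳ eq′) (*-assoc _ _ _))

    B≉0 : ∀ m → ¬ B m ≈ 0#
    B≉0 m B≈0 = let r , _ , eq = π-divisible m in π≉0 (trans eq (trans (*-congʳ B≈0) (zeroˡ r)))

    tail-small : ∀ m (k : Vector Carrier m) → (∀ i → O (k i)) →
                 ∃[ z ] Max z × sum (λ i → k i * chain m i) ≈ B m * z
    tail-small zero    k Ok = 0# , max-0 , sym (zeroʳ _)
    tail-small (suc m) k Ok =
      let z , mz , eq = tail-small m (λ i → k (suc i)) (λ i → Ok (suc i))
          w , mw , eq′ = B-suc m
      in k zero * w + w * z , max-+ (max-* (PB-O (Ok zero)) mw) (max-* (proj₁ mw) mz) , (begin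
        k zero * B m + sum (λ i → k (suc i) * chain m i)   ≈⟨ +-congˡ eq ⟩
        k zero * B m + B m * z                             ≈⟨ +-cong (*-congˡ eq′) (*-congʳ eq′) ⟩
        k zero * (B (suc m) * w) + B (suc m) * w * z
          ≈⟨ solve 4 (λ k b w z → k :* (b :* w) :+ b :* w :* z := b :* (k :* w :+ w :* z))
               refl (k zero) (B (suc m)) w z ⟩
        B (suc m) * (k zero * w + w * z)                   ∎)

    -- Since `B m` divides π and, with quotient in `Max`, the lower terms, dividing the relation by
    -- `B m` leaves k equal to minus an element of `Max`.
    no-unit-head : ∀ {m k s r} → Max r → (∃[ z ] Max z × s ≈ B m * z) → k * B m + s + π * r ≈ 0# →
                   ¬ OUnit k
    no-unit-head {m} {k} {s} {r} mr (z , mz , s≈) eq uk =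
      let w , pw , π≈ = π-divisible m
          mzwr = max-* (PB-neg PB-1) (max-+ mz (max-* pw mr))
          k+z+wr≈0 = zero-product {B m} {k + (z + w * r)} (B≉0 m) (begin
            B m * (k + (z + w * r))
              ≈⟨ solve 5 (λ b k z w r → b :* (k :+ (z :+ w :* r)) :=
                   k :* b :+ b :* z :+ b :* w :* r)
                   refl (B m) k z w r ⟩
            k * B m + B m * z + B m * w * r   ≈⟨ +-cong (+-congˡ s≈) (*-congʳ π≈) ⟨
            k * B m + s + π * r               ≈⟨ eq ⟩
            0#                                ∎)
          mk = max-resp (begin
            - 1# * (z + w * r)
              ≈⟨ solve 2 (λ u k → :- :1 :* u := k :- (k :+ u)) refl (z + w * r) k ⟩
            k - (k + (z + w * r))                    ≈⟨ +-congˡ (-‿cong k+z+wr≈0) ⟩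
            k - 0#                                   ≈⟨ solve 1 (λ k → k :- :0 := k) refl k ⟩
            k                                        ∎) mzwr
      in proj₂ mk (OUnit⇒unit uk)

    no-unit : ∀ m (k : Vector Carrier m) → (∀ i → O (k i)) → ∀ {r} → Max r →
              sum (λ i → k i * chain m i) + π * r ≈ 0# → ∀ i → ¬ OUnit (k i)
    no-unit (suc m) k Ok {r} mr eq = split
      where
      head : ¬ OUnit (k zero)
      head = no-unit-head {m = m} mr (tail-small m (λ i → k (suc i)) (λ i → Ok (suc i))) eq

      tail : ∀ {k′} → O k′ → k zero ≈ π * k′ → ∀ i → ¬ OUnit (k (suc i))
      tail {k′} Ok′ k≈ = no-unit m (λ i → k (suc i)) (λ i → Ok (suc i)) {k′ * B m + r}
        (max-+ (max-* (PB-O Ok′) (B-max m)) mr) (begin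
          S + π * (k′ * B m + r)
            ≈⟨ solve 5 (λ s p k b r → s :+ p :* (k :* b :+ r) := p :* k :* b :+ s :+ p :* r)
                 refl S π k′ (B m) r ⟩
          π * k′ * B m + S + π * r     ≈⟨ +-congʳ (+-congʳ (*-congʳ k≈)) ⟨
          k zero * B m + S + π * r     ≈⟨ eq ⟩
          0#                           ∎)
        where
        S : Carrier
        S = sum (λ i → k (suc i) * chain m i)

      split : ∀ i → ¬ OUnit (k i)
      split zero    = head
      split (suc i) with O-dichotomy (Ok zero)
      ... | inj₁ u              = ⊥-elim (head u)
      ... | inj₂ (k′ , Ok′ , eq) = tail Ok′ eq i

    absurd : ⊥
    absurd =
      let k , Ok , (i , uki) , eq = dependent (chain (suc dim)) in
      no-unit (suc dim) k Ok max-0 (trans (+-cong eq (zeroʳ π)) (+-identityˡ 0#)) i uki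

  Generator : Carrier → Set q
  Generator ϖ = Max ϖ × (∀ {y} → Max y → ∃[ r ] PowerBounded r × y ≈ ϖ * r)

  module Quotient {x y : Carrier} (mx : Max x) (¬d : ¬ (∃[ r ] PowerBounded r × y ≈ x * r)) where

    y≉0 : ¬ y ≈ 0#
    y≉0 y≈0 = ¬d (0# , PB-0 , trans y≈0 (sym (zeroʳ x)))

    module _ {j : Carrier} (yj : y * j ≈ 1#) where

      x≈ : x ≈ y * (j * x)
      x≈ = trans (sym (*-identityˡ x)) (trans (*-congʳ (sym yj)) (*-assoc _ _ _))

      bounded : PowerBounded (j * x)
      bounded with em ℓ {x ≈ 0#}
      ... | yes x≈0 = PB-resp (sym (trans (*-congˡ x≈0) (zeroʳ _))) PB-0
      ... | no x≉0 = let i , xi = inverse x x≉0 in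
        ⊎-elim id (λ p → ⊥-elim (¬d (y * i , p , (begin
            y                ≈⟨ *-identityˡ y ⟨
            1# * y           ≈⟨ *-congʳ xi ⟨
            x * i * y        ≈⟨ solve 3 (λ x i y → x :* i :* y := x :* (y :* i)) refl x i y ⟩
            x * (y * i)      ∎))))
        (valuation-ring (begin
            j * x * (y * i)
              ≈⟨ solve 4 (λ j x y i → j :* x :* (y :* i) := y :* j :* (x :* i)) refl j x y i ⟩
            y * j * (x * i)     ≈⟨ *-cong yj xi ⟩
            1# * 1#             ≈⟨ *-identityˡ 1# ⟩
            1#                  ∎))

      nonunit : ¬ IsUnit (j * x)
      nonunit (w , pw , eq) = ¬d (w , pw , (begin
        y                    ≈⟨ *-identityʳ y ⟨
        y * 1#               ≈⟨ *-congˡ eq ⟨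
        y * (j * x * w)
          ≈⟨ solve 4 (λ y j x w → y :* (j :* x :* w) := y :* j :* (x :* w)) refl y j x w ⟩
        y * j * (x * w)      ≈⟨ trans (*-congʳ yj) (*-identityˡ _) ⟩
        x * w                ∎))

    abstract
      -- One of x / y and y / x lies in R. The second would make x divide y, and so would x / y
      -- being a unit.
      quotient : ∃[ z ] Max z × x ≈ y * z
      quotient = let j , yj = inverse y y≉0 in j * x , (bounded yj , nonunit yj) , x≈ yj

  abstract
    -- As x is not a generator, some y in `Max` is not a multiple of it, and then y properly divides
    -- x.
    larger : ¬ ∃ Generator → ∀ {x} → Max x → ∃[ y ] Max y × ∃[ z ] Max z × x ≈ y * z
    larger ¬gen {x} mx = go (em q)
      where
      divides : ¬ (∃[ y ] Max y × ¬ (∃[ r ] PowerBounded r × y ≈ x * r)) →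
                ∀ {y} → Max y → ∃[ r ] PowerBounded r × y ≈ x * r
      divides none {y} my = decidable-stable (em q) λ ¬d → none (y , my , ¬d)

      go : Dec (∃[ y ] Max y × ¬ (∃[ r ] PowerBounded r × y ≈ x * r)) →
           ∃[ y ] Max y × ∃[ z ] Max z × x ≈ y * z
      go (no none)           = ⊥-elim (¬gen (x , mx , divides none))
      go (yes (y , my , ¬d)) = y , my , Quotient.quotient mx ¬d

  module _ (¬gen : ¬ ∃ Generator) where

    ascending : ℕ → ∃ Max
    ascending zero    = π , max-π
    ascending (suc n) = let y , my , _ = larger ¬gen (proj₂ (ascending n)) in y , my

    ascending-absurd : ⊥
    ascending-absurd = Chain.absurd (λ n → proj₁ (ascending n)) (λ n → proj₂ (ascending n)) refl
      (λ n → proj₂ (proj₂ (larger ¬gen (proj₂ (ascending n)))))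

  abstract
    generator : ∃ Generator
    generator = decidable-stable (em q) ascending-absurd

    archimedean : ∀ y → ∃[ m ] PowerBounded (π ^ m * y)
    archimedean y = let m , f = span-scale y basis in
      m , stab⇒powerBounded M₀-isLattice (λ {x} Mx → M₀.resp (sym (*-assoc (π ^ m) y x)) (f Mx))

  -- Factorisation by a uniformiser

  module Uniformiser (ϖ : Carrier) (gen : Generator ϖ) where

    abstract
      -- ϖ is divided out while x is not a unit. The exponent k bounds the number of divisions: each
      -- multiplies the inverse y by ϖ, and at k = 0 the inverse already lies in R.
      factor-out : ∀ k {x y} → PowerBounded x → x * y ≈ 1# → PowerBounded (ϖ ^ k * y) →
                   ∃[ n ] ∃[ u ] UnitPB u × x ≈ ϖ ^ n * u
      factor-out zero {x} {y} px xy pky =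
          0 , x , (px , y , PB-resp (*-identityˡ y) pky , xy) , sym (*-identityˡ x)
      factor-out (suc k) {x} {y} px xy pky with em q {IsUnit x}
      ... | yes U = 0 , x , (px , U) , sym (*-identityˡ x)
      ... | no ¬U =
        let x′ , px′ , x≈ = proj₂ gen (px , ¬U)
            n , u , U , eq = factor-out k {x′} {ϖ * y} px′
              (trans (solve 3 (λ x p y → x :* (p :* y) := p :* x :* y) refl x′ ϖ y)
                  (trans (*-congʳ (sym x≈)) xy))
              (PB-resp (solve 3 (λ p u y → p :* u :* y := u :* (p :* y)) refl ϖ (ϖ ^ k) y) pky)
        in suc n , u , U , trans x≈ (trans (*-congˡ eq) (sym (*-assoc _ _ _)))

      -- ϖ is not a unit, hence topologically nilpotent. This supplies the bound k for `factor-out`.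
      ϖ-power : ∀ m → ∃[ k ] ∃[ r ] PowerBounded r × ϖ ^ k ≈ π ^ m * r
      ϖ-power m = ⊎-elim (⊥-elim ∘ proj₂ (proj₁ gen)) go (unit⊎topNilpotent (proj₁ (proj₁ gen)))
        where
        go : TopNilpotent ϖ → ∃[ k ] ∃[ r ] PowerBounded r × ϖ ^ k ≈ π ^ m * r
        go (j , r , pr , eq) = suc j ℕ.* m , r ^ m , PB-^ m pr , (begin
          ϖ ^ (suc j ℕ.* m)   ≈⟨ ^-assocʳ ϖ (suc j) m ⟨
          (ϖ ^ suc j) ^ m     ≈⟨ ^-congˡ m eq ⟩
          (π * r) ^ m         ≈⟨ ^-distrib-* π r m ⟩
          π ^ m * r ^ m       ∎)

      factorise : ∀ {x} → PowerBounded x → ¬ x ≈ 0# → ∃[ n ] ∃[ u ] UnitPB u × x ≈ ϖ ^ n * u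
      factorise {x} px x≉0 =
        let y , xy = inverse x x≉0
            m , pmy = archimedean y
            k , r , pr , eq = ϖ-power m
        in factor-out k px xy (PB-resp (begin
          r * (π ^ m * y)   ≈⟨ solve 3 (λ r u y → r :* (u :* y) := u :* r :* y) refl r (π ^ m) y ⟩
          π ^ m * r * y     ≈⟨ *-congʳ eq ⟨
          ϖ ^ k * y         ∎) (PB-* pr pmy))

      π-factor : ∃[ e ] ∃[ u ] UnitPB u × π ≈ ϖ ^ suc e * u
      π-factor = go (factorise (PB-O O-π) π≉0)
        where
        go : ∃[ n ] ∃[ u ] UnitPB u × π ≈ ϖ ^ n * u → ∃[ e ] ∃[ u ] UnitPB u × π ≈ ϖ ^ suc e * u
        go (zero  , u , (_ , U) , eq) =
            ⊥-elim (proj₂ max-π (unit-resp (sym (trans eq (*-identityˡ u))) U))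
        go (suc e , u , U , eq) = e , u , U , eq

  -- Bounded denominators and completeness of R

  π^-cancel : ∀ n {x y} → π ^ n * x ≈ π ^ n * y → x ≈ y
  π^-cancel n {x} {y} eq = begin
    x                               ≈⟨ *-identityˡ x ⟨
    1# * x                          ≈⟨ *-congʳ (^-inverse n π-inverse) ⟨
    π ^ n * π⁻¹ ^ n * x
      ≈⟨ solve 3 (λ u v x → u :* v :* x := v :* (u :* x)) refl (π ^ n) (π⁻¹ ^ n) x ⟩
    π⁻¹ ^ n * (π ^ n * x)           ≈⟨ *-congˡ eq ⟩
    π⁻¹ ^ n * (π ^ n * y)
      ≈⟨ solve 3 (λ u v x → u :* v :* x := v :* (u :* x)) refl (π ^ n) (π⁻¹ ^ n) y ⟨
    π ^ n * π⁻¹ ^ n * y             ≈⟨ *-congʳ (^-inverse n π-inverse) ⟩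
    1# * y                          ≈⟨ *-identityˡ y ⟩
    y                               ∎

  O-comparable : ∀ m {k} → O k → (∃[ l ] O l × k ≈ π ^ m * l) ⊎ (∃[ l ] O l × π ^ m ≈ k * l)
  O-comparable zero    {k} Ok = inj₁ (k , Ok , sym (*-identityˡ k))
  O-comparable (suc m) {k} Ok = ⊎-elim deeper (λ (l , Ol , eq) → inj₂ (π * l , O-* O-π Ol , (begin
      π * π ^ m      ≈⟨ *-congˡ eq ⟩
      π * (k * l)    ≈⟨ solve 3 (λ p k l → p :* (k :* l) := k :* (p :* l)) refl π k l ⟩
      k * (π * l)    ∎))) (O-comparable m Ok)
    where
    deeper : ∃[ l ] O l × k ≈ π ^ m * l →
             (∃[ l ] O l × k ≈ π ^ suc m * l) ⊎ (∃[ l ] O l × π ^ suc m ≈ k * l)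
    deeper (l , Ol , eq) with O-dichotomy Ol
    ... | inj₁ (l⁻¹ , Ol⁻¹ , inv) = inj₂ (π * l⁻¹ , O-* O-π Ol⁻¹ , (begin
      π * π ^ m                   ≈⟨ *-identityʳ _ ⟨
      π * π ^ m * 1#              ≈⟨ *-congˡ inv ⟨
      π * π ^ m * (l * l⁻¹)
        ≈⟨ solve 4 (λ p u l i → p :* u :* (l :* i) := u :* l :* (p :* i)) refl π (π ^ m) l l⁻¹ ⟩
      π ^ m * l * (π * l⁻¹)       ≈⟨ *-congʳ eq ⟨
      k * (π * l⁻¹)               ∎))
    ... | inj₂ (l′ , Ol′ , l≈) = inj₁ (l′ , Ol′ , (begin
      k                     ≈⟨ trans eq (*-congˡ l≈) ⟩
      π ^ m * (π * l′)      ≈⟨ solve 3 (λ p u l → u :* (p :* l) := p :* u :* l) refl π (π ^ m) l′ ⟩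
      π * π ^ m * l′        ∎))

  PB-π^ : ∀ n {x} → PowerBounded x → PowerBounded (π ^ n * x)
  PB-π^ n px = PB-* (PB-^ n (PB-O O-π)) px

  -- For x nonzero some `π ^ m` clears the denominator of its inverse; divisibility of x by
  -- `π ^ suc m` would then make π a unit.
  PB-separated : ∀ {x} → (∀ n → ∃[ r ] PowerBounded r × x ≈ π ^ n * r) → x ≈ 0#
  PB-separated {x} h = decidable-stable (em ℓ) λ x≉0 →
    let y , xy = inverse x x≉0
        m , pmy = archimedean y
        r , pr , eq = h (suc m)
    in π-nonunit (PB-* pr pmy) (begin
      π * (r * (π ^ m * y))
        ≈⟨ solve 4 (λ p r u y → p :* (r :* (u :* y)) := p :* u :* r :* y) refl π r (π ^ m) y ⟩
      π * π ^ m * r * y       ≈⟨ *-congʳ eq ⟨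
      x * y                   ≈⟨ xy ⟩
      1#                      ∎)

  abstract
    span-PB : ∀ bs → ∃[ m ] (∀ {x} → Span O bs x → PowerBounded (π ^ m * x))
    span-PB [] = 0 , λ { (nil x≈0) → PB-resp (sym (trans (*-congˡ x≈0) (zeroʳ _))) PB-0 }
    span-PB (b ∷ bs) =
      let m , pb = archimedean b
          n , h = span-PB bs
      in m ℕ.+ n , λ { {x} (cons {a = a} {s} Oa S x≈) → PB-resp (begin
        a * (π ^ n * (π ^ m * b)) + π ^ m * (π ^ n * s)
          ≈⟨ solve 5 (λ a u v b s → a :* (u :* (v :* b)) :+ v :* (u :* s) :=
               v :* u :* (a :* b :+ s))
               refl a (π ^ n) (π ^ m) b s ⟩
        π ^ m * π ^ n * (a * b + s)    ≈⟨ *-cong (^-homo-* π m n) x≈ ⟨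
        π ^ (m ℕ.+ n) * x              ∎)
        (PB-+ (PB-* (PB-O Oa) (PB-π^ n pb)) (PB-π^ m (h S))) }

  SpanK : List Carrier → Carrier → Set q
  SpanK bs x = ∃[ m ] Span O bs (π ^ m * x)

  spanK-resp : ∀ {bs x y} → x ≈ y → SpanK bs x → SpanK bs y
  spanK-resp {bs} x≈y (m , S) = m , IsSubmodule.resp (span-isSubmodule bs) (*-congˡ x≈y) S

  spanK-π^ : ∀ {bs x} n → SpanK bs (π ^ n * x) → SpanK bs x
  spanK-π^ {bs} {x} n (m , S) = m ℕ.+ n , IsSubmodule.resp (span-isSubmodule bs) (π^-+ m n x) S

  span⇒spanK : ∀ {bs x} → Span O bs x → SpanK bs x
  span⇒spanK {bs} S = 0 , IsSubmodule.resp (span-isSubmodule bs) (sym (*-identityˡ _)) S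

  spanK-+ : ∀ {bs x y} → SpanK bs x → SpanK bs y → SpanK bs (x + y)
  spanK-+ {bs} {x} {y} (m , S) (n , T) = m ℕ.+ n , resp (begin
    π ^ n * (π ^ m * x) + π ^ m * (π ^ n * y)
      ≈⟨ solve 4 (λ u v x y → u :* (v :* x) :+ v :* (u :* y) := v :* u :* (x :+ y))
           refl (π ^ n) (π ^ m) x y ⟩
    π ^ m * π ^ n * (x + y)                      ≈⟨ *-congʳ (^-homo-* π m n) ⟨
    π ^ (m ℕ.+ n) * (x + y)                      ∎) (+∈ (π^∈ n S) (π^∈ m T))
    where open IsSubmodule (span-isSubmodule bs)

  spanK-O : ∀ {bs a x} → O a → SpanK bs x → SpanK bs (a * x)
  spanK-O {bs} {a} {x} Oa (m , S) =
      m , resp (solve 3 (λ a u x → a :* (u :* x) := u :* (a :* x)) refl a (π ^ m) x) (*∈ Oa S)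
    where open IsSubmodule (span-isSubmodule bs)

  -- `π ^ c` is a common denominator for the part of R in the K-span of `bs`. For a basis of L this
  -- is the comparison of R with M₀ that a discriminant provides in the separable case.
  Bounds : List Carrier → ℕ → Set q
  Bounds bs c = ∀ {x} → PowerBounded x → SpanK bs x → Span O bs (π ^ c * x)

  abstract
    -- Scaled by `π ^ c`, the digits enter the O-span, where the series has a sum; scaled by
    -- `π ^ m`, the remainders return to R.
    bounded-series : ∀ {bs c} → Bounds bs c → ∀ g → (∀ n → PowerBounded (g n)) →
                     (∀ n → SpanK bs (g n)) →
                     ∃[ s ] ∃[ m ] Span O bs s ×
                     (∀ n → ∃[ r ] PowerBounded r × π ^ m * (s - π ^ c * partial π g n) ≈ π ^ n * r)
    bounded-series {bs} {c} bound g pg Kg =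
      let s , conv = span-complete bs (λ n → π ^ c * g n) (λ n → bound (pg n) (Kg n))
          m , h = span-PB bs
          r₀ , S₀ , eq₀ = conv 0
      in s , m , IsSubmodule.resp (span-isSubmodule bs)
          (trans (solve 1 (λ r → r := :0 :+ :1 :* r) refl r₀) (sym eq₀)) S₀ ,
      λ n → let r , S , eq = conv n in π ^ m * r , h S , (begin
        π ^ m * (s - π ^ c * partial π g n)
          ≈⟨ *-congˡ (+-cong eq (-‿cong (sym (partial-* (π ^ c) g n)))) ⟩
        π ^ m * (partial π (λ n → π ^ c * g n) n + π ^ n * r - partial π (λ n → π ^ c * g n) n)
          ≈⟨ solve 4 (λ u P v r → u :* (P :+ v :* r :- P) := v :* (u :* r))
               refl (π ^ m) (partial π (λ n → π ^ c * g n) n) (π ^ n) r ⟩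
        π ^ n * (π ^ m * r) ∎)

  -- Either the coefficients k of b in elements of R are bounded, or they are arbitrarily large; in
  -- the latter case b is approximated by elements of the span of bs and lies in it by completeness.
  module Step {b : Carrier} {bs : List Carrier} {c₀ : ℕ} (bound : Bounds bs c₀) where
    open IsSubmodule (span-isSubmodule bs)

    record Relation (x : Carrier) : Set q where
      constructor relation
      field
        {m}   : ℕ
        {k s} : Carrier
        O-k   : O k
        S     : Span O bs s
        eq    : π ^ m * x ≈ k * b + s

    toRelation : ∀ {x} → SpanK (b ∷ bs) x → Relation x
    toRelation (m , cons Ok S eq) = relation {m = m} Ok S eq

    -- The coefficient of b in x is `k` divided by `π ^ m`. It belongs to a relation rather than to
    -- x, because b may depend on `bs`.
    CoefficientBound : ℕ → Set q
    CoefficientBound c = ∀ {x} → PowerBounded x → (R : Relation x) →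
      ∃[ l ] O l × π ^ c * Relation.k R ≈ π ^ Relation.m R * l

    -- With l the coefficient of b in `π ^ c * x`, the difference `π ^ c * x - l * b` lies in the
    -- K-span of `bs`. A further `π ^ a` puts it into R, because b need not be power bounded, and
    -- then `bound` applies.
    bounded-case : ∀ {c} → CoefficientBound c → ∃ (Bounds (b ∷ bs))
    bounded-case {c} cb = c₀ ℕ.+ (a ℕ.+ c) , λ px K → go px (toRelation K)
      where
      a : ℕ
      a = proj₁ (archimedean b)

      go : ∀ {x} → PowerBounded x → Relation x → Span O (b ∷ bs) (π ^ (c₀ ℕ.+ (a ℕ.+ c)) * x)
      go {x} px R@(relation {m} {k} {s} Ok S eq) =
        let l , Ol , kl = cb px R
            y = π ^ a * (π ^ c * x - l * b)
            my : π ^ m * y ≈ π ^ a * (π ^ c * s)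
            my = begin
              π ^ m * (π ^ a * (π ^ c * x - l * b))
                ≈⟨ solve 6 (λ u v w x l b → u :* (v :* (w :* x :- l :* b)) :=
                     v :* (w :* (u :* x) :- u :* l :* b))
                     refl (π ^ m) (π ^ a) (π ^ c) x l b ⟩
              π ^ a * (π ^ c * (π ^ m * x) - π ^ m * l * b)
                ≈⟨ *-congˡ (+-cong (*-congˡ eq) (-‿cong (*-congʳ (sym kl)))) ⟩
              π ^ a * (π ^ c * (k * b + s) - π ^ c * k * b)
                ≈⟨ solve 5 (λ v w k b s → v :* (w :* (k :* b :+ s) :- w :* k :* b) := v :* (w :* s))
                     refl (π ^ a) (π ^ c) k b s ⟩
              π ^ a * (π ^ c * s) ∎
            py : PowerBounded y
            py = PB-resp
                (solve 5 (λ v w x l b →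
                v :* (w :* x) :+ :- (l :* (v :* b)) := v :* (w :* x :- l :* b)) refl (π ^ a) (π ^ c)
                x l b)
                   (PB-+ (PB-π^ a (PB-π^ c px)) (PB-neg (PB-* (PB-O Ol) (proj₂ (archimedean b)))))
        in cons (O-* (O-^ c₀ O-π) (O-* (O-^ a O-π) Ol))
            (bound py (m , resp (sym my) (π^∈ a (π^∈ c S)))) (begin
          π ^ (c₀ ℕ.+ (a ℕ.+ c)) * x
            ≈⟨ trans (sym (π^-+ c₀ (a ℕ.+ c) x)) (*-congˡ (sym (π^-+ a c x))) ⟩
          π ^ c₀ * (π ^ a * (π ^ c * x))
            ≈⟨ solve 6 (λ u v w x l b → u :* (v :* (w :* x)) :=
                 u :* (v :* l) :* b :+ u :* (v :* (w :* x :- l :* b)))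
                 refl (π ^ c₀) (π ^ a) (π ^ c) x l b ⟩
          π ^ c₀ * (π ^ a * l) * b + π ^ c₀ * y ∎)

    Approximation : ℕ → Set q
    Approximation c = ∃[ t ] ∃[ r ] SpanK bs t × PowerBounded r × b ≈ t + π ^ c * r

    -- If `π ^ m` does not divide `π ^ c * k`, then `π ^ m = π ^ c * k * l` with l in O. Solving the
    -- relation for b leaves an element of the K-span of `bs` plus `π ^ c * (l * x)`.
    unbounded-approximation : ∀ {c x} → PowerBounded x → (R : Relation x) →
      ¬ (∃[ l ] O l × π ^ c * Relation.k R ≈ π ^ Relation.m R * l) → Approximation c
    unbounded-approximation {c} {x} px (relation {m} {k} {s} Ok S eq) ¬l =
      ⊎-elim (⊥-elim ∘ ¬l) go (O-comparable m (O-* (O-^ c O-π) Ok))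
      where
      go : ∃[ l ] O l × π ^ m ≈ π ^ c * k * l → Approximation c
      go (l , Ol , eq′) =
          b - π ^ c * (l * x) , l * x , (m , resp span-eq (*∈ (O-neg (O-* Ol (O-^ c O-π))) S)) ,
        PB-* (PB-O Ol) px , solve 2 (λ b u → b := (b :- u) :+ u) refl b (π ^ c * (l * x))
        where
        span-eq : - (l * π ^ c) * s ≈ π ^ m * (b - π ^ c * (l * x))
        span-eq = begin
          - (l * π ^ c) * s
            ≈⟨ solve 5 (λ l w s k b → :- (l :* w) :* s :=
                 w :* k :* l :* b :- w :* (l :* (k :* b :+ s)))
                 refl l (π ^ c) s k b ⟩
          π ^ c * k * l * b - π ^ c * (l * (k * b + s))
            ≈⟨ +-cong (*-congʳ eq′) (-‿cong (*-congˡ (*-congˡ eq))) ⟨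
          π ^ m * b - π ^ c * (l * (π ^ m * x))
            ≈⟨ solve 5 (λ u b w l x → u :* b :- w :* (l :* (u :* x)) := u :* (b :- w :* (l :* x)))
                 refl (π ^ m) b (π ^ c) l x ⟩
          π ^ m * (b - π ^ c * (l * x)) ∎

    module Limit (t r : ℕ → Carrier) (Kt : ∀ n → SpanK bs (t n)) (pr : ∀ n → PowerBounded (r n))
                 (approx : ∀ n → b ≈ t n + π ^ n * r n) where

      -- The digits of the approximating sequence: `π ^ n * g n` is `t (suc n) - t n`. The defining
      -- formula shows that they lie in R, the difference that they lie in the K-span.
      g : ℕ → Carrier
      g n = r n - π * r (suc n)

      difference : ∀ n → π ^ n * g n ≈ t (suc n) - t n
      difference n = begin
        π ^ n * (r n - π * r (suc n))
          ≈⟨ solve 6 (λ u r p r′ t t′ → u :* (r :- p :* r′) :=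
               (t :+ u :* r) :- (t′ :+ p :* u :* r′) :+ (t′ :- t)) refl
               (π ^ n) (r n) π (r (suc n)) (t n) (t (suc n)) ⟩
        (t n + π ^ n * r n) - (t (suc n) + π ^ suc n * r (suc n)) + (t (suc n) - t n)
          ≈⟨ +-congʳ (+-cong (approx n) (-‿cong (approx (suc n)))) ⟨
        b - b + (t (suc n) - t n)
          ≈⟨ solve 2 (λ b d → b :- b :+ d := d) refl b _ ⟩
        t (suc n) - t n ∎

      Kg : ∀ n → SpanK bs (g n)
      Kg n = spanK-π^ n (spanK-resp (trans (+-congˡ (-1*x≈-x (t n))) (sym (difference n)))
        (spanK-+ (Kt (suc n)) (spanK-O (O-neg O-1) (Kt n))))

      pg : ∀ n → PowerBounded (g n)
      pg n = PB-+ (pr n) (PB-neg (PB-* (PB-O O-π) (pr (suc n))))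

      telescope : ∀ n → b ≈ t 0 + partial π g n + π ^ n * r n
      telescope zero    =
          trans (approx 0) (solve 2 (λ t r → t :+ r := t :+ :0 :+ r) refl (t 0) (1# * r 0))
      telescope (suc n) = begin
        b   ≈⟨ telescope n ⟩
        t 0 + partial π g n + π ^ n * r n
          ≈⟨ solve 6 (λ t P u r p r′ → t :+ P :+ u :* r :=
               t :+ (P :+ u :* (r :- p :* r′)) :+ p :* u :* r′) refl
               (t 0) (partial π g n) (π ^ n) (r n) π (r (suc n)) ⟩
        t 0 + (partial π g n + π ^ n * g n) + π ^ suc n * r (suc n) ∎

      module _ (s : Carrier) (m : ℕ) (S : Span O bs s)
        (conv : ∀ n → ∃[ r ] PowerBounded r × π ^ m * (s - π ^ c₀ * partial π g n) ≈ π ^ n * r)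
            where

        gap : Carrier
        gap = π ^ c₀ * (b - t 0) - s

        -- `π ^ c₀ * (b - t 0)` and s are approximated by the same scaled partial sums, so after
        -- multiplication by `π ^ m` they agree up to `π ^ n` R.
        gap-small : ∀ n → ∃[ r ] PowerBounded r × π ^ m * gap ≈ π ^ n * r
        gap-small n = let r′ , pr′ , eq = conv n in
          π ^ m * (π ^ c₀ * r n) - r′ , PB-+ (PB-π^ m (PB-π^ c₀ (pr n))) (PB-neg pr′) , (begin
          π ^ m * (π ^ c₀ * (b - t 0) - s)
            ≈⟨ *-congˡ (+-congʳ (*-congˡ (+-congʳ (telescope n)))) ⟩
          π ^ m * (π ^ c₀ * (t 0 + partial π g n + π ^ n * r n - t 0) - s)
            ≈⟨ solve 7 (λ u w t P v r s → u :* (w :* (t :+ P :+ v :* r :- t) :- s) :=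
                 v :* (u :* (w :* r)) :- u :* (s :- w :* P)) refl
                 (π ^ m) (π ^ c₀) (t 0) (partial π g n) (π ^ n) (r n) s ⟩
          π ^ n * (π ^ m * (π ^ c₀ * r n)) - π ^ m * (s - π ^ c₀ * partial π g n)
            ≈⟨ +-congˡ (-‿cong eq) ⟩
          π ^ n * (π ^ m * (π ^ c₀ * r n)) - π ^ n * r′
            ≈⟨ solve 3 (λ v x y → v :* x :- v :* y := v :* (x :- y))
                 refl (π ^ n) (π ^ m * (π ^ c₀ * r n)) r′ ⟩
          π ^ n * (π ^ m * (π ^ c₀ * r n) - r′) ∎)

        in-span : SpanK bs b
        in-span = spanK-π^ c₀ (spanK-resp (begin
          s + π ^ c₀ * t 0              ≈⟨ +-congʳ (+-identityʳ s) ⟨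
          s + 0# + π ^ c₀ * t 0         ≈⟨ +-congʳ (+-congˡ gap≈0) ⟨
          s + gap + π ^ c₀ * t 0
            ≈⟨ solve 4 (λ s w b t → s :+ (w :* (b :- t) :- s) :+ w :* t := w :* b)
                 refl s (π ^ c₀) b (t 0) ⟩
          π ^ c₀ * b                    ∎)
          (spanK-+ (span⇒spanK S) (spanK-O (O-^ c₀ O-π) (Kt 0))))
          where
          gap≈0 : gap ≈ 0#
          gap≈0 = π^-cancel m (trans (PB-separated gap-small) (sym (zeroʳ _)))

      limit-in-span : SpanK bs b
      limit-in-span = let s , m , S , conv = bounded-series {c = c₀} bound g pg Kg in in-span s m S
          conv

    dependent-case : SpanK bs b → ∃ (Bounds (b ∷ bs))
    dependent-case Kb = c₀ , λ px K → go px (toRelation K)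
      where
      go : ∀ {x} → PowerBounded x → Relation x → Span O (b ∷ bs) (π ^ c₀ * x)
      go {x} px (relation {m} Ok S eq) = cons O-0
        (bound px (spanK-π^ m (spanK-resp (sym eq) (spanK-+ (spanK-O Ok Kb) (span⇒spanK S)))))
        (solve 2 (λ b y → y := :0 :* b :+ y) refl b (π ^ c₀ * x))

    abstract
      step : ∃ (Bounds (b ∷ bs))
      step = go (em q)
        where
        approximation : ¬ ∃ CoefficientBound → ∀ c → Approximation c
        approximation ¬cb c = decidable-stable (em q) λ ¬a → ¬cb (c , λ px R →
          decidable-stable (em q) λ ¬l → ¬a (unbounded-approximation {c} px R ¬l))

        go : Dec (∃ CoefficientBound) → ∃ (Bounds (b ∷ bs))
        go (yes (c , cb)) = bounded-case {c} cb
        go (no ¬cb) =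
            dependent-case (Limit.limit-in-span (λ n → proj₁ (a n)) (λ n → proj₁ (proj₂ (a n)))
          (λ n → proj₁ (proj₂ (proj₂ (a n)))) (λ n → proj₁ (proj₂ (proj₂ (proj₂ (a n)))))
          (λ n → proj₂ (proj₂ (proj₂ (proj₂ (a n))))))
          where
          a : ∀ n → Approximation n
          a = approximation ¬cb

  abstract
    bounds : ∀ bs → ∃ (Bounds bs)
    bounds [] =
        0 , λ { _ (m , nil eq) →
        nil (trans (*-identityˡ _) (π^-cancel m (trans eq (sym (zeroʳ _))))) }
    bounds (b ∷ bs) = let c , bound = bounds bs in Step.step {c₀ = c} bound

    PB-complete : ∀ g → (∀ n → PowerBounded (g n)) →
                  ∃[ s ] ∃[ m ]
                      (∀ n → ∃[ r ] PowerBounded r × π ^ m * (s - partial π g n) ≈ π ^ n * r)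
    PB-complete g pg =
      let c , bound = bounds basis
          s , m , _ , conv = bounded-series {c = c} bound g pg (λ n → spanning (g n))
      in π⁻¹ ^ c * s , m ℕ.+ c , λ n → let r , pr , eq = conv n in r , pr , (begin
        π ^ (m ℕ.+ c) * (π⁻¹ ^ c * s - partial π g n)
          ≈⟨ *-congʳ (^-homo-* π m c) ⟩
        π ^ m * π ^ c * (π⁻¹ ^ c * s - partial π g n)
          ≈⟨ solve 5 (λ u v i s P → u :* v :* (i :* s :- P) := u :* (v :* i :* s :- v :* P))
               refl (π ^ m) (π ^ c) (π⁻¹ ^ c) s (partial π g n) ⟩
        π ^ m * (π ^ c * π⁻¹ ^ c * s - π ^ c * partial π g n)
          ≈⟨ *-congˡ (+-congʳ (trans (*-congʳ (^-inverse c π-inverse)) (*-identityˡ s))) ⟩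
        π ^ m * (s - π ^ c * partial π g n)
          ≈⟨ eq ⟩
        π ^ n * r ∎)

  -- The valuation defined by a uniformiser

  module IntegerPowers {x y : Carrier} (xy : x * y ≈ 1#) where

    power : ℤ → Carrier
    power (ℤ.+ n)  = x ^ n
    power -[1+ n ] = y ^ suc n

    power-⊖ : ∀ m n → power (m ℤ.⊖ n) ≈ x ^ m * y ^ n
    power-⊖ m       zero    = sym (*-identityʳ _)
    power-⊖ zero    (suc n) = sym (*-identityˡ _)
    power-⊖ (suc m) (suc n) = begin
      power (suc m ℤ.⊖ suc n)     ≡⟨ ≡.cong power (ℤ.[1+m]⊖[1+n]≡m⊖n m n) ⟩
      power (m ℤ.⊖ n)             ≈⟨ power-⊖ m n ⟩
      x ^ m * y ^ n               ≈⟨ *-identityˡ _ ⟨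
      1# * (x ^ m * y ^ n)        ≈⟨ *-congʳ xy ⟨
      x * y * (x ^ m * y ^ n)
        ≈⟨ solve 4 (λ x y u v → x :* y :* (u :* v) := x :* u :* (y :* v)) refl x y (x ^ m) (y ^ n) ⟩
      x ^ suc m * y ^ suc n       ∎

    power-+ : ∀ i j → power (i ℤ.+ j) ≈ power i * power j
    power-+ (ℤ.+ m)  (ℤ.+ n)  = ^-homo-* x m n
    power-+ (ℤ.+ m)  -[1+ n ] = power-⊖ m (suc n)
    power-+ -[1+ m ] (ℤ.+ n)  = trans (power-⊖ n (suc m)) (*-comm _ _)
    power-+ -[1+ m ] -[1+ n ] = begin
      y ^ suc (suc (m ℕ.+ n))  ≡⟨ ≡.cong (λ k → y ^ suc k) (≡.sym (ℕ.+-suc m n)) ⟩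
      y ^ (suc m ℕ.+ suc n)    ≈⟨ ^-homo-* y (suc m) (suc n) ⟩
      y ^ suc m * y ^ suc n    ∎

    power-inverse : ∀ i → power i * power (ℤ.- i) ≈ 1#
    power-inverse i = trans (sym (power-+ i (ℤ.- i))) (reflexive (≡.cong power (ℤ.+-inverseʳ i)))

  generator≉0 : ∀ {ϖ} → Generator ϖ → ¬ ϖ ≈ 0#
  generator≉0 gen ϖ≈0 = let r , _ , eq = proj₂ gen max-π in π≉0
      (trans eq (trans (*-congʳ ϖ≈0) (zeroˡ r)))

  module Valuation {ϖ ϖ⁻¹ : Carrier} (gen : Generator ϖ) (ϖ-inverse : ϖ * ϖ⁻¹ ≈ 1#) where
    open Uniformiser ϖ gen public
    open IntegerPowers ϖ-inverse public

    UnitPB-1 : UnitPB 1#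
    UnitPB-1 = PB-1 , 1# , PB-1 , *-identityˡ 1#

    UnitPB-* : ∀ {u v} → UnitPB u → UnitPB v → UnitPB (u * v)
    UnitPB-* {u} {v} (pu , u′ , pu′ , uu′) (pv , v′ , pv′ , vv′) =
        PB-* pu pv , u′ * v′ , PB-* pu′ pv′ , (begin
      u * v * (u′ * v′)
        ≈⟨ solve 4 (λ u v u′ v′ → u :* v :* (u′ :* v′) := u :* u′ :* (v :* v′)) refl u v u′ v′ ⟩
      u * u′ * (v * v′)     ≈⟨ *-cong uu′ vv′ ⟩
      1# * 1#               ≈⟨ *-identityˡ 1# ⟩
      1#                    ∎)

    UnitPB-inverse : ∀ {u v} → UnitPB u → u * v ≈ 1# → UnitPB v
    UnitPB-inverse {u} {v} (pu , u′ , pu′ , uu′) uv = PB-resp (begin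
      u′              ≈⟨ *-identityˡ u′ ⟨
      1# * u′         ≈⟨ *-congʳ uv ⟨
      u * v * u′      ≈⟨ solve 3 (λ u v u′ → u :* v :* u′ := u :* u′ :* v) refl u v u′ ⟩
      u * u′ * v      ≈⟨ trans (*-congʳ uu′) (*-identityˡ v) ⟩
      v               ∎) pu′ , u , pu , trans (*-comm v u) uv

    UnitPB⇒≉0 : ∀ {u} → UnitPB u → ¬ u ≈ 0#
    UnitPB⇒≉0 (_ , u′ , _ , uu′) u≈0 = 1≉0 (trans (sym uu′) (trans (*-congʳ u≈0) (zeroˡ u′)))

    record Polar (x : Carrier) : Set q where
      constructor polar
      field
        degree : ℤ
        unit   : Carrier
        isUnit : UnitPB unit
        eq     : x ≈ power degree * unit

    inverse-product : ∀ {x y p n u v} → x * y ≈ 1# → p * n ≈ 1# → u * v ≈ 1# → x ≈ p * u → y ≈ n * v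
    inverse-product {x} {y} {p} {n} {u} {v} xy pn uv eq = begin
      y                     ≈⟨ *-identityˡ y ⟨
      1# * y                ≈⟨ *-congʳ (trans (*-cong pn uv) (*-identityˡ 1#)) ⟨
      p * n * (u * v) * y
        ≈⟨ solve 5 (λ p n u v y → p :* n :* (u :* v) :* y := p :* u :* y :* (n :* v))
             refl p n u v y ⟩
      p * u * y * (n * v)   ≈⟨ *-congʳ (*-congʳ eq) ⟨
      x * y * (n * v)       ≈⟨ trans (*-congʳ xy) (*-identityˡ _) ⟩
      n * v                 ∎

    polar-inverse : ∀ {x y} → x * y ≈ 1# → Polar x → Polar y
    polar-inverse xy (polar i u U eq) = let u′ , _ , uu′ = proj₂ U in
      polar (ℤ.- i) u′ (UnitPB-inverse U uu′) (inverse-product xy (power-inverse i) uu′ eq)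

    polar-PB : ∀ {x} → PowerBounded x → ¬ x ≈ 0# → Σ[ P ∈ Polar x ] ∃[ n ] Polar.degree P ≡ ℤ.+ n
    polar-PB px x≉0 = let n , u , U , eq = factorise px x≉0 in polar (ℤ.+ n) u U eq , n , ≡.refl

    inverse≉0 : ∀ {x y} → x * y ≈ 1# → ¬ y ≈ 0#
    inverse≉0 {x} xy y≈0 = 1≉0 (trans (sym xy) (trans (*-congˡ y≈0) (zeroʳ x)))

    abstract
      toPolar : ∀ {x} → ¬ x ≈ 0# → Polar x
      toPolar {x} x≉0 = let y , xy = inverse x x≉0 in
        ⊎-elim (λ px → proj₁ (polar-PB px x≉0))
               (λ py → polar-inverse (trans (*-comm y x) xy) (proj₁ (polar-PB py (inverse≉0 xy))))
               (valuation-ring xy)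

    power-unit : ∀ i → UnitPB (power i) → i ≡ ℤ.0ℤ
    power-unit (ℤ.+ zero)  _       = ≡.refl
    power-unit (ℤ.+ suc n) (_ , U) =
        ⊥-elim (proj₂ (proj₁ gen) (factor-unit (PB-^ n (proj₁ (proj₁ gen))) U))
    power-unit -[1+ n ] (p , _) = ⊥-elim (proj₂ (proj₁ gen)
      (ϖ ^ n * power -[1+ n ] , PB-* (PB-^ n (proj₁ (proj₁ gen))) p ,
          trans (sym (*-assoc _ _ _)) (power-inverse (ℤ.+ suc n))))

    -- Comparing two polar forms exhibits `power (i - j)` as a unit of R, and only the zeroth power
    -- of ϖ is one.
    degree-unique : ∀ {x} (P Q : Polar x) → Polar.degree P ≡ Polar.degree Q
    degree-unique {x} (polar i u U eq) (polar j u′ U′@(_ , u″ , _ , u′u″) eq′) =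
      ℤ.i-j≡0⇒i≡j i j
          (power-unit (i ℤ.- j) (UnitPB-inverse (UnitPB-* U (UnitPB-inverse U′ u′u″)) (begin
        u * u″ * power (i ℤ.- j)                            ≈⟨ *-congˡ (power-+ i (ℤ.- j)) ⟩
        u * u″ * (power i * power (ℤ.- j))
          ≈⟨ solve 4 (λ u v p n → u :* v :* (p :* n) := p :* u :* n :* v)
               refl u u″ (power i) (power (ℤ.- j)) ⟩
        power i * u * power (ℤ.- j) * u″
          ≈⟨ *-congʳ (*-congʳ (trans (sym eq) eq′)) ⟩
        power j * u′ * power (ℤ.- j) * u″
          ≈⟨ solve 4 (λ p u n v → p :* u :* n :* v := p :* n :* (u :* v))
               refl (power j) u′ (power (ℤ.- j)) u″ ⟩
        power j * power (ℤ.- j) * (u′ * u″)                 ≈⟨ *-cong (power-inverse j) u′u″ ⟩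
        1# * 1#                                             ≈⟨ *-identityˡ 1# ⟩
        1#                                                  ∎)))

    polar≉0 : ∀ {x} → Polar x → ¬ x ≈ 0#
    polar≉0 (polar i u U eq) x≈0 = UnitPB⇒≉0 U (zero-product
      (λ p≈0 → 1≉0 (trans (sym (power-inverse i)) (trans (*-congʳ p≈0) (zeroˡ _))))
          (trans (sym eq) x≈0))

    -- The sign follows the order of `ℤₘ₀`, in which more divisible elements are smaller: ϖ receives
    -- the value `[ -1 ]`.
    value : ∀ {x} → Dec (x ≈ 0#) → ℤₘ₀
    value (yes _)   = 𝟘
    value (no x≉0) = [ ℤ.- Polar.degree (toPolar x≉0) ]

    abstract
      w : Carrier → ℤₘ₀
      w x = value (em ℓ {x ≈ 0#})

      w-zero : ∀ {x} → x ≈ 0# → w x ≡ 𝟘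
      w-zero {x} x≈0 = go (em ℓ)
        where
        go : (d : Dec (x ≈ 0#)) → value d ≡ 𝟘
        go (yes _)  = ≡.refl
        go (no x≉0) = ⊥-elim (x≉0 x≈0)

      w-polar : ∀ {x} (P : Polar x) → w x ≡ [ ℤ.- Polar.degree P ]
      w-polar {x} P = go (em ℓ)
        where
        go : (d : Dec (x ≈ 0#)) → value d ≡ [ ℤ.- Polar.degree P ]
        go (yes x≈0) = ⊥-elim (polar≉0 P x≈0)
        go (no x≉0)  = ≡.cong (λ i → [ ℤ.- i ]) (degree-unique (toPolar x≉0) P)

    polar-1 : Polar 1#
    polar-1 = polar ℤ.0ℤ 1# UnitPB-1 (sym (*-identityˡ 1#))

    polar-* : ∀ {x y} (P : Polar x) (Q : Polar y) →
              Σ[ R ∈ Polar (x * y) ] Polar.degree R ≡ Polar.degree P ℤ.+ Polar.degree Q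
    polar-* {x} {y} (polar i u U eq) (polar j v V eq′) =
        polar (i ℤ.+ j) (u * v) (UnitPB-* U V) (begin
      x * y                               ≈⟨ *-cong eq eq′ ⟩
      power i * u * (power j * v)
        ≈⟨ solve 4 (λ p u r v → p :* u :* (r :* v) := p :* r :* (u :* v))
             refl (power i) u (power j) v ⟩
      power i * power j * (u * v)         ≈⟨ *-congʳ (power-+ i j) ⟨
      power (i ℤ.+ j) * (u * v)           ∎) , ≡.refl

    polar-resp : ∀ {x y} → x ≈ y → (P : Polar x) → Σ[ Q ∈ Polar y ] Polar.degree Q ≡ Polar.degree P
    polar-resp x≈y (polar i u U eq) = polar i u U (trans (sym x≈y) eq) , ≡.refl

    zero⊎polar : ∀ x → x ≈ 0# ⊎ Polar x
    zero⊎polar x = go (em ℓ)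
      where
      go : Dec (x ≈ 0#) → x ≈ 0# ⊎ Polar x
      go (yes x≈0) = inj₁ x≈0
      go (no x≉0)  = inj₂ (toPolar x≉0)

    w-cong : ∀ {x y} → x ≈ y → w x ≡ w y
    w-cong {x} x≈y = ⊎-elim
      (λ x≈0 → ≡.trans (w-zero x≈0) (≡.sym (w-zero (trans (sym x≈y) x≈0))))
      (λ P → let Q , eq = polar-resp x≈y P in
        ≡.trans (w-polar P) (≡.trans (≡.cong (λ i → [ ℤ.- i ]) (≡.sym eq)) (≡.sym (w-polar Q))))
      (zero⊎polar x)

    w-* : ∀ x y → w (x * y) ≡ w x · w y
    w-* x y = ⊎-elim
      (λ x≈0 → ≡.trans (w-zero (trans (*-congʳ x≈0) (zeroˡ y)))
          (≡.cong (_· w y) (≡.sym (w-zero x≈0))))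
      (λ P → ⊎-elim
        (λ y≈0 → ≡.trans (w-zero (trans (*-congˡ y≈0) (zeroʳ x)))
          (≡.trans (≡.sym (·-𝟘 (w x))) (≡.cong (w x ·_) (≡.sym (w-zero y≈0)))))
        (λ Q → let R , eq = polar-* P Q in
          ≡.trans (w-polar R) (≡.trans
            (≡.cong [_]
                (≡.trans (≡.cong ℤ.-_ eq) (ℤ.neg-distrib-+ (Polar.degree P) (Polar.degree Q))))
            (≡.sym (≡.cong₂ _·_ (w-polar P) (w-polar Q)))))
        (zero⊎polar y))
      (zero⊎polar x)

    PB⇒w≤𝟙 : ∀ {x} → PowerBounded x → w x ≤₀ 𝟙
    PB⇒w≤𝟙 {x} px = go (em ℓ)
      where
      go : Dec (x ≈ 0#) → w x ≤₀ 𝟙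
      go (yes x≈0) = ≡.subst (_≤₀ 𝟙) (≡.sym (w-zero x≈0)) (⊥₋≤ _)
      go (no x≉0)  = let P , n , eq = polar-PB px x≉0 in
        ≡.subst (_≤₀ 𝟙) (≡.sym (≡.trans (w-polar P) (≡.cong (λ i → [ ℤ.- i ]) eq)))
            [ ℤ.neg-≤-pos {n} {0} ]

    degree-PB : ∀ {x} (P : Polar x) → [ ℤ.- Polar.degree P ] ≤₀ 𝟙 → PowerBounded x
    degree-PB (polar (ℤ.+ n)  u (pu , _) eq) _ =
        PB-resp (sym eq) (PB-* (PB-^ n (proj₁ (proj₁ gen))) pu)
    degree-PB (polar -[1+ n ] u _ eq) [ ℤ.+≤+ () ]

    w≤𝟙⇒PB : ∀ {x} → w x ≤₀ 𝟙 → PowerBounded x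
    w≤𝟙⇒PB {x} wx = ⊎-elim
      (λ x≈0 → PB-resp (sym x≈0) PB-0)
      (λ P → degree-PB P (≡.subst (_≤₀ 𝟙) (w-polar P) wx))
      (zero⊎polar x)

    w-1 : w 1# ≡ 𝟙
    w-1 = w-polar polar-1

    w-power : ∀ i → w (power i) ≡ [ ℤ.- i ]
    w-power i = w-polar (polar i 1# UnitPB-1 (sym (*-identityʳ _)))

    w≤⇒PB : ∀ {x} i → w x ≤₀ [ ℤ.- i ] → ∃[ r ] PowerBounded r × x ≈ power i * r
    w≤⇒PB {x} i wx = power (ℤ.- i) * x , w≤𝟙⇒PB (≡.subst (_≤₀ 𝟙) (≡.sym (w-* _ x))
      (≤₀-trans (·-mono-≤₀ (≤₀-reflexive (w-power (ℤ.- i))) wx)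
          (≤₀-reflexive (≡.cong [_] (ℤ.+-inverseˡ (ℤ.- i)))))) , (begin
        x                                ≈⟨ *-identityˡ x ⟨
        1# * x                           ≈⟨ *-congʳ (power-inverse i) ⟨
        power i * power (ℤ.- i) * x      ≈⟨ *-assoc _ _ _ ⟩
        power i * (power (ℤ.- i) * x)    ∎)

    PB⇒w≤ : ∀ {x} i {r} → PowerBounded r → x ≈ power i * r → w x ≤₀ [ ℤ.- i ]
    PB⇒w≤ {x} i {r} pr eq =
        ≤₀-trans (≤₀-reflexive
        (≡.trans (w-cong eq) (≡.trans (w-* _ r) (≡.cong (_· w r) (w-power i)))))
      (·-decreasing [ ℤ.- i ] (PB⇒w≤𝟙 pr))

    -- If y has degree i, both x and y are ϖ ^ i times elements of R, and R is closed under
    -- addition.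
    w-+-ordered : ∀ x y → w x ≤₀ w y → w (x + y) ≤₀ w y
    w-+-ordered x y wx≤wy = ⊎-elim zero-case polar-case (zero⊎polar y)
      where
      zero-case : y ≈ 0# → w (x + y) ≤₀ w y
      zero-case y≈0 = ≤₀-trans (≤₀-reflexive (w-cong (trans (+-congˡ y≈0) (+-identityʳ x)))) wx≤wy

      polar-case : Polar y → w (x + y) ≤₀ w y
      polar-case P@(polar i u (pu , _) eq) =
        let r , pr , eq′ = w≤⇒PB {x} i (≡.subst (w x ≤₀_) (w-polar P) wx≤wy) in
        ≡.subst (w (x + y) ≤₀_) (≡.sym (w-polar P))
            (PB⇒w≤ i (PB-+ pr pu) (trans (+-cong eq′ eq) (sym (distribˡ _ _ _))))

    w-+ : ∀ x y → w (x + y) ≤₀ w x ⊔₀ w y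
    w-+ x y = ⊎-elim
      (λ p → ≤₀-trans (w-+-ordered x y p) (y≤₀x⊔y (w x) (w y)))
      (λ p → ≤₀-trans (≤₀-reflexive (w-cong (+-comm x y)))
          (≤₀-trans (w-+-ordered y x p) (x≤₀x⊔y (w x) (w y))))
      (≤₀-total (w x) (w y))

    w-surjective : ∀ γ → ∃[ x ] (∀ {z} → z ≈ x → w z ≡ γ)
    w-surjective ⊥₋    = 0# , w-zero
    w-surjective [ i ] =
        power (ℤ.- i) , λ eq →
        ≡.trans (w-cong eq) (≡.trans (w-power (ℤ.- i)) (≡.cong [_] (ℤ.neg-involutive i)))

    w-isDiscreteValuation : IsDiscreteValuation L w
    w-isDiscreteValuation = record
      { isValuation = record
          { v-cong = w-cong ; v-0 = w-zero refl ; v-1 = w-1 ; v-* = w-* ; v-+ = w-+ }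
      ; surjective  = w-surjective }

  -- Completeness and uniqueness of w

  module Properties {ϖ ϖ⁻¹ : Carrier} (gen : Generator ϖ) (ϖ-inverse : ϖ * ϖ⁻¹ ≈ 1#) where
    open Valuation gen ϖ-inverse public
    open IsDiscreteValuation w-isDiscreteValuation using () renaming (isValuation to w-isValuation)
    module W = ValuationProperties L w-isValuation

    w-π : ∃[ e ] w π ≡ [ ℤ.- (ℤ.+ suc e) ]
    w-π = let e , u , U , eq = π-factor in e , w-polar (polar (ℤ.+ suc e) u U eq)

    w-OUnit : ∀ {x} → O x → OUnit x → w x ≡ 𝟙
    w-OUnit Ox u = w-polar (polar ℤ.0ℤ _ (PB-O Ox , OUnit⇒unit u) (sym (*-identityˡ _)))

    -- Radii are values of powers of π rather than of ϖ because the series of `PB-complete` are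
    -- π-adic.
    radius : ℕ → ℤₘ₀
    radius n = w (π ^ n)

    abstract
      radius-value : ∀ n → radius n ≡ [ ℤ.- (ℤ.+ (n ℕ.* suc (proj₁ w-π))) ]
      radius-value n = let e , wπ = w-π in ≡.trans (W.v-^ π n)
          (≡.trans (≡.cong (_^₀ n) wπ) (≡.trans ([]-^₀ _ n)
        (≡.cong [_]
            (≡.trans (≡.sym (ℤ.neg-distribʳ-* (ℤ.+ n) (ℤ.+ suc e)))
            (≡.cong ℤ.-_ (≡.sym (ℤ.pos-* n (suc e))))))))

    radius≢𝟘 : ∀ n → radius n ≢ 𝟘
    radius≢𝟘 n eq = []≢𝟘 (≡.trans (≡.sym (radius-value n)) eq)

    radius-antitone : ∀ m n → radius (m ℕ.+ n) ≤₀ radius m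
    radius-antitone m n = ≤₀-trans (≤₀-reflexive (≡.trans (w-cong (^-homo-* π m n)) (w-* _ _)))
      (·-decreasing (radius m) (PB⇒w≤𝟙 (PB-^ n (PB-O O-π))))

    abstract
      radius-cofinal : ∀ g → ∃[ n ] radius n ≤₀ [ g ]
      radius-cofinal g = ℤ.∣ g ∣ , ≤₀-trans (≤₀-reflexive (radius-value ℤ.∣ g ∣))
        [ ℤ.≤-trans (ℤ.neg-mono-≤ (ℤ.+≤+ (ℕ.m≤m*n ℤ.∣ g ∣ (suc (proj₁ w-π))))) (neg-∣∣≤ g) ]

      divide-π^ : ∀ n {x} → w x ≤₀ radius n → ∃[ r ] PowerBounded r × x ≈ π ^ n * r
      divide-π^ n {x} wx = π⁻¹ ^ n * x , w≤𝟙⇒PB (≤₀-trans (≤₀-reflexive (w-* _ x)) (≤₀-trans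
        (·-mono-≤₀ (≤₀-refl {w (π⁻¹ ^ n)}) wx)
        (≤₀-reflexive
            (≡.trans (≡.sym (w-* _ _))
            (≡.trans (w-cong (trans (*-comm _ _) (^-inverse n π-inverse))) w-1))))) , (begin
          x                        ≈⟨ *-identityˡ x ⟨
          1# * x                   ≈⟨ *-congʳ (^-inverse n π-inverse) ⟨
          π ^ n * π⁻¹ ^ n * x      ≈⟨ *-assoc _ _ _ ⟩
          π ^ n * (π⁻¹ ^ n * x)    ∎)

    module _ (x g : ℕ → Carrier) (difference : ∀ n → x (suc n) - x n ≈ π ^ n * g n) where

      telescope : ∀ n → x n ≈ x 0 + partial π g n
      telescope zero    = sym (+-identityʳ _)
      telescope (suc n) = begin
        x (suc n)
          ≈⟨ solve 2 (λ a b → a := b :+ (a :- b)) refl (x (suc n)) (x n) ⟩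
        x n + (x (suc n) - x n)                ≈⟨ +-cong (telescope n) (difference n) ⟩
        x 0 + partial π g n + π ^ n * g n      ≈⟨ +-assoc _ _ _ ⟩
        x 0 + partial π g (suc n)              ∎

      -- The index `m + k` absorbs the factor `π ^ m` lost in `PB-complete`, and precision `π ^ k`
      -- remains.
      error : ∀ s m k r {n} → n ≡ m ℕ.+ k → π ^ m * (s - partial π g n) ≈ π ^ n * r →
              x n - (x 0 + s) ≈ π ^ k * - r
      error s m k r {n} ≡.refl eq = begin
        x n - (x 0 + s)                          ≈⟨ +-congʳ (telescope n) ⟩
        x 0 + partial π g n - (x 0 + s)
          ≈⟨ solve 3 (λ x P s → x :+ P :- (x :+ s) := :- (s :- P)) refl (x 0) (partial π g n) s ⟩
        - (s - partial π g n)
          ≈⟨ -‿cong (π^-cancel m (trans eq (sym (π^-+ m k r)))) ⟩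
        - (π ^ k * r)                            ≈⟨ -‿distribʳ-* _ _ ⟩
        π ^ k * - r                              ∎

      w-error : ∀ s m k r {n} → PowerBounded r → n ≡ m ℕ.+ k →
                π ^ m * (s - partial π g n) ≈ π ^ n * r →
                w (x n - (x 0 + s)) ≤₀ radius k
      w-error s m k r pr n≡ eq = ≤₀-trans
        (≤₀-reflexive (≡.trans (w-cong (error s m k r n≡ eq)) (w-* (π ^ k) (- r))))
        (·-decreasing (radius k) (PB⇒w≤𝟙 (PB-neg pr)))

      differences-limit : (∀ n → PowerBounded (g n)) →
                          ∃[ a ] (∀ h → ∃[ N ] (∀ n → w (x (N ℕ.+ n) - a) ≤₀ [ h ]))
      differences-limit pg = let s , m , conv = PB-complete g pg in
        x 0 + s , λ h → let k , rk = radius-cofinal h in m ℕ.+ k , λ n →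
          let r , pr , eq = conv (m ℕ.+ k ℕ.+ n) in
          ≤₀-trans (w-error s m (k ℕ.+ n) r pr (ℕ.+-assoc m k n) eq)
              (≤₀-trans (radius-antitone k n) rk)

    w-limit : ∀ x → (∀ n → w (x (suc n) - x n) ≤₀ radius n) →
              ∃[ a ] (∀ g → ∃[ N ] (∀ n → w (x (N ℕ.+ n) - a) ≤₀ [ g ]))
    w-limit x close =
        differences-limit x (λ n → proj₁ (step n)) (λ n → proj₂ (proj₂ (step n)))
        (λ n → proj₁ (proj₂ (step n)))
      where
      step : ∀ n → ∃[ r ] PowerBounded r × x (suc n) - x n ≈ π ^ n * r
      step n = divide-π^ n (close n)

    w-complete : IsComplete L w
    w-complete =
        W.sequentially-complete⇒complete radius radius≢𝟘 radius-antitone radius-cofinal w-limit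

    module Unique {w′ : Carrier → ℤₘ₀} (dw′ : IsDiscreteValuation L w′)
        (O-≤𝟙 : ∀ {x} → O x → w′ x ≤₀ 𝟙) where
      open IsDiscreteValuation dw′
      open ValuationProperties L isValuation hiding (1≉0)

      value-bound : ∀ γ → ∃[ B ] γ ≤₀ [ B ]
      value-bound ⊥₋    = ℤ.0ℤ , ⊥₋≤ _
      value-bound [ B ] = B , ≤₀-refl

      -- Coefficients in O do not increase `w′`, so the values of the finitely many generators bound
      -- it.
      span-bound : ∀ bs → ∃[ B ] (∀ {x} → Span O bs x → w′ x ≤₀ [ B ])
      span-bound [] = ℤ.0ℤ , λ { (nil x≈0) → ≤₀-trans (≤₀-reflexive (v-zero x≈0)) (⊥₋≤ _) }
      span-bound (b ∷ bs) =
        let β , hβ = value-bound (w′ b)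
            B , hB = span-bound bs
        in β ℤ.⊔ B , λ { (cons {a = a} {s} Oa S x≈) → ≤₀-trans (≤₀-reflexive (v-cong x≈)) (v-+-≤
          (≤₀-trans (≤₀-reflexive (≡.trans (v-* a b) (·-comm (w′ a) (w′ b))))
            (≤₀-trans (·-decreasing (w′ b) (O-≤𝟙 Oa)) (≤₀-trans hβ [ ℤ.i≤i⊔j β B ])))
          (≤₀-trans (hB S) [ ℤ.i≤j⊔i β B ])) }

      nonzero-value : ∀ {x y} → x * y ≈ 1# → ∃[ i ] w′ x ≡ [ i ]
      nonzero-value {x} {y} xy = go (w′ x) ≡.refl
        where
        go : ∀ γ → w′ x ≡ γ → ∃[ i ] w′ x ≡ [ i ]
        go [ i ] eq = i , eq
        go ⊥₋    eq =
            ⊥-elim ([]≢𝟘 (≡.trans (≡.sym v-1)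
            (≡.trans (v-cong (sym xy)) (≡.trans (v-* x y) (≡.cong (_· w′ y) eq)))))

      -- All `π ^ m * x ^ n` lie in M₀, so e + n j is bounded independently of n, where e and j are
      -- the exponents of `π ^ m` and x. Hence j is not positive.
      PB⇒≤𝟙 : ∀ {x} → PowerBounded x → w′ x ≤₀ 𝟙
      PB⇒≤𝟙 {x} (m , h) = go (w′ x) ≡.refl
        where
        B e : ℤ
        B = proj₁ (span-bound basis)
        e = proj₁ (nonzero-value (^-inverse m π-inverse))

        go : ∀ γ → w′ x ≡ γ → w′ x ≤₀ 𝟙
        go ⊥₋    eq = ≤₀-trans (≤₀-reflexive eq) (⊥₋≤ _)
        go [ j ] eq = ≤₀-trans (≤₀-reflexive eq) [ bounded-multiples j (ℤ.- e ℤ.+ B) (λ n →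
          ≡.subst (ℤ._≤ ℤ.- e ℤ.+ B) (cancel n) (ℤ.+-monoʳ-≤ (ℤ.- e) (multiple n))) ]
          where
          multiple : ∀ n → e ℤ.+ ℤ.+ n ℤ.* j ℤ.≤ B
          multiple n = [≤]-injective (≤₀-trans (≤₀-reflexive (≡.sym (≡.trans (v-* (π ^ m) (x ^ n))
            (≡.cong₂ _·_ (proj₂ (nonzero-value (^-inverse m π-inverse)))
              (≡.trans (v-^ x n) (≡.trans (≡.cong (_^₀ n) eq) ([]-^₀ j n)))))))
            (proj₂ (span-bound basis) (h n)))

          cancel : ∀ n → ℤ.- e ℤ.+ (e ℤ.+ ℤ.+ n ℤ.* j) ≡ ℤ.+ n ℤ.* j
          cancel n =
              ≡.trans (≡.sym (ℤ.+-assoc (ℤ.- e) e _))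
              (≡.trans (≡.cong (ℤ._+ _) (ℤ.+-inverseˡ e)) (ℤ.+-identityˡ _))

      unit-value : ∀ {u} → UnitPB u → w′ u ≡ 𝟙
      unit-value {u} (pu , u′ , pu′ , uu′) = units-≤𝟙 (PB⇒≤𝟙 pu) (PB⇒≤𝟙 pu′)
        (≡.trans (≡.sym (v-* u u′)) (≡.trans (v-cong uu′) v-1))

      scale-factor : ℤ
      scale-factor = proj₁ (nonzero-value ϖ-inverse)

      ϖ-value : w′ ϖ ≡ [ scale-factor ]
      ϖ-value = proj₂ (nonzero-value ϖ-inverse)

      ϖ^-value : ∀ n → w′ (ϖ ^ n) ≡ [ ℤ.+ n ℤ.* scale-factor ]
      ϖ^-value n = ≡.trans (v-^ ϖ n) (≡.trans (≡.cong (_^₀ n) ϖ-value) ([]-^₀ scale-factor n))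

      power-value : ∀ i → w′ (power i) ≡ [ i ℤ.* scale-factor ]
      power-value (ℤ.+ n)  = ϖ^-value n
      power-value -[1+ n ] = ≡.trans (v-inverse (^-inverse (suc n) ϖ-inverse) (ϖ^-value (suc n)))
        (≡.cong [_] (ℤ.neg-distribˡ-* (ℤ.+ suc n) scale-factor))

      polar-value : ∀ {x} (P : Polar x) → w′ x ≡ [ Polar.degree P ℤ.* scale-factor ]
      polar-value (polar i u U eq) = ≡.trans (v-cong eq) (≡.trans (v-* (power i) u)
        (≡.trans (≡.cong₂ _·_ (power-value i) (unit-value U)) (·-identityʳ _)))

      -- All exponents of `w′` are multiples of `scale-factor`, so surjectivity makes it invertible
      -- in ℤ; it is not positive because ϖ lies in R.
      scale-factor≡-1 : scale-factor ≡ ℤ.-1ℤ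
      scale-factor≡-1 =
        let x , wx = surjective [ ℤ.1ℤ ] in
        ⊎-elim (λ x≈0 → ⊥-elim ([]≢𝟘 (≡.trans (≡.sym (wx refl)) (v-zero x≈0))))
               (λ P → integer-inverse (Polar.degree P) scale-factor
                 ([]-injective (≡.trans (≡.sym (polar-value P)) (wx refl)))
                 ([≤]-injective
                     (≤₀-trans (≤₀-reflexive (≡.sym ϖ-value)) (PB⇒≤𝟙 (proj₁ (proj₁ gen))))))
               (zero⊎polar x)

      unique : ∀ x → w x ≡ w′ x
      unique x = ⊎-elim
        (λ x≈0 → ≡.trans (w-zero x≈0) (≡.sym (v-zero x≈0)))
        (λ P → ≡.trans (w-polar P) (≡.sym (≡.trans (polar-value P) (≡.cong [_] (≡.trans
          (≡.cong (Polar.degree P ℤ.*_) scale-factor≡-1)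
          (≡.trans (ℤ.*-comm (Polar.degree P) ℤ.-1ℤ) (ℤ.-1*i≡-i (Polar.degree P))))))))
        (zero⊎polar x)

  record IsNormalisedExtension (w : Carrier → ℤₘ₀) : Set (q ⊔ lsuc 0ℓ) where
    field
      isDiscreteValuation : IsDiscreteValuation L w
      isComplete          : IsComplete L w
      w-π                 : ∃[ e ] w π ≡ [ ℤ.- (ℤ.+ suc e) ]
      w-OUnit             : ∀ {x} → O x → OUnit x → w x ≡ 𝟙
      unique              : ∀ {w′} → IsDiscreteValuation L w′ → (∀ {x} → O x → w′ x ≤₀ 𝟙) → ∀ x →
          w x ≡ w′ x

  abstract
    normalisedExtension : ∃ IsNormalisedExtension
    normalisedExtension = let ϖ , gen = generator in from gen (inverse ϖ (generator≉0 gen))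
      where
      from : ∀ {ϖ} → Generator ϖ → ∃[ ϖ⁻¹ ] ϖ * ϖ⁻¹ ≈ 1# → ∃ IsNormalisedExtension
      from gen (_ , ϖ-inverse) = P.w , record
        { isDiscreteValuation = P.w-isDiscreteValuation
        ; isComplete = P.w-complete ; w-π = P.w-π ; w-OUnit = P.w-OUnit ; unique = P.Unique.unique }
        where module P = Properties gen ϖ-inverse

-- The valuation ring of K and its image in L

module DiscreteField {c ℓ : Level} (em : ∀ {P : Set ℓ} → Dec P) (K : CommutativeRing c ℓ)
  (inverse : HasInverses K)
  {v : CommutativeRing.Carrier K → ℤₘ₀} (dv : IsDiscreteValuation K v) where
  open CommutativeRing K hiding (zero)
  open Spans K
  open Solver K
  open import Algebra.Properties.Ring ring
  open import Relation.Binary.Reasoning.Setoid setoid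
  open IsDiscreteValuation dv public
  open ValuationProperties K isValuation public

  -- The greatest value below `𝟙` is `[ -1 ]`, so this is a uniformiser of K.
  ϖ : Carrier
  ϖ = proj₁ (surjective [ ℤ.-1ℤ ])

  v-ϖ : v ϖ ≡ [ ℤ.-1ℤ ]
  v-ϖ = proj₂ (surjective [ ℤ.-1ℤ ]) refl

  v≢𝟘⇒≉0 : ∀ {x i} → v x ≡ [ i ] → ¬ x ≈ 0#
  v≢𝟘⇒≉0 vx x≈0 = []≢𝟘 (≡.trans (≡.sym vx) (v-zero x≈0))

  v≡𝟘⇒zero : ∀ {x} → v x ≡ 𝟘 → x ≈ 0#
  v≡𝟘⇒zero = v≡𝟘⇒≈0 inverse (λ _ → em)

  ϖ⁻¹ : Carrier
  ϖ⁻¹ = proj₁ (inverse ϖ (v≢𝟘⇒≉0 v-ϖ))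

  ϖ-inverse : ϖ * ϖ⁻¹ ≈ 1#
  ϖ-inverse = proj₂ (inverse ϖ (v≢𝟘⇒≉0 v-ϖ))

  v-ϖ^ : ∀ n → v (ϖ ^ n) ≡ [ ℤ.- (ℤ.+ n) ]
  v-ϖ^ n = ≡.trans (v-^ ϖ n) (≡.trans (≡.cong (_^₀ n) v-ϖ) (≡.trans ([]-^₀ ℤ.-1ℤ n)
    (≡.cong [_] (≡.trans (ℤ.*-comm (ℤ.+ n) ℤ.-1ℤ) (ℤ.-1*i≡-i (ℤ.+ n))))))

  v-ϖ⁻¹^ : ∀ n → v (ϖ⁻¹ ^ n) ≡ [ ℤ.+ n ]
  v-ϖ⁻¹^ n =
      ≡.trans (v-inverse (^-inverse n ϖ-inverse) (v-ϖ^ n)) (≡.cong [_] (ℤ.neg-involutive (ℤ.+ n)))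

  divide-ϖ^ : ∀ n {x} → v x ≤₀ [ ℤ.- (ℤ.+ n) ] → ∃[ r ] v r ≤₀ 𝟙 × x ≈ ϖ ^ n * r
  divide-ϖ^ n {x} vx = ϖ⁻¹ ^ n * x ,
    ≤₀-trans (≤₀-reflexive (v-* _ x))
        (≤₀-trans (·-mono-≤₀ (≤₀-reflexive (v-ϖ⁻¹^ n)) vx)
        (≤₀-reflexive (≡.cong [_] (ℤ.+-inverseʳ (ℤ.+ n))))) ,
    (begin
      x                          ≈⟨ *-identityˡ x ⟨
      1# * x                     ≈⟨ *-congʳ (^-inverse n ϖ-inverse) ⟨
      ϖ ^ n * ϖ⁻¹ ^ n * x        ≈⟨ *-assoc _ _ _ ⟩
      ϖ ^ n * (ϖ⁻¹ ^ n * x)      ∎)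

  multiple-ϖ^ : ∀ n {x r} → v r ≤₀ 𝟙 → x ≈ ϖ ^ n * r → v x ≤₀ [ ℤ.- (ℤ.+ n) ]
  multiple-ϖ^ n {r = r} vr eq =
      ≤₀-trans (≤₀-reflexive (≡.trans (v-cong eq) (≡.trans (v-* _ r) (≡.cong (_· v r) (v-ϖ^ n)))))
    (·-decreasing [ ℤ.- (ℤ.+ n) ] vr)

  unit-inverse : ∀ {x} → v x ≡ 𝟙 → ∃[ y ] v y ≤₀ 𝟙 × x * y ≈ 1#
  unit-inverse vx = let y , xy = inverse _ (v≢𝟘⇒≉0 vx) in y , ≤₀-reflexive (v-inverse xy vx) , xy

  integral-dichotomy : ∀ {x} → v x ≤₀ 𝟙 → (∃[ y ] v y ≤₀ 𝟙 × x * y ≈ 1#) ⊎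
      (∃[ y ] v y ≤₀ 𝟙 × x ≈ ϖ * y)
  integral-dichotomy {x} vx = go (v x) ≡.refl vx
    where
    divisible : v x ≤₀ [ ℤ.-1ℤ ] → ∃[ y ] v y ≤₀ 𝟙 × x ≈ ϖ * y
    divisible vx = let r , vr , eq = divide-ϖ^ 1 vx in r , vr , trans eq (*-congʳ (*-identityʳ ϖ))

    go : ∀ γ → v x ≡ γ → γ ≤₀ 𝟙 → (∃[ y ] v y ≤₀ 𝟙 × x * y ≈ 1#) ⊎ (∃[ y ] v y ≤₀ 𝟙 × x ≈ ϖ * y)
    go ⊥₋               eq _ = inj₂ (divisible (≤₀-trans (≤₀-reflexive eq) (⊥₋≤ _)))
    go [ ℤ.+ zero ]     eq _ = inj₁ (unit-inverse eq)
    go [ ℤ.+ suc n ]    eq [ ℤ.+≤+ () ]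
    go [ -[1+ n ] ]     eq _ = inj₂ (divisible (≤₀-trans (≤₀-reflexive eq) [ ℤ.-≤- ℕ.z≤n ]))

  denominator : ∀ x → ∃[ m ] v (ϖ ^ m * x) ≤₀ 𝟙
  denominator x = go (v x) ≡.refl
    where
    go : ∀ γ → v x ≡ γ → ∃[ m ] v (ϖ ^ m * x) ≤₀ 𝟙
    go ⊥₋           eq = 0 , ≤₀-trans (≤₀-reflexive (≡.trans (v-cong (*-identityˡ x)) eq)) (⊥₋≤ _)
    go [ ℤ.+ n ]    eq =
        n , ≤₀-reflexive (≡.trans (v-* _ x)
        (≡.trans (≡.cong₂ _·_ (v-ϖ^ n) eq) (≡.cong [_] (ℤ.+-inverseˡ (ℤ.+ n)))))
    go [ -[1+ n ] ] eq = 0 , ≤₀-trans (≤₀-reflexive (≡.trans (v-cong (*-identityˡ x)) eq)) [ ℤ.-≤+ ]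

  v-ϖ^-≤𝟙 : ∀ n → v (ϖ ^ n) ≤₀ 𝟙
  v-ϖ^-≤𝟙 n = ≤₀-trans (≤₀-reflexive (v-ϖ^ n)) [ ℤ.neg-≤-pos {n} {0} ]

  integral-* : ∀ {x y} → v x ≤₀ 𝟙 → v y ≤₀ 𝟙 → v (x * y) ≤₀ 𝟙
  integral-* p r = ≤₀-trans (≤₀-reflexive (v-* _ _)) (·-≤𝟙 p r)

  common-denominator : ∀ {n} (k : Vector Carrier n) → ∃[ m ] (∀ i → v (ϖ ^ m * k i) ≤₀ 𝟙)
  common-denominator {zero}  k = 0 , λ ()
  common-denominator {suc n} k =
    let m , p = denominator (k zero)
        m′ , p′ = common-denominator (λ i → k (suc i))
    in m ℕ.+ m′ , λ
      { zero    → ≤₀-trans (≤₀-reflexive (v-cong (trans (*-congʳ (^-homo-* ϖ m m′))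
                    (solve 3 (λ u w x → u :* w :* x := w :* (u :* x)) refl (ϖ ^ m) (ϖ ^ m′)
                        (k zero)))))
                    (integral-* (v-ϖ^-≤𝟙 m′) p)
      ; (suc i) → ≤₀-trans
          (≤₀-reflexive (v-cong (trans (*-congʳ (^-homo-* ϖ m m′)) (*-assoc _ _ _))))
                    (integral-* (v-ϖ^-≤𝟙 m) (p′ i)) }

  v-separated : ∀ {x} → (∀ n → v x ≤₀ [ ℤ.- (ℤ.+ n) ]) → x ≈ 0#
  v-separated {x} h = v≡𝟘⇒zero (go (v x) h)
    where
    go : ∀ γ → (∀ n → γ ≤₀ [ ℤ.- (ℤ.+ n) ]) → γ ≡ 𝟘
    go ⊥₋           h = ≡.refl
    go [ ℤ.+ n ]    h with [≤]-injective (h 1)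
    ... | ()
    go [ -[1+ n ] ] h with [≤]-injective (h (suc (suc n)))
    ... | ℤ.-≤- n≥ = ⊥-elim (ℕ.1+n≰n n≥)

  maximal-entry : ∀ {n} (k : Vector Carrier (suc n)) → ∃[ p ] (∀ i → v (k i) ≤₀ v (k p))
  maximal-entry {zero}  k = zero , λ { zero → ≤₀-refl }
  maximal-entry {suc n} k =
    let p , h = maximal-entry (λ i → k (suc i)) in
    ⊎-elim (λ le → suc p , λ { zero → le ; (suc i) → h i })
           (λ le → zero , λ { zero → ≤₀-refl ; (suc i) → ≤₀-trans (h i) le })
           (≤₀-total (v (k zero)) (v (k (suc p))))

  -- The vector is divided by an entry of greatest value, which is nonzero because some entry is.
  normalise : ∀ {n} (k : Vector Carrier (suc n)) → (∃[ p ] ¬ k p ≈ 0#) →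
              ∃[ u ] (∀ i → v (k i * u) ≤₀ 𝟙) × (∃[ p ] k p * u ≈ 1#)
  normalise k (r , kr≉0) =
    let p , h = maximal-entry k
        kp≉0 = λ kp≈0 → kr≉0 (v≡𝟘⇒zero (below-𝟘 (≤₀-trans (h r) (≤₀-reflexive (v-zero kp≈0)))))
        u , inv = inverse (k p) kp≉0
    in u , (λ i → ≤₀-trans (≤₀-reflexive (v-* _ u)) (≤₀-trans (·-mono-≤₀ (h i) (≤₀-refl {v u}))
         (≤₀-reflexive (≡.trans (≡.sym (v-* _ u)) (≡.trans (v-cong inv) v-1))))) , p , inv
    where
    below-𝟘 : ∀ {γ} → γ ≤₀ 𝟘 → γ ≡ 𝟘
    below-𝟘 (⊥₋≤ _) = ≡.refl

  series-limit : IsComplete K v → ∀ d → (∀ n → v (d n) ≤₀ 𝟙) →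
                 ∃[ s ] (∀ n → ∃[ r ] v r ≤₀ 𝟙 × s ≈ partial ϖ d n + ϖ ^ n * r)
  series-limit complete d vd =
    let s , conv = complete⇒limit (partial ϖ d) (λ n → multiple-ϖ^ n (vd n)
                     (solve 2 (λ P u → P :+ u :- P := u) refl (partial ϖ d n) (ϖ ^ n * d n)))
                         complete
    in s , λ n → let r , vr , eq = divide-ϖ^ n (conv n) in r , vr ,
      trans (solve 2 (λ s P → s := P :+ (s :- P)) refl s (partial ϖ d n)) (+-congˡ eq)

module Extension {c₁ ℓ₁ c₂ ℓ₂ : Level} (em : EM) (K : CommutativeRing c₁ ℓ₁)
    (L : CommutativeRing c₂ ℓ₂)
  (K-inverse : HasInverses K) (L-inverse : HasInverses L) (L-1≉0 : Nontrivial L)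
  {v : CommutativeRing.Carrier K → ℤₘ₀} (dv : IsDiscreteValuation K v) (complete : IsComplete K v)
  (ι : CommutativeRing.Carrier K → CommutativeRing.Carrier L)
  (hom : RingMorphisms.IsRingHomomorphism (CommutativeRing.rawRing K) (CommutativeRing.rawRing L) ι)
  where
  private
    module K where
      open CommutativeRing K public
      open Spans K public
      open DiscreteField (em ℓ₁) K K-inverse dv public
  open CommutativeRing L hiding (zero)
  open Spans L
  open Solver L
  open import Algebra.Properties.Ring ring
  open import Relation.Binary.Reasoning.Setoid setoid
  open RingMorphisms.IsRingHomomorphism hom

  combine : ∀ {n} → Vector Carrier n → Vector K.Carrier n → Carrier
  combine b k = sum (λ i → ι (k i) * b i)

  Integral : Pred Carrier (c₁ ⊔ ℓ₂)
  Integral x = ∃[ k ] v k ≤₀ 𝟙 × x ≈ ι k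

  π : Carrier
  π = ι K.ϖ

  ι-^ : ∀ x n → ι (x K.^ n) ≈ ι x ^ n
  ι-^ x zero    = 1#-homo
  ι-^ x (suc n) = trans (*-homo x _) (*-congˡ (ι-^ x n))

  ι-inverse : ∀ {x y} → x K.* y K.≈ K.1# → ι x * ι y ≈ 1#
  ι-inverse xy = trans (sym (*-homo _ _)) (trans (⟦⟧-cong xy) 1#-homo)

  ι-≉0 : ∀ {x} → ¬ x K.≈ K.0# → ¬ ι x ≈ 0#
  ι-≉0 x≉0 ιx≈0 = let y , xy = K-inverse _ x≉0 in
    L-1≉0 (trans (sym (ι-inverse xy)) (trans (*-congʳ ιx≈0) (zeroˡ _)))

  ι-partial : ∀ d d′ → (∀ n → d n ≈ ι (d′ n)) → ∀ n → partial π d n ≈ ι (K.partial K.ϖ d′ n)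
  ι-partial d d′ eq zero    = sym 0#-homo
  ι-partial d d′ eq (suc n) = trans
    (+-cong (ι-partial d d′ eq n) (trans (*-cong (sym (ι-^ K.ϖ n)) (eq n)) (sym (*-homo _ _))))
        (sym (+-homo _ _))

  combine-* : ∀ {n} (b : Vector Carrier n) (u : K.Carrier) (k : Vector K.Carrier n) →
              combine b (λ i → u K.* k i) ≈ ι u * combine b k
  combine-* b u k = trans (sum-cong-≋ (λ i → trans (*-congʳ (*-homo u (k i))) (*-assoc _ _ _)))
    (sym (*-distribˡ-sum (ι u) (λ i → ι (k i) * b i)))

  combine-+ : ∀ {n} (b : Vector Carrier n) (k l : Vector K.Carrier n) →
              combine b (λ i → k i K.+ l i) ≈ combine b k + combine b l
  combine-+ b k l = trans (sum-cong-≋ (λ i → trans (*-congʳ (+-homo (k i) (l i))) (distribʳ _ _ _)))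
    (∑-distrib-+ (λ i → ι (k i) * b i) (λ i → ι (l i) * b i))

  combine-0 : ∀ {n} (b : Vector Carrier n) (k : Vector K.Carrier n) → (∀ i → k i K.≈ K.0#) →
              combine b k ≈ 0#
  combine-0 {zero}  b k k≈0 = refl
  combine-0 {suc n} b k k≈0 =
      trans (+-cong (trans (*-congʳ (trans (⟦⟧-cong (k≈0 zero)) 0#-homo)) (zeroˡ _))
    (combine-0 (λ i → b (suc i)) (λ i → k (suc i)) (λ i → k≈0 (suc i)))) (+-identityˡ 0#)

  combine-span : ∀ {n} (b : Vector Carrier n) k → (∀ i → v (k i) ≤₀ 𝟙) →
                 Span Integral (tabulate b) (combine b k)
  combine-span {zero}  b k vk = nil refl
  combine-span {suc n} b k vk = cons (k zero , vk zero , refl)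
    (combine-span (λ i → b (suc i)) (λ i → k (suc i)) (λ i → vk (suc i))) refl

  span-combine : ∀ {n} (b : Vector Carrier n) {x} → Span Integral (tabulate b) x →
                 ∃[ k ] (∀ i → v (k i) ≤₀ 𝟙) × x ≈ combine b k
  span-combine {zero}  b (nil x≈0) = (λ ()) , (λ ()) , x≈0
  span-combine {suc n} b (cons (k₀ , vk₀ , a≈) S x≈) =
    let k , vk , eq = span-combine (λ i → b (suc i)) S in
    k₀ Vector.∷ k , (λ { zero → vk₀ ; (suc i) → vk i }) , trans x≈ (+-cong (*-congʳ a≈) eq)

  module Finite {n : ℕ} (b : Vector Carrier n) (spanning : ∀ x → ∃[ k ] x ≈ combine b k)
    (independent : ∀ k → combine b k ≈ 0# → ∀ i → k i K.≈ K.0#) where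

    coordinates-unique : ∀ k l → combine b k ≈ combine b l → ∀ i → k i K.≈ l i
    coordinates-unique k l eq i = K.trans (K-difference (k i) (l i))
      (K.trans (K.+-congˡ (independent (λ i → k i K.+ K.- K.1# K.* l i) (begin
        combine b (λ i → k i K.+ K.- K.1# K.* l i)
          ≈⟨ combine-+ b k (λ i → K.- K.1# K.* l i) ⟩
        combine b k + combine b (λ i → K.- K.1# K.* l i)
          ≈⟨ +-cong eq (combine-* b (K.- K.1#) l) ⟩
        combine b l + ι (K.- K.1#) * combine b l
          ≈⟨ +-congˡ (*-congʳ (trans (-‿homo K.1#) (-‿cong 1#-homo))) ⟩
        combine b l + - 1# * combine b l
          ≈⟨ solve 1 (λ x → x :+ :- :1 :* x := :0) refl (combine b l) ⟩
        0# ∎) i)) (K.+-identityʳ (l i)))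
      where
      K-difference : ∀ x y → x K.≈ y K.+ (x K.+ K.- K.1# K.* y)
      K-difference = S.solve 2 (λ x y → x S.:= y S.:+ (x S.:+ S.:- S.:1 S.:* y)) K.refl
        where module S = Solver K

    Integral-spanning : ∀ x → ∃[ m ] Span Integral (tabulate b) (π ^ m * x)
    Integral-spanning x =
      let k , x≈ = spanning x
          m , vk = K.common-denominator k
      in m , span-resp (trans (combine-* b (K.ϖ K.^ m) k) (*-cong (ι-^ K.ϖ m) (sym x≈)))
          (combine-span b (λ i → K.ϖ K.^ m K.* k i) vk)
      where
      span-resp : ∀ {bs x y} → x ≈ y → Span Integral bs x → Span Integral bs y
      span-resp eq (nil x≈0)      = nil (trans (sym eq) x≈0)
      span-resp eq (cons Oa S x≈) = cons Oa S (trans (sym eq) x≈)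

    -- By uniqueness of coordinates, divisibility by `π ^ m` inside the span is divisibility of each
    -- coordinate by `ϖ ^ m`, and only 0 is divisible by all of these.
    Integral-separated : ∀ x → (∀ m → ∃[ y ] Span Integral (tabulate b) y × x ≈ π ^ m * y) → x ≈ 0#
    Integral-separated x h = let k , x≈ = spanning x in trans x≈
        (combine-0 b k λ i → K.v-separated λ m →
      let y , S , x≈π^y = h m
          l , vl , y≈ = span-combine b S
      in K.multiple-ϖ^ m (vl i) (coordinates-unique k (λ i → K.ϖ K.^ m K.* l i) (begin
        combine b k                             ≈⟨ x≈ ⟨
        x                                       ≈⟨ x≈π^y ⟩
        π ^ m * y                               ≈⟨ *-cong (sym (ι-^ K.ϖ m)) y≈ ⟩
        ι (K.ϖ K.^ m) * combine b l             ≈⟨ combine-* b (K.ϖ K.^ m) l ⟨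
        combine b (λ i → K.ϖ K.^ m K.* l i)     ∎) i))

    sum-combine : ∀ {m} (k : Vector K.Carrier m) (A : Fin m → Fin n → K.Carrier) →
                  sum (λ j → ι (k j) * combine b (A j)) ≈ combine b
                      (λ i → K.sum (λ j → k j K.* A j i))
    sum-combine {zero}  k A = sym (combine-0 b (λ _ → K.0#) (λ _ → K.refl))
    sum-combine {suc m} k A = trans
      (+-cong (sym (combine-* b (k zero) (A zero)))
          (sum-combine (λ j → k (suc j)) (λ j → A (suc j))))
      (sym (combine-+ b (λ i → k zero K.* A zero i)
          (λ i → K.sum (λ j → k (suc j) K.* A (suc j) i))))

    -- The coordinate vectors of n + 1 elements are dependent over K; normalising the relation makes
    -- one coefficient equal to 1.
    Integral-dependent : ∀ (x : Vector Carrier (suc n)) →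
                         Σ[ k ∈ Vector Carrier (suc n) ] (∀ i → Integral (k i)) ×
                         (∃[ i ] ∃[ y ] Integral y × k i * y ≈ 1#) × sum (λ i → k i * x i) ≈ 0#
    Integral-dependent x =
      let A = λ j → proj₁ (spanning (x j))
          k , nonzero , rel = LinearAlgebra.linear-dependence (em ℓ₁) K K-inverse K.1≉0 n A
          u , vku , p , kpu = K.normalise k nonzero
      in (λ i → ι (k i K.* u)) , (λ i → k i K.* u , vku i , refl) ,
         (p , 1# , (K.1# , ≤₀-reflexive K.v-1 , sym 1#-homo) ,
             trans (*-identityʳ _) (trans (⟦⟧-cong kpu) 1#-homo)) ,
         (begin
           sum (λ i → ι (k i K.* u) * x i)
             ≈⟨ sum-cong-≋
                 (λ i → trans (*-cong (trans (⟦⟧-cong (K.*-comm (k i) u)) (*-homo u (k i)))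
                 (proj₂ (spanning (x i)))) (*-assoc _ _ _)) ⟩
           sum (λ i → ι u * (ι (k i) * combine b (A i)))
             ≈⟨ *-distribˡ-sum (ι u) (λ i → ι (k i) * combine b (A i)) ⟨
           ι u * sum (λ i → ι (k i) * combine b (A i))
             ≈⟨ *-congˡ
                 (trans (sum-combine k A) (combine-0 b (λ i → K.sum (λ j → k j K.* A j i)) rel)) ⟩
           ι u * 0#
             ≈⟨ zeroʳ _ ⟩
           0# ∎)

    Integral-dichotomy : ∀ {x} → Integral x → (∃[ y ] Integral y × x * y ≈ 1#) ⊎
        (∃[ y ] Integral y × x ≈ π * y)
    Integral-dichotomy (k , vk , x≈) = ⊎-elim
      (λ (l , vl , kl) → inj₁ (ι l , (l , vl , refl) , trans (*-congʳ x≈) (ι-inverse kl)))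
      (λ (l , vl , k≈) → inj₂ (ι l , (l , vl , refl) , trans x≈ (trans (⟦⟧-cong k≈) (*-homo _ _))))
      (K.integral-dichotomy vk)

    Integral-complete : ∀ d → (∀ n → Integral (d n)) →
                        ∃[ s ] (∀ n → ∃[ r ] Integral r × s ≈ partial π d n + π ^ n * r)
    Integral-complete d Id =
      let s , conv = K.series-limit complete (λ n → proj₁ (Id n)) (λ n → proj₁ (proj₂ (Id n))) in
      ι s , λ n → let r , vr , eq = conv n in ι r , (r , vr , refl) ,
        trans (⟦⟧-cong eq) (trans (+-homo _ _) (+-cong
          (sym (ι-partial d (λ n → proj₁ (Id n)) (λ n → proj₂ (proj₂ (Id n))) n))
              (trans (*-homo _ _) (*-congʳ (ι-^ K.ϖ n)))))

    dvrLattice : DVRLattice (c₁ ⊔ ℓ₂)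
    dvrLattice = record
      { 1≉0         = L-1≉0
      ; inverse     = L-inverse
      ; O           = Integral
      ; O-resp      = λ x≈y (k , vk , eq) → k , vk , trans (sym x≈y) eq
      ; O-1         = K.1# , ≤₀-reflexive K.v-1 , sym 1#-homo
      ; O-+         =
          λ (k , vk , eq) (l , vl , eq′) → k K.+ l , K.v-+-≤ vk vl ,
          trans (+-cong eq eq′) (sym (+-homo k l))
      ; O-*         =
          λ (k , vk , eq) (l , vl , eq′) → k K.* l , K.integral-* vk vl ,
          trans (*-cong eq eq′) (sym (*-homo k l))
      ; O-neg       =
          λ (k , vk , eq) → K.- k , ≤₀-trans (≤₀-reflexive (K.v-neg k)) vk ,
          trans (-‿cong eq) (sym (-‿homo k))
      ; π           = π
      ; O-π         = K.ϖ , ≤₀-trans (≤₀-reflexive K.v-ϖ) [ ℤ.-≤+ ] , refl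
      ; π≉0         = ι-≉0 (K.v≢𝟘⇒≉0 K.v-ϖ)
      ; O-dichotomy = Integral-dichotomy
      ; O-complete  = Integral-complete
      ; basis       = tabulate b
      ; spanning    = Integral-spanning
      ; separated   = Integral-separated
      ; dim         = n
      ; dependent   = Integral-dependent
      }

  -- The ramification index

  module Ramification {w : Carrier → ℤₘ₀} (w-isValuation : IsValuation L w) {e : ℕ}
    (w-π : w π ≡ [ ℤ.- (ℤ.+ suc e) ]) (w-unit : ∀ {x} → v x ≡ 𝟙 → w (ι x) ≡ 𝟙) where
    open IsValuation w-isValuation

    w-ϖ^ : ∀ n → w (ι (K.ϖ K.^ n)) ≡ [ ℤ.- (ℤ.+ suc e ℤ.* ℤ.+ n) ]
    w-ϖ^ zero    = ≡.trans (w-unit K.v-1) (≡.cong (λ i → [ ℤ.- i ]) (≡.sym (ℤ.*-zeroʳ (ℤ.+ suc e))))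
    w-ϖ^ (suc n) =
        ≡.trans (v-cong (*-homo K.ϖ (K.ϖ K.^ n)))
        (≡.trans (v-* _ _) (≡.trans (≡.cong₂ _·_ w-π (w-ϖ^ n))
      (≡.cong [_]
          (≡.trans (≡.sym (ℤ.neg-distrib-+ (ℤ.+ suc e) (ℤ.+ suc e ℤ.* ℤ.+ n)))
          (≡.cong ℤ.-_ (≡.sym (ℤ.*-suc (ℤ.+ suc e) (ℤ.+ n))))))))

    -- Multiplication or division by a power of ϖ reduces x to value `𝟙`, where `w-unit` applies;
    -- the exponent is then read off from the value of π.
    w-extends : ∀ x → w (ι x) ≡ v x ^₀ suc e
    w-extends x = go (v x) ≡.refl
      where
      go : ∀ γ → v x ≡ γ → w (ι x) ≡ γ ^₀ suc e
      go ⊥₋ eq =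
          ValuationProperties.v-zero L w-isValuation (trans (⟦⟧-cong (K.v≡𝟘⇒zero eq)) 0#-homo)
      go [ ℤ.+ n ] eq = ≡.trans (·-inverse-unique (≡.trans (≡.cong (w (ι x) ·_) (≡.sym (w-ϖ^ n)))
        (≡.trans (≡.sym (v-* _ _)) (≡.trans (v-cong (sym (*-homo x (K.ϖ K.^ n)))) (w-unit unit)))))
        (≡.trans (≡.cong [_] (ℤ.neg-involutive (ℤ.+ suc e ℤ.* ℤ.+ n)))
            (≡.sym ([]-^₀ (ℤ.+ n) (suc e))))
        where
        unit : v (x K.* K.ϖ K.^ n) ≡ 𝟙
        unit = ≡.trans (K.v-* x _)
            (≡.trans (≡.cong₂ _·_ eq (K.v-ϖ^ n)) (≡.cong [_] (ℤ.+-inverseʳ (ℤ.+ n))))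
      go [ -[1+ n ] ] eq =
          ≡.trans (v-cong (⟦⟧-cong x≈))
          (≡.trans (v-cong (*-homo (K.ϖ K.^ suc n) _)) (≡.trans (v-* _ _)
        (≡.trans (≡.cong₂ _·_ (w-ϖ^ (suc n)) (w-unit unit)) (≡.trans (·-identityʳ _)
          (≡.trans (≡.cong [_] (ℤ.neg-distribʳ-* (ℤ.+ suc e) (ℤ.+ suc n)))
              (≡.sym ([]-^₀ -[1+ n ] (suc e))))))))
        where
        t : K.Carrier
        t = K.ϖ⁻¹ K.^ suc n K.* x

        x≈ : x K.≈ K.ϖ K.^ suc n K.* t
        x≈ = K.trans (K.sym (K.*-identityˡ x))
            (K.trans (K.*-congʳ (K.sym (K.^-inverse (suc n) K.ϖ-inverse))) (K.*-assoc _ _ _))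

        unit : v t ≡ 𝟙
        unit = ≡.trans (K.v-* _ x)
            (≡.trans (≡.cong₂ _·_ (K.v-ϖ⁻¹^ (suc n)) eq) (≡.cong [_] (ℤ.+-inverseʳ (ℤ.+ suc n))))

-- Classical fields and the theorem

module FieldProperties {c ℓ a : Level} (em : EM) (F : HeytingField c ℓ a) where
  open HeytingField F hiding (refl)
  private module R = CommutativeRing ⟦ F ⟧
  open Solver ⟦ F ⟧

  minus-0 : ∀ x → x + - 0# ≈ x
  minus-0 = solve 1 (λ x → x :- :0 := x) R.refl

  -- Tightness and excluded middle make x apart from 0. The field axiom then inverts the difference
  -- of x and 0, which is why `minus-0` is applied.
  field-inverse : ∀ x → ¬ x ≈ 0# → ∃[ y ] x * y ≈ 1#
  field-inverse x x≉0 =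
    let y , _ , xy = #⇒invertible (decidable-stable (em a) λ ¬# → x≉0 (proj₁ (tight x 0#) ¬#)) in
    y , R.trans (R.*-congʳ (R.sym (minus-0 x))) xy

  -- In the zero ring the difference of 1 with itself would be invertible, making 1 apart from
  -- itself.
  1≉0 : ¬ 1# ≈ 0#
  1≉0 1≈0 = #-irrefl R.refl (invertible⇒# {1#} {1#} (1# , all-equal _ _ , all-equal _ _))
    where
    all-equal : ∀ x y → x ≈ y
    all-equal x y = R.trans (zero! x) (R.sym (zero! y))
      where
      zero! : ∀ x → x ≈ 0#
      zero! x = R.trans (R.sym (R.*-identityˡ x)) (R.trans (R.*-congʳ 1≈0) (R.zeroˡ x))

mainTheorem6 : EM →
    ∀ {c₁ ℓ₁ e₁ c₂ ℓ₂ e₂}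
    (K : HeytingField c₁ ℓ₁ e₁) (L : HeytingField c₂ ℓ₂ e₂)
    (ι : HeytingField.Carrier K → HeytingField.Carrier L) →
    IsFiniteExtension K L ι →
    (v : HeytingField.Carrier K → ℤₘ₀) →
    IsDiscreteValuation ⟦ K ⟧ v →
    IsComplete ⟦ K ⟧ v →
    Σ[ w ∈ ∃! _≗_ (λ w → IsDiscreteValuation ⟦ L ⟧ w × Extends K L ι v w) ]
    IsComplete ⟦ L ⟧ (proj₁ w)
mainTheorem6 em {ℓ₁ = ℓ₁} K L ι fin v dv complete =
  (w , (isDiscreteValuation , suc e , ℕ.s≤s ℕ.z≤n , w-extends) , λ (dw′ , ext) →
      unique dw′ (integral-≤𝟙 dw′ ext)) , isComplete
  where
  module FK = FieldProperties em K
  module FL = FieldProperties em L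
  module DK = DiscreteField (em ℓ₁) ⟦ K ⟧ FK.field-inverse dv
  open IsFiniteExtension fin
  open IsBasis isBasis
  module Ext =
      Extension em ⟦ K ⟧ ⟦ L ⟧ FK.field-inverse FL.field-inverse FL.1≉0 dv complete ι
      isRingHomomorphism
  module R = IntegralClosure em ⟦ L ⟧ (Ext.Finite.dvrLattice basis spanning independent)

  w : HeytingField.Carrier L → ℤₘ₀
  w = proj₁ R.normalisedExtension

  open R.IsNormalisedExtension (proj₂ R.normalisedExtension)

  -- `suc e` is the ramification index, the degree of the image of a uniformiser of K; it is
  -- positive because that image is not a unit of R.
  e : ℕ
  e = proj₁ w-π

  w-unit : ∀ {x} → v x ≡ 𝟙 → w (ι x) ≡ 𝟙
  w-unit {x} vx = let y , vy , xy = DK.unit-inverse vx in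
    w-OUnit (x , ≤₀-reflexive vx , CommutativeRing.refl ⟦ L ⟧)
      (ι y , (y , vy , CommutativeRing.refl ⟦ L ⟧) , Ext.ι-inverse xy)

  w-extends : ∀ x → w (ι x) ≡ v x ^₀ suc e
  w-extends =
      Ext.Ramification.w-extends (IsDiscreteValuation.isValuation isDiscreteValuation) (proj₂ w-π)
      w-unit

  -- Uniqueness is applied to a second extension through this bound, which holds whatever its
  -- exponent `e′` is.
  integral-≤𝟙 : ∀ {w′} → IsDiscreteValuation ⟦ L ⟧ w′ → Extends K L ι v w′ → ∀ {x} →
                Ext.Integral x → w′ x ≤₀ 𝟙
  integral-≤𝟙 dw′ (e′ , _ , ext) (k , vk , x≈) =
    ≤₀-trans (≤₀-reflexive (≡.trans (IsDiscreteValuation.v-cong dw′ x≈) (ext k))) (^₀-≤𝟙 e′ vk)
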